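{- Let $d\ge 1$, and let $T$, $K$, $X_1,\dots,X_d$ be as in the context. Define coefficients $\alpha_{\mathbf n}$, $\mathbf n\in\mathbb{N}_0^d$, with unspecified values $\alpha_{\mathbf e_1},\dots,\alpha_{\mathbf e_d}$ (regarded as indeterminates), as follows: $\alpha_{\boldsymbol 0}=0$; for $\mathbf n=n_\ell\mathbf e_\ell$ with $n_\ell\ge1$, $1\le \ell\le d$, $$\alpha_{\mathbf n}=\frac{\alpha_{\mathbf e_\ell}^{n_\ell}X_\ell^{n_\ell-1}(1-X_\ell^{n_\ell d})}{(1-X_\ell^d)(1-X_\ell)^{n_\ell-1}(1-X_\ell^{d+1})^{n_\ell-1}};$$ and for all other $\mathbf n$ (at least two nonzero coordinates) recursively by $$\alpha_{\mathbf n}\Big(-\frac{1}{zT^{2d}}+\sum_{\ell=-d}^{d}\mathbf X^{\ell\mathbf n}\Big)=\sum_{\ell=2}^{2d+1}(-1)^\ell\sum_{\mathbf g_1+\dots+\mathbf g_\ell=\mathbf n}\Big(\prod_{k=1}^{\ell}\alpha_{\mathbf g_k}\Big)\sum_{\{b_1<\dots<b_\ell\}\subseteq\{ -d,\dots,d\}}\ \prod_{k=1}^{\ell}\mathbf X^{b_k\mathbf g_k},$$ where the middle sum is over ordered tuples of vectors $\mathbf g_k\in\mathbb{N}_0^d\setminus\{\boldsymbol 0\}$. For $j\in\mathbb{Z}$ put $$\rho_j=\sum_{\mathbf n\in\mathbb{N}_0^d}\alpha_{\mathbf n}\mathbf X^{j\mathbf n}.$$ Then the formal power series $T_j=T(1-\rho_j)$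 satisfies $$T_j=1+z\prod_{\ell=-d}^{d}T_{j+\ell},\qquad j\in\mathbb{Z}.$$ Equivalently, for all $j\in\mathbb{Z}$, $$\rho_j=zT^{2d}\sum_{\ell=1}^{2d+1}(-1)^{\ell-1}\sum_{\{b_1,\dots,b_\ell\}\subseteq\{ -d,\dots,d\}}\ \prod_{k=1}^{\ell}\rho_{j+b_k},$$ the inner sum being over all subsets of size $\ell$.
   Context: $T=T(z)$ is the formal power series with $T(0)=1$ and $T=1+zT^{2d+1}$ (generating function of $(2d+1)$-ary trees). $K=\bigcup_{m\ge1}\mathbb{C}((z^{1/m}))$ is the field of Puiseux series in $z$. $X_1,\dots,X_d\in K$ are the $d$ small solutions (those of positive order in $z$, i.e. tending to $0$ as $z\to0$) of the characteristic equation $$1=zT^{2d}\sum_{\ell=-d}^{d}X^\ell .$$ Notation: $\mathbb{N}_0=\{0,1,2,\dots\}$; $\mathbf e_\ell$ is the $\ell$-th unit vector of $\mathbb{N}_0^d$; for $\mathbf n=(n_1,\dots,n_d)$ and $m\in\mathbb{Z}$, $\mathbf X^{m\mathbf n}=X_1^{mn_1}\cdots X_d^{mn_d}$. Each $\alpha_{\mathbf n}$ is an element of $K$ times the monomial $\prod_{\ell}\alpha_{\mathbf e_\ell}^{n_\ell}$, and $\rho_j,T_j$ are regarded as formal power series in the indeterminates $\alpha_{\mathbf e_1},\dots,\alpha_{\mathbf e_d}$ with coefficients in $K$. -}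

module Defs where

open import Algebra.Bundles using (CommutativeMonoid)
open import Algebra.Bundles.Raw using (RawRing)
import Algebra.Properties.CommutativeSemigroup as CommutativeSemigroupProperties
import Algebra.Definitions.RawSemiring as RawSemiringDefinitions
open import Data.Bool.Base using (if_then_else_)
open import Data.Fin.Base using (Fin)
open import Data.Integer.Base as ℤ using (ℤ; +_; -[1+_]; _⊖_)
open import Data.List.Base as List
  using (List; []; _∷_; _++_; map; concatMap; cartesianProductWith; applyUpTo; allFin)
open import Data.Nat.Base as ℕ using (ℕ; zero; suc; NonZero; _⊔_)
open import Data.Nat.Divisibility using (_∣?_)
open import Data.Nat.DivMod using (_/_)
import Data.Nat.Properties as ℕ
open import Data.Product.Base using (Σ-syntax; _×_; _,_)
open import Data.Rational.Base as ℚ using (ℚ; 0ℚ; 1ℚ; ½; ∣_∣; 1/_; Positive; positive)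
import Data.Rational.Properties as ℚ
open import Data.Vec.Base as Vec using (Vec; []; _∷_; lookup; replicate; _[_]≔_)
import Data.Vec.Properties as Vec
open import Level using (0ℓ)
open import Relation.Binary.Definitions using (DecidableEquality)
open import Relation.Binary.PropositionalEquality
  using (_≡_; _≢_; refl; sym; trans; cong; cong₂; subst; module ≡-Reasoning)
open import Relation.Nullary.Decidable.Core using (does)
open import Relation.Nullary.Negation.Core using (¬_)

------------------------------------------------------------------------
-- Real numbers: Cauchy sequences of rationals, equal when their
-- difference tends to 0

IsCauchy : (ℕ → ℚ) → Set
IsCauchy x = ∀ ε → 0ℚ ℚ.< ε →
  Σ[ N ∈ ℕ ] (∀ m n → N ℕ.≤ m → N ℕ.≤ n → ∣ x m ℚ.- x n ∣ ℚ.< ε)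

record ℝ : Set where
  constructor real
  field
    approx : ℕ → ℚ
    cauchy : IsCauchy approx
open ℝ public

infix 4 _≈ℝ_

_≈ℝ_ : ℝ → ℝ → Set
x ≈ℝ y = ∀ ε → 0ℚ ℚ.< ε →
  Σ[ N ∈ ℕ ] (∀ n → N ℕ.≤ n → ∣ approx x n ℚ.- approx y n ∣ ℚ.< ε)

abstract
  cauchy-const : ∀ q → IsCauchy (λ _ → q)
  cauchy-const q ε 0<ε =
    0 , λ _ _ _ _ → subst (λ p → ∣ p ∣ ℚ.< ε) (sym (ℚ.+-inverseʳ q)) 0<ε

  half : ∀ ε → 0ℚ ℚ.< ε → 0ℚ ℚ.< ½ ℚ.* ε
  half ε 0<ε = ℚ.positive⁻¹ _ {{ℚ.pos*pos⇒pos ½ ε {{positive 0<ε}}}}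

  halves : ∀ ε → ½ ℚ.* ε ℚ.+ ½ ℚ.* ε ≡ ε
  halves ε = trans (sym (ℚ.*-distribʳ-+ ε ½ ½)) (ℚ.*-identityˡ ε)

  +-difference : ∀ a b c e → (a ℚ.+ b) ℚ.- (c ℚ.+ e) ≡ (a ℚ.- c) ℚ.+ (b ℚ.- e)
  +-difference a b c e = trans
    (cong (a ℚ.+ b ℚ.+_) (ℚ.neg-distrib-+ c e))
    (CommutativeSemigroupProperties.interchange
      (CommutativeMonoid.commutativeSemigroup ℚ.+-0-commutativeMonoid) a b (ℚ.- c) (ℚ.- e))

  minus-plus : ∀ a b → a ≡ (a ℚ.- b) ℚ.+ b
  minus-plus a b = sym (trans (ℚ.+-assoc a (ℚ.- b) b)
    (trans (cong (a ℚ.+_) (ℚ.+-inverseˡ b)) (ℚ.+-identityʳ a)))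

  *-difference : ∀ a b c e → a ℚ.* b ℚ.- c ℚ.* e ≡ a ℚ.* (b ℚ.- e) ℚ.+ e ℚ.* (a ℚ.- c)
  *-difference a b c e = begin
    a ℚ.* b ℚ.- c ℚ.* e
      ≡⟨ cong (ℚ._- c ℚ.* e) (minus-plus (a ℚ.* b) (a ℚ.* e)) ⟩
    (a ℚ.* b ℚ.- a ℚ.* e) ℚ.+ a ℚ.* e ℚ.- c ℚ.* e
      ≡⟨ ℚ.+-assoc (a ℚ.* b ℚ.- a ℚ.* e) (a ℚ.* e) (ℚ.- (c ℚ.* e)) ⟩
    (a ℚ.* b ℚ.- a ℚ.* e) ℚ.+ (a ℚ.* e ℚ.- c ℚ.* e)
      ≡⟨ cong₂ ℚ._+_ (distrib a b e)
           (trans (cong₂ ℚ._-_ (ℚ.*-comm a e) (ℚ.*-comm c e)) (distrib e a c)) ⟩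
    a ℚ.* (b ℚ.- e) ℚ.+ e ℚ.* (a ℚ.- c) ∎
    where
    open ≡-Reasoning
    distrib : ∀ p q r → p ℚ.* q ℚ.- p ℚ.* r ≡ p ℚ.* (q ℚ.- r)
    distrib p q r = sym (trans (ℚ.*-distribˡ-+ p q (ℚ.- r))
      (cong (p ℚ.* q ℚ.+_) (sym (ℚ.neg-distribʳ-* p r))))

  cauchy-+ : ∀ {x y} → IsCauchy x → IsCauchy y → IsCauchy (λ n → x n ℚ.+ y n)
  cauchy-+ {x} {y} cx cy ε 0<ε with cx _ (half ε 0<ε) | cy _ (half ε 0<ε)
  ... | N , p | M , q = N ⊔ M , λ m n N≤m N≤n → begin-strict
    ∣ (x m ℚ.+ y m) ℚ.- (x n ℚ.+ y n) ∣
      ≡⟨ cong ∣_∣ (+-difference (x m) (y m) (x n) (y n)) ⟩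
    ∣ (x m ℚ.- x n) ℚ.+ (y m ℚ.- y n) ∣
      ≤⟨ ℚ.∣p+q∣≤∣p∣+∣q∣ (x m ℚ.- x n) (y m ℚ.- y n) ⟩
    ∣ x m ℚ.- x n ∣ ℚ.+ ∣ y m ℚ.- y n ∣
      <⟨ ℚ.+-mono-< (p m n (ℕ.m⊔n≤o⇒m≤o N M N≤m) (ℕ.m⊔n≤o⇒m≤o N M N≤n))
                    (q m n (ℕ.m⊔n≤o⇒n≤o N M N≤m) (ℕ.m⊔n≤o⇒n≤o N M N≤n)) ⟩
    ½ ℚ.* ε ℚ.+ ½ ℚ.* ε
      ≡⟨ halves ε ⟩
    ε ∎
    where open ℚ.≤-Reasoning

  cauchy-neg : ∀ {x} → IsCauchy x → IsCauchy (λ n → ℚ.- x n)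
  cauchy-neg {x} cx ε 0<ε with cx ε 0<ε
  ... | N , p = N , λ m n N≤m N≤n →
    subst (ℚ._< ε) (trans (sym (ℚ.∣-p∣≡∣p∣ (x m ℚ.- x n)))
                          (cong ∣_∣ (ℚ.neg-distrib-+ (x m) (ℚ.- x n))))
          (p m n N≤m N≤n)

  bounded : ∀ {x} → IsCauchy x →
            Σ[ N ∈ ℕ ] Σ[ B ∈ ℚ ] Positive B × (∀ n → N ℕ.≤ n → ∣ x n ∣ ℚ.≤ B)
  bounded {x} cx with cx 1ℚ (ℚ.positive⁻¹ 1ℚ)
  ... | N , p = N , 1ℚ ℚ.+ ∣ x N ∣
    , ℚ.pos+nonNeg⇒pos 1ℚ ∣ x N ∣ {{ℚ.nonNegative (ℚ.0≤∣p∣ (x N))}}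
    , λ n N≤n → begin
    ∣ x n ∣
      ≡⟨ cong ∣_∣ (minus-plus (x n) (x N)) ⟩
    ∣ (x n ℚ.- x N) ℚ.+ x N ∣
      ≤⟨ ℚ.∣p+q∣≤∣p∣+∣q∣ (x n ℚ.- x N) (x N) ⟩
    ∣ x n ℚ.- x N ∣ ℚ.+ ∣ x N ∣
      ≤⟨ ℚ.+-monoˡ-≤ ∣ x N ∣ (ℚ.<⇒≤ (p n N N≤n ℕ.≤-refl)) ⟩
    1ℚ ℚ.+ ∣ x N ∣ ∎
    where open ℚ.≤-Reasoning

  shrink : ∀ B → Positive B → ∀ ε → 0ℚ ℚ.< ε →
           Σ[ δ ∈ ℚ ] 0ℚ ℚ.< δ × B ℚ.* δ ≡ ε
  shrink B B>0 ε 0<ε = δ , ℚ.positive⁻¹ δ {{δ>0}} , (begin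
    B ℚ.* (1/B ℚ.* ε)   ≡⟨ ℚ.*-assoc B 1/B ε ⟨
    (B ℚ.* 1/B) ℚ.* ε   ≡⟨ cong (ℚ._* ε) (ℚ.*-inverseʳ B {{B≢0}}) ⟩
    1ℚ ℚ.* ε            ≡⟨ ℚ.*-identityˡ ε ⟩
    ε                   ∎)
    where
    open ≡-Reasoning
    B≢0 : ℚ.NonZero B
    B≢0 = ℚ.pos⇒nonZero B {{B>0}}
    1/B δ : ℚ
    1/B = (1/ B) {{B≢0}}
    δ   = 1/B ℚ.* ε
    δ>0 : Positive δ
    δ>0 = ℚ.pos*pos⇒pos 1/B {{ℚ.1/pos⇒pos B {{B>0}}}} ε {{positive 0<ε}}

  cauchy-* : ∀ {x y} → IsCauchy x → IsCauchy y → IsCauchy (λ n → x n ℚ.* y n)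
  cauchy-* {x} {y} cx cy ε 0<ε with bounded {x} cx | bounded {y} cy
  ... | N₁ , A , A>0 , ∣x∣≤A | N₂ , B , B>0 , ∣y∣≤B
    with shrink A A>0 _ (half ε 0<ε) | shrink B B>0 _ (half ε 0<ε)
  ... | δ , 0<δ , Aδ≡ | η , 0<η , Bη≡ with cy δ 0<δ | cx η 0<η
  ... | N₃ , p | N₄ , q = (N₁ ⊔ N₂) ⊔ (N₃ ⊔ N₄) , λ m n N≤m N≤n →
    let
      N₁₂≤m = ℕ.m⊔n≤o⇒m≤o (N₁ ⊔ N₂) (N₃ ⊔ N₄) N≤m
      N₁₂≤n = ℕ.m⊔n≤o⇒m≤o (N₁ ⊔ N₂) (N₃ ⊔ N₄) N≤n
      N₃₄≤m = ℕ.m⊔n≤o⇒n≤o (N₁ ⊔ N₂) (N₃ ⊔ N₄) N≤m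
      N₃₄≤n = ℕ.m⊔n≤o⇒n≤o (N₁ ⊔ N₂) (N₃ ⊔ N₄) N≤n
      ∣y-y∣<δ = p m n (ℕ.m⊔n≤o⇒m≤o N₃ N₄ N₃₄≤m) (ℕ.m⊔n≤o⇒m≤o N₃ N₄ N₃₄≤n)
      ∣x-x∣<η = q m n (ℕ.m⊔n≤o⇒n≤o N₃ N₄ N₃₄≤m) (ℕ.m⊔n≤o⇒n≤o N₃ N₄ N₃₄≤n)
    in begin-strict
    ∣ x m ℚ.* y m ℚ.- x n ℚ.* y n ∣
      ≡⟨ cong ∣_∣ (*-difference (x m) (y m) (x n) (y n)) ⟩
    ∣ x m ℚ.* (y m ℚ.- y n) ℚ.+ y n ℚ.* (x m ℚ.- x n) ∣
      ≤⟨ ℚ.∣p+q∣≤∣p∣+∣q∣ (x m ℚ.* (y m ℚ.- y n)) (y n ℚ.* (x m ℚ.- x n)) ⟩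
    ∣ x m ℚ.* (y m ℚ.- y n) ∣ ℚ.+ ∣ y n ℚ.* (x m ℚ.- x n) ∣
      <⟨ ℚ.+-mono-<
           (bound A A>0 (x m) (y m ℚ.- y n) (∣x∣≤A m (ℕ.m⊔n≤o⇒m≤o N₁ N₂ N₁₂≤m)) ∣y-y∣<δ)
           (bound B B>0 (y n) (x m ℚ.- x n) (∣y∣≤B n (ℕ.m⊔n≤o⇒n≤o N₁ N₂ N₁₂≤n)) ∣x-x∣<η) ⟩
    A ℚ.* δ ℚ.+ B ℚ.* η
      ≡⟨ cong₂ ℚ._+_ Aδ≡ Bη≡ ⟩
    ½ ℚ.* ε ℚ.+ ½ ℚ.* ε
      ≡⟨ halves ε ⟩
    ε ∎
    where
    open ℚ.≤-Reasoning
    bound : ∀ C → Positive C → ∀ u v {γ} → ∣ u ∣ ℚ.≤ C → ∣ v ∣ ℚ.< γ → ∣ u ℚ.* v ∣ ℚ.< C ℚ.* γ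
    bound C C>0 u v {γ} ∣u∣≤C ∣v∣<γ = begin-strict
      ∣ u ℚ.* v ∣      ≡⟨ ℚ.∣p*q∣≡∣p∣*∣q∣ u v ⟩
      ∣ u ∣ ℚ.* ∣ v ∣  ≤⟨ ℚ.*-monoʳ-≤-nonNeg ∣ v ∣ {{ℚ.nonNegative (ℚ.0≤∣p∣ v)}} ∣u∣≤C ⟩
      C ℚ.* ∣ v ∣      <⟨ ℚ.*-monoʳ-<-pos C {{C>0}} ∣v∣<γ ⟩
      C ℚ.* γ          ∎

fromℚ : ℚ → ℝ
fromℚ q = real (λ _ → q) (cauchy-const q)

infixl 6 _+ℝ_
infixl 7 _*ℝ_
infix  8 -ℝ_

_+ℝ_ _*ℝ_ : ℝ → ℝ → ℝ
real x cx +ℝ real y cy = real (λ n → x n ℚ.+ y n) (cauchy-+ {x} {y} cx cy)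
real x cx *ℝ real y cy = real (λ n → x n ℚ.* y n) (cauchy-* {x} {y} cx cy)

-ℝ_ : ℝ → ℝ
-ℝ real x cx = real (λ n → ℚ.- x n) (cauchy-neg {x} cx)

------------------------------------------------------------------------
-- Complex numbers, (a , b) standing for a + b i

ℂ : RawRing 0ℓ 0ℓ
ℂ = record
  { Carrier = ℝ × ℝ
  ; _≈_     = λ (a , b) (c , e) → (a ≈ℝ c) × (b ≈ℝ e)
  ; _+_     = λ (a , b) (c , e) → a +ℝ c , b +ℝ e
  ; _*_     = λ (a , b) (c , e) → a *ℝ c +ℝ -ℝ (b *ℝ e) , a *ℝ e +ℝ b *ℝ c
  ; -_      = λ (a , b) → -ℝ a , -ℝ b
  ; 0#      = fromℚ 0ℚ , fromℚ 0ℚ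
  ; 1#      = fromℚ 1ℚ , fromℚ 0ℚ
  }

------------------------------------------------------------------------
-- Notation in an arbitrary ring

module Notation (R : RawRing 0ℓ 0ℓ) where
  open RawRing R
  open RawSemiringDefinitions rawSemiring public using (_^_)

  infixl 6 _-_
  _-_ : Carrier → Carrier → Carrier
  x - y = x + - y

  ∑ ∏ : {A : Set} → List A → (A → Carrier) → Carrier
  ∑ xs f = List.foldr (λ x s → f x + s) 0# xs
  ∏ xs f = List.foldr (λ x p → f x * p) 1# xs

record Unit (R : RawRing 0ℓ 0ℓ) : Set where
  open RawRing R
  field
    value inverse : Carrier
    isInverse     : value * inverse ≈ 1#
open Unit public

infixr 8 _^ᶻ_

_^ᶻ_ : {R : RawRing 0ℓ 0ℓ} → Unit R → ℤ → RawRing.Carrier R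
_^ᶻ_ {R} u (+ n)    = value u ^ n where open Notation R
_^ᶻ_ {R} u -[1+ n ] = inverse u ^ suc n where open Notation R

------------------------------------------------------------------------
-- Formal power series.  The exponents range over a type I with zero
-- exponent o, and split n lists each (i , j) with i + j = n once.

module Series (R : RawRing 0ℓ 0ℓ)
              {I : Set} (_≟_ : DecidableEquality I) (o : I)
              (split : I → List (I × I)) where
  open RawRing R
  open Notation R

  monomial : Carrier → I → (I → Carrier)
  monomial c n m = if does (m ≟ n) then c else 0#

  constant : Carrier → (I → Carrier)
  constant c = monomial c o

  ring : RawRing 0ℓ 0ℓ
  ring = record
    { Carrier = I → Carrier
    ; _≈_     = λ f g → ∀ n → f n ≈ g n
    ; _+_     = λ f g n → f n + g n
    ; _*_     = λ f g n → ∑ (split n) λ (i , j) → f i * g j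
    ; -_      = λ f n → - f n
    ; 0#      = λ _ → 0#
    ; 1#      = constant 1#
    }

  -- The sum of a family (f n) in which f n is divisible by the monomial
  -- with exponent n, so that only f i with i + j = n for some j
  -- contributes to the coefficient at n.
  ∑∞ : (I → I → Carrier) → (I → Carrier)
  ∑∞ f n = ∑ (split n) λ (i , _) → f i n

splitℕ : ℕ → List (ℕ × ℕ)
splitℕ zero    = (0 , 0) ∷ []
splitℕ (suc n) = (0 , suc n) ∷ map (λ (i , j) → suc i , j) (splitℕ n)

splitVec : ∀ {d} → Vec ℕ d → List (Vec ℕ d × Vec ℕ d)
splitVec []       = ([] , []) ∷ []
splitVec (n ∷ ns) =
  cartesianProductWith (λ (i , j) (is , js) → i ∷ is , j ∷ js) (splitℕ n) (splitVec ns)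

module UnivariateSeries (R : RawRing 0ℓ 0ℓ) = Series R ℕ._≟_ 0 splitℕ

module MultivariateSeries (R : RawRing 0ℓ 0ℓ) (d : ℕ) =
  Series R (Vec.≡-dec ℕ._≟_) (replicate d 0) splitVec

------------------------------------------------------------------------
-- Laurent series: t^- pole · body, where body may vanish at 0

record LaurentSeries (R : RawRing 0ℓ 0ℓ) : Set where
  constructor t^-_·_
  field
    pole : ℕ
    body : ℕ → RawRing.Carrier R

module Laurent (R : RawRing 0ℓ 0ℓ) where
  open RawRing R
  private module S = RawRing (UnivariateSeries.ring R)

  t^_·_ : ℕ → (ℕ → Carrier) → (ℕ → Carrier)
  (t^ zero  · f) n       = f n
  (t^ suc k · f) zero    = 0#
  (t^ suc k · f) (suc n) = (t^ k · f) n

  ring : RawRing 0ℓ 0ℓ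
  ring = record
    { Carrier = LaurentSeries R
    ; _≈_     = λ (t^- p · f) (t^- q · g) → (t^ q · f) S.≈ (t^ p · g)
    ; _+_     = λ (t^- p · f) (t^- q · g) → t^- (p ℕ.+ q) · ((t^ q · f) S.+ (t^ p · g))
    ; _*_     = λ (t^- p · f) (t^- q · g) → t^- (p ℕ.+ q) · (f S.* g)
    ; -_      = λ (t^- p · f) → t^- p · (S.- f)
    ; 0#      = t^- 0 · S.0#
    ; 1#      = t^- 0 · S.1#
    }

  substPower : (k : ℕ) .{{_ : NonZero k}} → LaurentSeries R → LaurentSeries R
  substPower k (t^- p · f) =
    t^- (k ℕ.* p) · λ n → if does (k ∣? n) then f (n / k) else 0#

------------------------------------------------------------------------
-- Puiseux series: series is a Laurent series in t = z^(1/ram)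

record PuiseuxSeries (R : RawRing 0ℓ 0ℓ) : Set where
  constructor puiseux
  field
    ram         : ℕ
    .{{ram≢0}}  : NonZero ram
    series      : LaurentSeries R

module Puiseux (R : RawRing 0ℓ 0ℓ) where
  open RawRing R
  open Laurent R using (substPower)
  private module L = RawRing (Laurent.ring R)

  ring : RawRing 0ℓ 0ℓ
  ring = record
    { Carrier = PuiseuxSeries R
    ; _≈_     = λ (puiseux m x) (puiseux n y) → substPower n x L.≈ substPower m y
    ; _+_     = λ (puiseux m x) (puiseux n y) →
                  puiseux (m ℕ.* n) {{ℕ.m*n≢0 m n}} (substPower n x L.+ substPower m y)
    ; _*_     = λ (puiseux m x) (puiseux n y) →
                  puiseux (m ℕ.* n) {{ℕ.m*n≢0 m n}} (substPower n x L.* substPower m y)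
    ; -_      = λ (puiseux m x) → puiseux m (L.- x)
    ; 0#      = puiseux 1 L.0#
    ; 1#      = puiseux 1 L.1#
    }

  embed : (ℕ → Carrier) → PuiseuxSeries R
  embed f = puiseux 1 (t^- 0 · f)

  HasPositiveOrder : PuiseuxSeries R → Set
  HasPositiveOrder (puiseux m (t^- p · f)) = ∀ n → n ℕ.≤ p → f n ≈ 0#

------------------------------------------------------------------------
-- Finite index sets

-- All integers from m to n, for m ≤ n.
range : ℕ → ℕ → List ℕ
range m n = applyUpTo (m ℕ.+_) (suc n ℕ.∸ m)

-- -d , … , d
window : ℕ → List ℤ
window d = applyUpTo (_⊖ d) (2 ℕ.* d ℕ.+ 1)

-- The ℓ-element subsequences of a list; those of window d are the
-- b₁ < … < b_ℓ in {-d , … , d}.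
choose : {A : Set} (ℓ : ℕ) → List A → List (Vec A ℓ)
choose zero    xs       = [] ∷ []
choose (suc ℓ) []       = []
choose (suc ℓ) (x ∷ xs) = map (x ∷_) (choose ℓ xs) ++ choose (suc ℓ) xs

module _ {d : ℕ} where

  infix 4 _≟ᵛ_

  _≟ᵛ_ : DecidableEquality (Vec ℕ d)
  _≟ᵛ_ = Vec.≡-dec ℕ._≟_

  𝟘 : Vec ℕ d
  𝟘 = replicate d 0

  infix 8 _·e_

  _·e_ : ℕ → Fin d → Vec ℕ d
  k ·e i = 𝟘 [ i ]≔ k

  -- Ordered ℓ-tuples of nonzero vectors with sum n.
  compositions : (ℓ : ℕ) → Vec ℕ d → List (Vec (Vec ℕ d) ℓ)
  compositions zero    n = if does (n ≟ᵛ 𝟘) then [] ∷ [] else []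
  compositions (suc ℓ) n =
    concatMap (λ (g , h) → if does (g ≟ᵛ 𝟘) then [] else map (g ∷_) (compositions ℓ h))
              (splitVec n)

  HasTwoNonzeroCoordinates : Vec ℕ d → Set
  HasTwoNonzeroCoordinates n =
    Σ[ i ∈ Fin d ] Σ[ j ∈ Fin d ] i ≢ j × lookup n i ≢ 0 × lookup n j ≢ 0

------------------------------------------------------------------------
-- The coefficients α_n, as power series in the indeterminates α_{e_ℓ}
-- over a ring K

module Coefficients (K : RawRing 0ℓ 0ℓ) (d : ℕ) where

  open MultivariateSeries K d public
    using (monomial; constant; ∑∞) renaming (ring to K⟦α⟧)

  private
    module K where
      open RawRing K public
      open Notation K public
  module K⟦α⟧ where
    open RawRing K⟦α⟧ public
    open Notation K⟦α⟧ public
  open K⟦α⟧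

  -- X ^[ m · n ] = X₁^(m n₁) ⋯ X_d^(m n_d)
  _^[_·_] : (Fin d → Unit K) → ℤ → Vec ℕ d → K.Carrier
  X ^[ m · n ] = K.∏ (allFin d) λ i → X i ^ᶻ (m ℤ.* + lookup n i)

  indeterminate : Fin d → Carrier
  indeterminate ℓ = monomial K.1# (1 ·e ℓ)

  -- A quotient x = y / u is expressed as x * u ≈ y, the denominators u
  -- being nonzero; w is the unit z T^(2d).
  record IsCoefficientFamily (w : Unit K) (X : Fin d → Unit K)
                             (α : Vec ℕ d → Carrier) : Set where
    field
      isMonomial : ∀ n → Σ[ c ∈ K.Carrier ] α n ≈ monomial c n

      α-zero : α 𝟘 ≈ 0#

      α-unit : ∀ ℓ → α (1 ·e ℓ) ≈ indeterminate ℓ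

      α-axis : ∀ ℓ k → 1 ℕ.≤ k → let x = value (X ℓ) in
        α (k ·e ℓ) * constant ((K.1# K.- x K.^ d)
                                 K.* (K.1# K.- x) K.^ (k ℕ.∸ 1)
                                 K.* (K.1# K.- x K.^ (d ℕ.+ 1)) K.^ (k ℕ.∸ 1))
        ≈ α (1 ·e ℓ) ^ k * constant (x K.^ (k ℕ.∸ 1) K.* (K.1# K.- x K.^ (k ℕ.* d)))

      α-mixed : ∀ n → HasTwoNonzeroCoordinates n →
        α n * constant (K.- inverse w K.+ K.∑ (window d) λ ℓ → X ^[ ℓ · n ])
        ≈ ∑ (range 2 (2 ℕ.* d ℕ.+ 1)) λ ℓ → (- 1#) ^ ℓ *
            ∑ (compositions ℓ n) λ g →
              ∏ (allFin ℓ) (λ k → α (lookup g k)) *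
              ∑ (choose ℓ (window d)) λ b →
                ∏ (allFin ℓ) λ k → constant (X ^[ lookup b k · lookup g k ])

  module _ (X : Fin d → Unit K) (α : Vec ℕ d → Carrier) where

    ρ : ℤ → Carrier
    ρ j = ∑∞ λ n → α n * constant (X ^[ j · n ])

    Tⱼ : K.Carrier → ℤ → Carrier
    Tⱼ T j = constant T * (1# - ρ j)

------------------------------------------------------------------------
-- The series T, the field K and the small solutions

ℂ⟦z⟧ K : RawRing 0ℓ 0ℓ
ℂ⟦z⟧ = UnivariateSeries.ring ℂ
K    = Puiseux.ring ℂ

module ℂ = RawRing ℂ
module ℂ⟦z⟧ where
  open RawRing ℂ⟦z⟧ public
  open Notation ℂ⟦z⟧ public
module K where
  open RawRing K public
  open Notation K public
open Puiseux ℂ public using (embed; HasPositiveOrder)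

z : ℂ⟦z⟧.Carrier
z = UnivariateSeries.monomial ℂ ℂ.1# 1

IsTreeSeries : ℕ → ℂ⟦z⟧.Carrier → Set
IsTreeSeries d T =
  (T 0 ℂ.≈ ℂ.1#) × (T ℂ⟦z⟧.≈ ℂ⟦z⟧.1# ℂ⟦z⟧.+ z ℂ⟦z⟧.* T ℂ⟦z⟧.^ (2 ℕ.* d ℕ.+ 1))

zT²ᵈ : ℕ → ℂ⟦z⟧.Carrier → K.Carrier
zT²ᵈ d T = embed z K.* embed T K.^ (2 ℕ.* d)

IsSmallSolution : ℕ → ℂ⟦z⟧.Carrier → Unit K → Set
IsSmallSolution d T x =
  HasPositiveOrder (value x) × (K.1# K.≈ zT²ᵈ d T K.* K.∑ (window d) λ ℓ → x ^ᶻ ℓ)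

-- The equation has exactly d small solutions, so X lists all of them.
AreTheSmallSolutions : (d : ℕ) → ℂ⟦z⟧.Carrier → (Fin d → Unit K) → Set
AreTheSmallSolutions d T X =
  (∀ i → IsSmallSolution d T (X i)) ×
  (∀ i j → i ≢ j → ¬ (value (X i) K.≈ value (X j)))

{-# OPTIONS --safe #-}

-- Both claims amount to ρ_j = w (1 - ∏_b (1 - ρ_{j+b})), where w = z T^(2d) and
-- b runs over -d , … , d.  Scaling the coefficient at n by X^(jn) is a ring
-- automorphism taking ρ_b to ρ_{j+b}, so j = 0 suffices.  There the coefficients
-- are compared at each n.  If n has two nonzero coordinates, this is the
-- recursion defining α_n.  If n lies on the axis ℓ, restrict to that axis and
-- put x = X_ℓ: after rescaling the variable u, ρ_b becomes
--   (1 - x) (1 - x^(d+1)) x^b u / ((1 - x^(b+1) u) (1 - x^(b+d+1) u)),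
-- hence 1 - ρ_b = (1 - x^b u) (1 - x^(b+d+2) u) / ((1 - x^(b+1) u) (1 - x^(b+d+1) u)),
-- and the product over b telescopes.  Denominators are cleared by cancelling
-- the elements 1 - x^m, which are regular in K because x has positive order.

module Submission where

open import Algebra.Bundles using (AbelianGroup; CommutativeMonoid; CommutativeRing)
open import Algebra.Bundles.Raw using (RawRing)
open import Algebra.Morphism.Structures using (IsRingMonomorphism)
import Algebra.Morphism.RingMonomorphism as RingMonomorphism
import Algebra.Properties.AbelianGroup as AbelianGroupProperties
import Algebra.Properties.CommutativeSemigroup as CommutativeSemigroupProperties
import Algebra.Properties.CommutativeSemiring.Exp as Exp
import Algebra.Properties.Ring as RingProperties
import Algebra.Properties.Semiring.Mult.TCOptimised as Mult
import Algebra.Solver.Ring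
import Algebra.Solver.Ring.AlmostCommutativeRing as ACR
open import Algebra.Structures using (IsCommutativeMonoid; IsCommutativeRing)
open import Data.Bool.Base using (if_then_else_)
open import Data.Fin.Base as Fin using (Fin; zero; suc)
import Data.Fin.Properties as Fin
open import Data.Integer.Base as ℤ using (ℤ; +_; -[1+_]; _⊖_)
import Data.Integer.Properties as ℤ
open import Data.List.Base as List
  using (List; []; _∷_; _++_; map; concatMap; cartesianProductWith; applyUpTo; allFin; length)
open import Data.List.Membership.Propositional using (_∈_; find)
open import Data.List.Membership.Propositional.Properties
  using (∈-map⁺; ∈-map⁻; ∈-concatMap⁻; ∈-cartesianProductWith⁺; ∈-cartesianProductWith⁻)
import Data.List.Properties as List
open import Data.List.Relation.Unary.Any using (here; there)
import Data.Maybe.Base as Maybe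
open import Data.Nat.Base as ℕ using (ℕ; zero; suc; NonZero)
open import Data.Nat.Divisibility
  using (_∣_; divides-refl; _∣?_; _∣0; ∣-refl; n∣m*n; m∣m*n; ∣m∣n⇒∣m+n; ∣m+n∣m⇒∣n; *-monoˡ-∣; >⇒∤)
open import Data.Nat.DivMod using (_/_; m*n/n≡m)
open import Data.Nat.Induction using (<-rec)
import Data.Nat.Properties as ℕ
open import Data.Product.Base using (Σ-syntax; _×_; _,_; proj₁; proj₂)
open import Data.Rational.Base as ℚ using (ℚ; 0ℚ; 1ℚ; ½)
import Data.Rational.Properties as ℚ
open import Data.Sum.Base using (inj₁; inj₂)
open import Data.Vec.Base as Vec using (Vec; []; _∷_; lookup; replicate)
import Data.Vec.Properties as Vec
open import Function.Base using (_∘_)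
open import Level using (0ℓ)
open import Relation.Binary.Definitions using (DecidableEquality; WeaklyDecidable)
open import Relation.Binary.PropositionalEquality as ≡ using (_≡_; _≢_)
import Relation.Binary.Reasoning.Setoid as SetoidReasoning
open import Relation.Nullary.Decidable.Core using (does; yes; no; dec⇒maybe)
open import Relation.Nullary.Negation.Core using (¬_; contradiction)

open import Defs

-- The axes need a closed form because the recursion breaks down there: at n = e_ℓ the factor of
-- α_n, which is -1/w plus the sum of X_ℓ^b over the window, vanishes by the characteristic
-- equation. The same equation closes the axis computation. With x = X_ℓ the telescoped product is
-- (1 - x^(-d) u)(1 - x^(2d+2) u) / ((1 - x u)(1 - x^(d+1) u)). In 1 minus this product the terms in
-- u^2 of the numerator cancel, leaving (x^(-d) - x^(d+1))(1 - x^(d+1)) u, whose first factor is 1 -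
-- x times the window sum, that is, (1 - x)/w. The obstacle is that complex coefficients are pairs
-- of Cauchy sequences: equality with zero is undecidable, so inverses in `K` cannot be found by
-- inspecting leading coefficients. Hence `K` is used only as a commutative ring, whose laws are
-- established layer by layer (real, complex, Laurent, Puiseux), and the combinatorial argument runs
-- over an arbitrary commutative ring.

IsCommutativeRawRing : RawRing 0ℓ 0ℓ → Set
IsCommutativeRawRing R = IsCommutativeRing _≈_ _+_ _*_ -_ 0# 1#
  where open RawRing R

bundle : (R : RawRing 0ℓ 0ℓ) → IsCommutativeRawRing R → CommutativeRing 0ℓ 0ℓ
bundle R isCR = record { isCommutativeRing = isCR }

suc-⊖ : ∀ i d → suc i ⊖ d ≡ i ⊖ d ℤ.+ + 1
suc-⊖ i d = ≡.trans (≡.sym (ℤ.distribʳ-⊖-+-pos 1 i d)) (ℤ.+-comm (+ 1) (i ⊖ d))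

-- The first integer past `window d`, where telescoping sums and products stop.
window-end : ∀ d → (2 ℕ.* d ℕ.+ 1) ⊖ d ≡ + suc d
window-end d = ≡.trans
  (≡.cong (_⊖ d) (≡.trans (≡.cong (λ k → d ℕ.+ k ℕ.+ 1) (ℕ.+-identityʳ d)) (ℕ.+-assoc d d 1)))
  (≡.trans (ℤ.⊖-≥ (ℕ.m≤m+n d (d ℕ.+ 1)))
           (≡.cong +_ (≡.trans (ℕ.m+n∸m≡n d (d ℕ.+ 1)) (ℕ.+-comm d 1))))

-- Commutative rings: solver, regular elements, finite sums and products, telescoping

module RingTheory (R : RawRing 0ℓ 0ℓ) (isCR : IsCommutativeRawRing R) where
  open CommutativeRing (bundle R isCR) hiding (rawRing; _-_; zero) public
  open Notation R public
  open RingProperties ring public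
    using (-‿distribˡ-*; -‿distribʳ-*; -0#≈0#)

  open AbelianGroupProperties +-abelianGroup public using (⁻¹-∙-comm; ⁻¹-involutive)
    renaming (x∙y⁻¹≈ε⇒x≈y to x-y≈0⇒x≈y; x≈y⇒x∙y⁻¹≈ε to x≈y⇒x-y≈0)
  open Exp commutativeSemiring public using (^-congˡ; ^-homo-*; ^-distrib-*; ^-assocʳ)
  open CommutativeSemigroupProperties *-commutativeSemigroup public using (x∙yz≈z∙yx)
  open SetoidReasoning setoid public

  -- Equality in `R` need not be decidable, so polynomials are normalised with integer coefficients.
  -- Distinct integers may have equal images in `R`; the solver only has to recognise equal
  -- integers, hence the weakly decidable equality.
  module Solver where
    open Mult semiring using (×-homo-+; ×1-homo-*; 1+×) renaming (_×_ to infixl 8 _⋆_)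

    ℤ-ring : RawRing 0ℓ 0ℓ
    ℤ-ring = CommutativeRing.rawRing ℤ.+-*-commutativeRing

    fromℤ : ℤ → Carrier
    fromℤ (+ n)    = n ⋆ 1#
    fromℤ -[1+ n ] = - (suc n ⋆ 1#)

    cancel-common : ∀ a x y → (a + x) - (a + y) ≈ x - y
    cancel-common a x y = begin
      (a + x) + - (a + y)    ≈⟨ +-cong (+-comm a x) (sym (⁻¹-∙-comm a y)) ⟩
      (x + a) + (- a + - y)  ≈⟨ +-assoc x a _ ⟩
      x + (a + (- a + - y))  ≈⟨ +-congˡ (sym (+-assoc a (- a) (- y))) ⟩
      x + ((a - a) + - y)    ≈⟨ +-congˡ (+-congʳ (-‿inverseʳ a)) ⟩
      x + (0# + - y)         ≈⟨ +-congˡ (+-identityˡ (- y)) ⟩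
      x - y                  ∎

    ⊖-homo : ∀ m n → fromℤ (m ⊖ n) ≈ m ⋆ 1# - n ⋆ 1#
    ⊖-homo m       zero    = sym (trans (+-congˡ -0#≈0#) (+-identityʳ _))
    ⊖-homo zero    (suc n) = sym (+-identityˡ _)
    ⊖-homo (suc m) (suc n) = begin
      fromℤ (suc m ⊖ suc n)            ≡⟨ ≡.cong fromℤ (ℤ.[1+m]⊖[1+n]≡m⊖n m n) ⟩
      fromℤ (m ⊖ n)                    ≈⟨ ⊖-homo m n ⟩
      m ⋆ 1# - n ⋆ 1#                  ≈⟨ cancel-common 1# _ _ ⟨
      (1# + m ⋆ 1#) - (1# + n ⋆ 1#)    ≈⟨ +-cong (1+× m 1#) (-‿cong (1+× n 1#)) ⟨
      suc m ⋆ 1# - suc n ⋆ 1#          ∎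

    +-homo : ∀ i j → fromℤ (i ℤ.+ j) ≈ fromℤ i + fromℤ j
    +-homo (+ m)    (+ n)    = ×-homo-+ 1# m n
    +-homo (+ m)    -[1+ n ] = ⊖-homo m (suc n)
    +-homo -[1+ m ] (+ n)    = trans (⊖-homo n (suc m)) (+-comm _ _)
    +-homo -[1+ m ] -[1+ n ] = begin
      - (suc (suc (m ℕ.+ n)) ⋆ 1#)     ≡⟨ ≡.cong (λ k → - (k ⋆ 1#)) (≡.sym (ℕ.+-suc (suc m) n)) ⟩
      - ((suc m ℕ.+ suc n) ⋆ 1#)       ≈⟨ -‿cong (×-homo-+ 1# (suc m) (suc n)) ⟩
      - (suc m ⋆ 1# + suc n ⋆ 1#)      ≈⟨ ⁻¹-∙-comm _ _ ⟨
      - (suc m ⋆ 1#) - suc n ⋆ 1#      ∎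

    neg-homo : ∀ i → fromℤ (ℤ.- i) ≈ - fromℤ i
    neg-homo (+ zero)  = sym -0#≈0#
    neg-homo (+ suc n) = refl
    neg-homo -[1+ n ]  = sym (⁻¹-involutive _)

    *-homo⁺ : ∀ m j → fromℤ (+ m ℤ.* j) ≈ fromℤ (+ m) * fromℤ j
    *-homo⁺ m (+ n)    = trans (reflexive (≡.cong fromℤ (≡.sym (ℤ.pos-* m n)))) (×1-homo-* m n)
    *-homo⁺ m -[1+ n ] = begin
      fromℤ (+ m ℤ.* ℤ.- (+ suc n))    ≡⟨ ≡.cong fromℤ (ℤ.neg-distribʳ-* (+ m) (+ suc n)) ⟨
      fromℤ (ℤ.- (+ m ℤ.* + suc n))    ≈⟨ neg-homo (+ m ℤ.* + suc n) ⟩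
      - fromℤ (+ m ℤ.* + suc n)        ≈⟨ -‿cong (*-homo⁺ m (+ suc n)) ⟩
      - (m ⋆ 1# * suc n ⋆ 1#)          ≈⟨ -‿distribʳ-* _ _ ⟩
      m ⋆ 1# * - (suc n ⋆ 1#)          ∎

    *-homo : ∀ i j → fromℤ (i ℤ.* j) ≈ fromℤ i * fromℤ j
    *-homo (+ m)    j = *-homo⁺ m j
    *-homo -[1+ m ] j = begin
      fromℤ (ℤ.- (+ suc m) ℤ.* j)      ≡⟨ ≡.cong fromℤ (ℤ.neg-distribˡ-* (+ suc m) j) ⟨
      fromℤ (ℤ.- (+ suc m ℤ.* j))      ≈⟨ neg-homo (+ suc m ℤ.* j) ⟩
      - fromℤ (+ suc m ℤ.* j)          ≈⟨ -‿cong (*-homo⁺ (suc m) j) ⟩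
      - (suc m ⋆ 1# * fromℤ j)         ≈⟨ -‿distribˡ-* _ _ ⟩
      - (suc m ⋆ 1#) * fromℤ j         ∎

    homomorphism : ℤ-ring ACR.-Raw-AlmostCommutative⟶ ACR.fromCommutativeRing (bundle R isCR)
    homomorphism = record
      { ⟦_⟧    = fromℤ
      ; +-homo = +-homo
      ; *-homo = *-homo
      ; -‿homo = neg-homo
      ; 0-homo = refl
      ; 1-homo = refl
      }

    _≟_ : WeaklyDecidable (ACR.Induced-equivalence homomorphism)
    i ≟ j = Maybe.map (λ p → reflexive (≡.cong fromℤ p)) (dec⇒maybe (i ℤ.≟ j))

    open Algebra.Solver.Ring ℤ-ring _ homomorphism _≟_ public
      using (solve; _:=_; _:+_; _:*_; _:-_; :-_; con)

    one zer : ∀ {n} → Algebra.Solver.Ring.Polynomial ℤ-ring _ homomorphism _≟_ n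
    one = con (+ 1)
    zer = con (+ 0)

  open Solver using (solve; _:=_; _:+_; _:*_; _:-_; :-_; one; zer)

  [1-cz]f : ∀ c z f → (1# - c * z) * f ≈ f - c * (z * f)
  [1-cz]f = solve 3 (λ c z f → (one :- c :* z) :* f := f :- c :* (z :* f)) refl

  -- Non-zero-divisors take the place of invertible elements: a quotient is handled by multiplying
  -- both sides of an equation by its denominator and cancelling at the end.
  Regular : Carrier → Set
  Regular c = ∀ v → c * v ≈ 0# → v ≈ 0#

  regular-cancel : ∀ {c} → Regular c → ∀ {x y} → c * x ≈ c * y → x ≈ y
  regular-cancel {c} reg {x} {y} p = x-y≈0⇒x≈y x y (reg (x - y) (begin
    c * (x - y)    ≈⟨ solve 3 (λ c x y → c :* (x :- y) := c :* x :- c :* y) refl c x y ⟩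
    c * x - c * y  ≈⟨ x≈y⇒x-y≈0 p ⟩
    0#             ∎))

  regular-cong : ∀ {c e} → c ≈ e → Regular c → Regular e
  regular-cong c≈e reg v ev≈0 = reg v (trans (*-congʳ c≈e) ev≈0)

  regular-* : ∀ {c e} → Regular c → Regular e → Regular (c * e)
  regular-* {c} {e} reg-c reg-e v p = reg-e v (reg-c (e * v) (trans (sym (*-assoc c e v)) p))

  regular-^ : ∀ {c} n → Regular c → Regular (c ^ n)
  regular-^ zero    reg v p = trans (sym (*-identityˡ v)) p
  regular-^ (suc n) reg     = regular-* reg (regular-^ n reg)

  regular-∏ : {A : Set} (xs : List A) {f : A → Carrier} → (∀ x → Regular (f x)) → Regular (∏ xs f)
  regular-∏ []       reg v p = trans (sym (*-identityˡ v)) p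
  regular-∏ (x ∷ xs) reg     = regular-* (reg x) (regular-∏ xs reg)

  module _ {A : Set} where

    ∑-cong-∈ : ∀ (xs : List A) {f g} → (∀ {x} → x ∈ xs → f x ≈ g x) → ∑ xs f ≈ ∑ xs g
    ∑-cong-∈ []       p = refl
    ∑-cong-∈ (x ∷ xs) p = +-cong (p (here ≡.refl)) (∑-cong-∈ xs (p ∘ there))

    ∑-cong : ∀ (xs : List A) {f g} → (∀ x → f x ≈ g x) → ∑ xs f ≈ ∑ xs g
    ∑-cong xs p = ∑-cong-∈ xs (λ {x} _ → p x)

    ∑-0 : ∀ (xs : List A) {f} → (∀ x → f x ≈ 0#) → ∑ xs f ≈ 0#
    ∑-0 []       p = refl
    ∑-0 (x ∷ xs) p = trans (+-cong (p x) (∑-0 xs p)) (+-identityˡ 0#)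

    ∑-+ : ∀ (xs : List A) f g → ∑ xs (λ x → f x + g x) ≈ ∑ xs f + ∑ xs g
    ∑-+ []       f g = sym (+-identityˡ 0#)
    ∑-+ (x ∷ xs) f g = trans (+-congˡ (∑-+ xs f g))
      (solve 4 (λ a b c d → (a :+ b) :+ (c :+ d) := (a :+ c) :+ (b :+ d)) refl _ _ _ _)

    *-∑ : ∀ (xs : List A) c f → c * ∑ xs f ≈ ∑ xs (λ x → c * f x)
    *-∑ []       c f = zeroʳ c
    *-∑ (x ∷ xs) c f = trans (distribˡ c _ _) (+-congˡ (*-∑ xs c f))

    ∑-* : ∀ (xs : List A) f c → ∑ xs f * c ≈ ∑ xs (λ x → f x * c)
    ∑-* []       f c = zeroˡ c
    ∑-* (x ∷ xs) f c = trans (distribʳ c _ _) (+-congˡ (∑-* xs f c))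

    ∑-++ : ∀ (xs ys : List A) f → ∑ (xs ++ ys) f ≈ ∑ xs f + ∑ ys f
    ∑-++ []       ys f = sym (+-identityˡ _)
    ∑-++ (x ∷ xs) ys f = trans (+-congˡ (∑-++ xs ys f)) (sym (+-assoc _ _ _))

    ∏-cong : ∀ (xs : List A) {f g} → (∀ x → f x ≈ g x) → ∏ xs f ≈ ∏ xs g
    ∏-cong []       p = refl
    ∏-cong (x ∷ xs) p = *-cong (p x) (∏-cong xs p)

    ∏-* : ∀ (xs : List A) f g → ∏ xs (λ x → f x * g x) ≈ ∏ xs f * ∏ xs g
    ∏-* []       f g = sym (*-identityˡ 1#)
    ∏-* (x ∷ xs) f g = trans (*-congˡ (∏-* xs f g))
      (solve 4 (λ a b c d → (a :* b) :* (c :* d) := (a :* c) :* (b :* d)) refl _ _ _ _)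

    ∏-scale : ∀ (xs : List A) c f → ∏ xs (λ x → c * f x) ≈ c ^ length xs * ∏ xs f
    ∏-scale []       c f = sym (*-identityˡ 1#)
    ∏-scale (x ∷ xs) c f = trans (*-congˡ (∏-scale xs c f))
      (solve 4 (λ a b c d → (a :* b) :* (c :* d) := (a :* c) :* (b :* d)) refl _ _ _ _)

  module _ {A B : Set} where

    ∑-map : ∀ (h : A → B) (xs : List A) f → ∑ (map h xs) f ≡ ∑ xs (f ∘ h)
    ∑-map h xs f = List.foldr-map _ h 0# xs

    ∏-map : ∀ (h : A → B) (xs : List A) f → ∏ (map h xs) f ≡ ∏ xs (f ∘ h)
    ∏-map h xs f = List.foldr-map _ h 1# xs

  module _ {A B : Set} where

    ∑-swap : ∀ (xs : List A) (ys : List B) (F : A → B → Carrier) →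
             ∑ xs (λ x → ∑ ys (F x)) ≈ ∑ ys (λ y → ∑ xs (λ x → F x y))
    ∑-swap []       ys F = sym (∑-0 ys (λ _ → refl))
    ∑-swap (x ∷ xs) ys F = trans (+-congˡ (∑-swap xs ys F)) (sym (∑-+ ys _ _))

    ∑-concatMap : ∀ (h : A → List B) (xs : List A) f →
                  ∑ (concatMap h xs) f ≈ ∑ xs (λ x → ∑ (h x) f)
    ∑-concatMap h []       f = refl
    ∑-concatMap h (x ∷ xs) f = trans (∑-++ (h x) _ f) (+-congˡ (∑-concatMap h xs f))

    ∑-cartesianProductWith : ∀ {C : Set} (h : A → B → C) (xs : List A) (ys : List B) f →
      ∑ (cartesianProductWith h xs ys) f ≈ ∑ xs (λ x → ∑ ys (λ y → f (h x y)))
    ∑-cartesianProductWith h []       ys f = refl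
    ∑-cartesianProductWith h (x ∷ xs) ys f = begin
      ∑ (map (h x) ys ++ cartesianProductWith h xs ys) f
        ≈⟨ ∑-++ (map (h x) ys) _ f ⟩
      ∑ (map (h x) ys) f + ∑ (cartesianProductWith h xs ys) f
        ≈⟨ +-cong (reflexive (∑-map (h x) ys f)) (∑-cartesianProductWith h xs ys f) ⟩
      ∑ ys (λ y → f (h x y)) + ∑ xs (λ x → ∑ ys (λ y → f (h x y))) ∎

  ∏-allFin-suc : ∀ ℓ (f : Fin (suc ℓ) → Carrier) →
    ∏ (allFin (suc ℓ)) f ≡ f zero * ∏ (allFin ℓ) (f ∘ suc)
  ∏-allFin-suc ℓ f = ≡.cong (f zero *_)
    (≡.trans (≡.cong (λ l → ∏ l f) (≡.sym (List.map-tabulate (λ i → i) suc)))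
             (∏-map suc (allFin ℓ) f))

  ∏-shift : ∀ {A : Set} (g : A → Carrier) (h : ℕ → A) n →
    ∏ (applyUpTo h n) g * g (h n) ≈ g (h 0) * ∏ (applyUpTo (h ∘ suc) n) g
  ∏-shift g h zero    = *-comm _ _
  ∏-shift g h (suc n) = begin
    (g (h 0) * ∏ (applyUpTo (h ∘ suc) n) g) * g (h (suc n))  ≈⟨ *-assoc _ _ _ ⟩
    g (h 0) * (∏ (applyUpTo (h ∘ suc) n) g * g (h (suc n)))  ≈⟨ *-congˡ (∏-shift g (h ∘ suc) n) ⟩
    g (h 0) * ∏ (applyUpTo (h ∘ suc) (suc n)) g              ∎

  esym : ∀ {A : Set} → (A → Carrier) → ℕ → List A → Carrier
  esym f ℓ xs = ∑ (choose ℓ xs) λ b → ∏ (allFin ℓ) λ k → f (lookup b k)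

  -- Subsets containing the head are separated from those avoiding it.
  esym-∷ : ∀ {A : Set} (f : A → Carrier) ℓ x xs →
           esym f (suc ℓ) (x ∷ xs) ≈ f x * esym f ℓ xs + esym f (suc ℓ) xs
  esym-∷ f ℓ x xs = begin
    ∑ (map (x ∷_) (choose ℓ xs) ++ choose (suc ℓ) xs) F
      ≈⟨ ∑-++ (map (x ∷_) (choose ℓ xs)) _ F ⟩
    ∑ (map (x ∷_) (choose ℓ xs)) F + esym f (suc ℓ) xs
      ≡⟨ ≡.cong (_+ _) (∑-map (x ∷_) (choose ℓ xs) F) ⟩
    ∑ (choose ℓ xs) (λ b → F (x ∷ b)) + esym f (suc ℓ) xs
      ≈⟨ +-congʳ (∑-cong (choose ℓ xs) (λ b → reflexive (∏-allFin-suc ℓ _))) ⟩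
    ∑ (choose ℓ xs) (λ b → f x * ∏ (allFin ℓ) λ k → f (lookup b k)) + esym f (suc ℓ) xs
      ≈⟨ +-congʳ (*-∑ (choose ℓ xs) (f x) _) ⟨
    f x * esym f ℓ xs + esym f (suc ℓ) xs ∎
    where
    F : Vec _ (suc ℓ) → Carrier
    F b = ∏ (allFin (suc ℓ)) λ k → f (lookup b k)

  -- Vieta's formula. The bound `n` may exceed the length, since surplus degrees have no subsets to
  -- sum over. This freedom drives the induction: by `esym-∷` the tail is used once with bound
  -- `suc n` and once, multiplied by the head, with bound `n`.
  ∏[1-f] : ∀ {A : Set} (f : A → Carrier) (xs : List A) n → length xs ℕ.≤ n →
    ∏ xs (λ x → 1# - f x) ≈ ∑ (range 0 n) (λ ℓ → (- 1#) ^ ℓ * esym f ℓ xs)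
  ∏[1-f] f [] n _ = begin
    1#                                            ≈⟨ +-identityʳ 1# ⟨
    1# + 0#                                       ≈⟨ +-cong one≈ (sym rest) ⟩
    1# * (1# + 0#) + ∑ (applyUpTo suc n) term     ∎
    where
    term : ℕ → Carrier
    term ℓ = (- 1#) ^ ℓ * esym f ℓ []
    one≈ : 1# ≈ 1# * (1# + 0#)
    one≈ = sym (trans (*-identityˡ _) (+-identityʳ 1#))
    rest : ∑ (applyUpTo suc n) term ≈ 0#
    rest = trans (reflexive (≡.trans (≡.cong (λ l → ∑ l term) (≡.sym (List.map-upTo suc n)))
                                     (∑-map suc (List.upTo n) term)))
                 (∑-0 (List.upTo n) (λ ℓ → zeroʳ _))
  ∏[1-f] {A} f (x ∷ xs) (suc n) (ℕ.s≤s len≤n) = sym (begin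
    1# * esym f 0 xs + ∑ (applyUpTo suc (suc n)) (term (x ∷ xs))
      ≈⟨ +-congˡ (shift (x ∷ xs)) ⟩
    1# * esym f 0 xs + ∑ (range 0 n) (λ ℓ → term (x ∷ xs) (suc ℓ))
      ≈⟨ +-congˡ (∑-cong (range 0 n) step) ⟩
    1# * esym f 0 xs + ∑ (range 0 n) (λ ℓ → term xs (suc ℓ) + - f x * term xs ℓ)
      ≈⟨ +-congˡ (∑-+ (range 0 n) _ _) ⟩
    1# * esym f 0 xs + (∑ (range 0 n) (λ ℓ → term xs (suc ℓ)) + ∑ (range 0 n) (λ ℓ → - f x * term xs ℓ))
      ≈⟨ +-assoc _ _ _ ⟨
    1# * esym f 0 xs + ∑ (range 0 n) (λ ℓ → term xs (suc ℓ)) + ∑ (range 0 n) (λ ℓ → - f x * term xs ℓ)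
      ≈⟨ +-cong (+-congˡ (sym (shift xs))) (sym (*-∑ (range 0 n) _ _)) ⟩
    ∑ (range 0 (suc n)) (term xs) + - f x * ∑ (range 0 n) (term xs)
      ≈⟨ +-cong (sym (∏[1-f] f xs (suc n) (ℕ.m≤n⇒m≤1+n len≤n))) (*-congˡ (sym (∏[1-f] f xs n len≤n))) ⟩
    P + - f x * P
      ≈⟨ solve 2 (λ p y → p :+ :- y :* p := (one :- y) :* p) refl P (f x) ⟩
    (1# - f x) * P ∎)
    where
    P : Carrier
    P = ∏ xs (λ x → 1# - f x)
    term : List A → ℕ → Carrier
    term ys ℓ = (- 1#) ^ ℓ * esym f ℓ ys
    shift : ∀ ys → ∑ (applyUpTo suc (suc n)) (term ys) ≈ ∑ (range 0 n) (λ ℓ → term ys (suc ℓ))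
    shift ys = reflexive (≡.trans (≡.cong (λ l → ∑ l (term ys)) (≡.sym (List.map-upTo suc (suc n))))
                                  (∑-map suc (List.upTo (suc n)) (term ys)))
    step : ∀ ℓ → term (x ∷ xs) (suc ℓ) ≈ term xs (suc ℓ) + - f x * term xs ℓ
    step ℓ = trans (*-congˡ (esym-∷ f ℓ x xs))
      (solve 4 (λ s y e e′ → (:- one :* s) :* (y :* e :+ e′) := (:- one :* s) :* e′ :+ :- y :* (s :* e))
        refl _ _ _ _)

  ∏-applyUpTo : ∀ {A : Set} (g : A → Carrier) (h : ℕ → A) n →
    ∏ (applyUpTo h n) g ≡ ∏ (List.upTo n) (g ∘ h)
  ∏-applyUpTo g h n = ≡.trans (≡.cong (λ l → ∏ l g) (≡.sym (List.map-upTo h n))) (∏-map h (List.upTo n) g)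

  ∑-applyUpTo : ∀ {A : Set} (g : A → Carrier) (h : ℕ → A) n →
    ∑ (applyUpTo h n) g ≡ ∑ (List.upTo n) (g ∘ h)
  ∑-applyUpTo g h n = ≡.trans (≡.cong (λ l → ∑ l g) (≡.sym (List.map-upTo h n))) (∑-map h (List.upTo n) g)

  esym-1 : ∀ {A : Set} (f : A → Carrier) xs → esym f 1 xs ≈ ∑ xs f
  esym-1 f []       = refl
  esym-1 f (x ∷ xs) = trans (esym-∷ f 0 x xs)
    (+-cong (trans (*-congˡ (+-identityʳ 1#)) (*-identityʳ (f x))) (esym-1 f xs))

  -- The linear part is split off because it produces the window sum multiplying α_n in `α-mixed`,
  -- whereas the degrees from 2 on match the right-hand side of that recursion.
  1-∏[1-f] : ∀ {A : Set} (f : A → Carrier) xs n → length xs ℕ.≤ suc n →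
    1# - ∏ xs (λ x → 1# - f x) ≈ ∑ xs f - ∑ (range 2 (suc n)) (λ ℓ → (- 1#) ^ ℓ * esym f ℓ xs)
  1-∏[1-f] f xs n len≤ = begin
    1# - ∏ xs (λ x → 1# - f x)
      ≈⟨ +-congˡ (-‿cong (∏[1-f] f xs (suc n) len≤)) ⟩
    1# - (1# * (1# + 0#) + (- 1# * 1# * esym f 1 xs + M))
      ≈⟨ solve 2 (λ e m → one :- (one :* (one :+ zer) :+ (:- one :* one :* e :+ m)) := e :- m) refl _ _ ⟩
    esym f 1 xs - M
      ≈⟨ +-congʳ (esym-1 f xs) ⟩
    ∑ xs f - M ∎
    where
    M : Carrier
    M = ∑ (range 2 (suc n)) (λ ℓ → (- 1#) ^ ℓ * esym f ℓ xs)

  inclusion-exclusion : ∀ {A : Set} (f : A → Carrier) xs n → length xs ℕ.≤ n →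
    1# - ∏ xs (λ x → 1# - f x) ≈ ∑ (range 1 n) (λ ℓ → (- 1#) ^ (ℓ ℕ.∸ 1) * esym f ℓ xs)
  inclusion-exclusion f xs n len≤ = begin
    1# - ∏ xs (λ x → 1# - f x)
      ≈⟨ +-congˡ (-‿cong (trans (∏[1-f] f xs n len≤) (+-congˡ (reflexive (∑-applyUpTo _ suc n))))) ⟩
    1# - (1# * (1# + 0#) + ∑ (List.upTo n) (λ ℓ → - 1# * (- 1#) ^ ℓ * esym f (suc ℓ) xs))
      ≈⟨ +-congˡ (-‿cong (+-congˡ (trans
           (∑-cong (List.upTo n) (λ ℓ → *-assoc (- 1#) _ _)) (sym (*-∑ (List.upTo n) (- 1#) _))))) ⟩
    1# - (1# * (1# + 0#) + - 1# * ∑ (List.upTo n) (λ ℓ → (- 1#) ^ ℓ * esym f (suc ℓ) xs))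
      ≈⟨ solve 1 (λ s → one :- (one :* (one :+ zer) :+ :- one :* s) := s) refl _ ⟩
    ∑ (List.upTo n) (λ ℓ → (- 1#) ^ ℓ * esym f (suc ℓ) xs)
      ≡⟨ ∑-applyUpTo _ suc n ⟨
    ∑ (range 1 n) (λ ℓ → (- 1#) ^ (ℓ ℕ.∸ 1) * esym f ℓ xs) ∎

  ∏-1 : ∀ {A : Set} (xs : List A) {f} → (∀ x → f x ≈ 1#) → ∏ xs f ≈ 1#
  ∏-1 []       p = refl
  ∏-1 (x ∷ xs) p = trans (*-cong (p x) (∏-1 xs p)) (*-identityˡ 1#)

  ∏-allFin-single : ∀ {d} (i : Fin d) (f : Fin d → Carrier) →
    (∀ j → j ≢ i → f j ≈ 1#) → ∏ (allFin d) f ≈ f i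
  ∏-allFin-single {suc d} zero f p = trans (reflexive (∏-allFin-suc d f))
    (trans (*-congˡ (∏-1 (allFin d) (λ j → p (suc j) (λ ())))) (*-identityʳ _))
  ∏-allFin-single {suc d} (suc i) f p = trans (reflexive (∏-allFin-suc d f))
    (trans (*-cong (p zero (λ ())) (∏-allFin-single i (f ∘ suc) (λ j j≢i → p (suc j) (j≢i ∘ Fin.suc-injective))))
           (*-identityˡ _))

  -- A division-free substitute for the quotient (1 - y^n)/(1 - y) that `α-axis` produces at y =
  -- x^d.
  geometric : Carrier → ℕ → Carrier
  geometric y zero    = 0#
  geometric y (suc n) = geometric y n + y ^ n

  [1-y]*geometric : ∀ y n → (1# - y) * geometric y n ≈ 1# - y ^ n
  [1-y]*geometric y zero    = trans (zeroʳ _) (sym (-‿inverseʳ 1#))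
  [1-y]*geometric y (suc n) = begin
    (1# - y) * (geometric y n + y ^ n)            ≈⟨ distribˡ _ _ _ ⟩
    (1# - y) * geometric y n + (1# - y) * y ^ n   ≈⟨ +-congʳ ([1-y]*geometric y n) ⟩
    (1# - y ^ n) + (1# - y) * y ^ n
      ≈⟨ solve 2 (λ y z → (one :- z) :+ (one :- y) :* z := one :- y :* z) refl y (y ^ n) ⟩
    1# - y ^ suc n ∎

  -- Only the ratio of consecutive terms enters, so that the sum may start at a negative power of x,
  -- as the window sum does; `geometric` covers only sums starting at 1.
  ∑-telescope : ∀ {A : Set} x (g : A → Carrier) (h : ℕ → A) →
    (∀ i → g (h (suc i)) ≈ x * g (h i)) →
    ∀ n → (1# - x) * ∑ (applyUpTo h n) g ≈ g (h 0) - g (h n)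
  ∑-telescope x g h step zero    = trans (zeroʳ _) (sym (-‿inverseʳ _))
  ∑-telescope x g h step (suc n) = begin
    (1# - x) * (g (h 0) + ∑ (applyUpTo (h ∘ suc) n) g)
      ≈⟨ distribˡ _ _ _ ⟩
    (1# - x) * g (h 0) + (1# - x) * ∑ (applyUpTo (h ∘ suc) n) g
      ≈⟨ +-congˡ (∑-telescope x g (h ∘ suc) (step ∘ suc) n) ⟩
    (1# - x) * g (h 0) + (g (h 1) - g (h (suc n)))
      ≈⟨ +-congˡ (+-congʳ (step 0)) ⟩
    (1# - x) * g (h 0) + (x * g (h 0) - g (h (suc n)))
      ≈⟨ solve 3 (λ x a b → (one :- x) :* a :+ (x :* a :- b) := a :- b) refl _ _ _ ⟩
    g (h 0) - g (h (suc n)) ∎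

  module _ (u : Unit R) where

    ^ᶻ-⊖ : ∀ m n → u ^ᶻ (m ⊖ n) ≈ value u ^ m * inverse u ^ n
    ^ᶻ-⊖ m       zero    = sym (*-identityʳ _)
    ^ᶻ-⊖ zero    (suc n) = sym (*-identityˡ _)
    ^ᶻ-⊖ (suc m) (suc n) = begin
      u ^ᶻ (suc m ⊖ suc n)                 ≡⟨ ≡.cong (u ^ᶻ_) (ℤ.[1+m]⊖[1+n]≡m⊖n m n) ⟩
      u ^ᶻ (m ⊖ n)                         ≈⟨ ^ᶻ-⊖ m n ⟩
      value u ^ m * inverse u ^ n          ≈⟨ *-identityˡ _ ⟨
      1# * (value u ^ m * inverse u ^ n)   ≈⟨ *-congʳ (isInverse u) ⟨
      (value u * inverse u) * (value u ^ m * inverse u ^ n)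
        ≈⟨ solve 4 (λ v i a b → (v :* i) :* (a :* b) := (v :* a) :* (i :* b)) refl _ _ _ _ ⟩
      value u ^ suc m * inverse u ^ suc n  ∎

    ^ᶻ-homo : ∀ i j → u ^ᶻ (i ℤ.+ j) ≈ u ^ᶻ i * u ^ᶻ j
    ^ᶻ-homo (+ m)    (+ n)    = ^-homo-* (value u) m n
    ^ᶻ-homo (+ m)    -[1+ n ] = ^ᶻ-⊖ m (suc n)
    ^ᶻ-homo -[1+ m ] (+ n)    = trans (^ᶻ-⊖ n (suc m)) (*-comm _ _)
    ^ᶻ-homo -[1+ m ] -[1+ n ] = trans
      (reflexive (≡.cong (inverse u ^_) (≡.sym (ℕ.+-suc (suc m) n))))
      (^-homo-* (inverse u) (suc m) (suc n))

    ^ᶻ-1 : u ^ᶻ (+ 1) ≈ value u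
    ^ᶻ-1 = *-identityʳ _

    ^ᶻ-*ℕ : ∀ i n → u ^ᶻ (i ℤ.* + n) ≈ (u ^ᶻ i) ^ n
    ^ᶻ-*ℕ i zero    = reflexive (≡.cong (u ^ᶻ_) (ℤ.*-zeroʳ i))
    ^ᶻ-*ℕ i (suc n) = begin
      u ^ᶻ (i ℤ.* + suc n)             ≡⟨ ≡.cong (u ^ᶻ_) (ℤ.*-suc i (+ n)) ⟩
      u ^ᶻ (i ℤ.+ i ℤ.* + n)           ≈⟨ ^ᶻ-homo i (i ℤ.* + n) ⟩
      u ^ᶻ i * u ^ᶻ (i ℤ.* + n)        ≈⟨ *-congˡ (^ᶻ-*ℕ i n) ⟩
      (u ^ᶻ i) ^ suc n                 ∎

  -- Both sides multiply the values of `g` over the integers from -d to d + 1. This lets products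
  -- over shifted windows telescope without division.
  ∏-window-shift : ∀ d (g : ℤ → Carrier) →
    ∏ (window d) g * g (+ suc d) ≈ g (ℤ.- + d) * ∏ (window d) (λ b → g (b ℤ.+ + 1))
  ∏-window-shift d g = begin
    ∏ (window d) g * g (+ suc d)
      ≡⟨ ≡.cong (λ i → ∏ (window d) g * g i) (window-end d) ⟨
    ∏ (window d) g * g ((2 ℕ.* d ℕ.+ 1) ⊖ d)
      ≈⟨ ∏-shift g (_⊖ d) (2 ℕ.* d ℕ.+ 1) ⟩
    g (0 ⊖ d) * ∏ (applyUpTo (λ i → suc i ⊖ d) (2 ℕ.* d ℕ.+ 1)) g
      ≈⟨ *-cong (reflexive (≡.cong g (ℤ.⊖-≤ (ℕ.z≤n {d})))) (trans (reflexive (∏-applyUpTo g (λ i → suc i ⊖ d) (2 ℕ.* d ℕ.+ 1))) (trans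
           (∏-cong (List.upTo (2 ℕ.* d ℕ.+ 1)) (λ i → reflexive (≡.cong g (suc-⊖ i d))))
           (reflexive (≡.sym (∏-applyUpTo (λ b → g (b ℤ.+ + 1)) (_⊖ d) (2 ℕ.* d ℕ.+ 1)))))) ⟩
    g (ℤ.- + d) * ∏ (window d) (λ b → g (b ℤ.+ + 1)) ∎

  -- 1 - r b = L b L (b + d + 2) / (L (b + 1) L (b + d + 1)), so that the
  -- product over the window telescopes.
  module _ (d : ℕ) (x : Unit R) (Z w : Carrier) (r : ℤ → Carrier) where
    private
      v y p s : Carrier
      v = value x
      y = v ^ d
      p = x ^ᶻ (ℤ.- + d)
      s = (1# - v) * (1# - v ^ suc d)
      L : ℤ → Carrier
      L i = 1# - x ^ᶻ i * Z
      W : List ℤ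
      W = window d

    module _ (L-regular : ∀ i → Regular (L i))
             (r-equation : ∀ b → r b * (L (b ℤ.+ + 1) * L (b ℤ.+ + suc d)) ≈ s * x ^ᶻ b * Z)
             (w-equation : w * ∑ W (x ^ᶻ_) ≈ 1#) where

      private
        L⁺ : ∀ b n → L (b ℤ.+ + n) ≈ 1# - x ^ᶻ b * v ^ n * Z
        L⁺ b n = +-congˡ (-‿cong (*-congʳ (^ᶻ-homo x b (+ n))))

      -- The constant `s` is the one that makes the numerator factor: both sides are quadratics in
      -- x^b Z with leading coefficient v (v y), and the linear coefficients agree because v + v y +
      -- (1 - v)(1 - v y) = 1 + v (v y).
      1-r : ∀ b → (1# - r b) * (L (b ℤ.+ + 1) * L (b ℤ.+ + suc d)) ≈ L b * L (b ℤ.+ + suc d ℤ.+ + 1)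
      1-r b = begin
        (1# - r b) * (L (b ℤ.+ + 1) * L (b ℤ.+ + suc d))
          ≈⟨ solve 2 (λ r l → (one :- r) :* l := l :- r :* l) refl (r b) _ ⟩
        L (b ℤ.+ + 1) * L (b ℤ.+ + suc d) - r b * (L (b ℤ.+ + 1) * L (b ℤ.+ + suc d))
          ≈⟨ +-cong (*-cong (trans (L⁺ b 1) (+-congˡ (-‿cong (*-congʳ (*-congˡ (*-identityʳ v))))))
                            (L⁺ b (suc d)))
                    (-‿cong (r-equation b)) ⟩
        (1# - c * v * Z) * (1# - c * (v * y) * Z) - (1# - v) * (1# - v * y) * c * Z
          ≈⟨ solve 4 (λ v y c z → (one :- c :* v :* z) :* (one :- c :* (v :* y) :* z) :- (one :- v) :* (one :- v :* y) :* c :* z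
               := (one :- c :* z) :* (one :- c :* (v :* y) :* v :* z)) refl v y c Z ⟩
        (1# - c * Z) * (1# - c * (v * y) * v * Z)
          ≈⟨ *-congˡ (+-congˡ (-‿cong (*-congʳ (trans (^ᶻ-homo x (b ℤ.+ + suc d) (+ 1))
               (*-cong (^ᶻ-homo x b (+ suc d)) (^ᶻ-1 x)))))) ⟨
        L b * L (b ℤ.+ + suc d ℤ.+ + 1) ∎
        where
        c : Carrier
        c = x ^ᶻ b

      private
        P₀ P₁ Q₁ Q₂ π : Carrier
        P₀ = ∏ W L
        P₁ = ∏ W (λ b → L (b ℤ.+ + 1))
        Q₁ = ∏ W (λ b → L (b ℤ.+ + suc d))
        Q₂ = ∏ W (λ b → L (b ℤ.+ + suc d ℤ.+ + 1))
        π  = ∏ W (λ b → 1# - r b)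

        P-shift : P₀ * L (+ suc d) ≈ L (ℤ.- + d) * P₁
        P-shift = ∏-window-shift d L

        Q-shift : Q₁ * L (+ suc d ℤ.+ + suc d) ≈ L (+ 1) * Q₂
        Q-shift = trans (∏-window-shift d (λ b → L (b ℤ.+ + suc d)))
          (*-cong (reflexive (≡.cong L (-d+1+d d)))
                  (∏-cong W (λ b → reflexive (≡.cong L (swap b)))))
          where
          -d+1+d : ∀ d → ℤ.- + d ℤ.+ + suc d ≡ + 1
          -d+1+d d = ≡.trans (≡.cong (λ i → ℤ.- + d ℤ.+ i) (ℤ.+-comm (+ 1) (+ d)))
            (≡.trans (≡.sym (ℤ.+-assoc (ℤ.- + d) (+ d) (+ 1))) (≡.cong (λ i → i ℤ.+ + 1) (ℤ.+-inverseˡ (+ d))))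
          swap : ∀ b → b ℤ.+ + 1 ℤ.+ + suc d ≡ b ℤ.+ + suc d ℤ.+ + 1
          swap b = ≡.trans (ℤ.+-assoc b (+ 1) (+ suc d))
            (≡.trans (≡.cong (λ i → b ℤ.+ i) (ℤ.+-comm (+ 1) (+ suc d))) (≡.sym (ℤ.+-assoc b (+ suc d) (+ 1))))

      -- `P₀` and `P₁` share all but their end factors, and so do `Q₁` and `Q₂`. This is π = L(-d)
      -- L(2d+2) / (L(1) L(d+1)) before the common part `P₁ * Q₁` is cancelled.
      telescoped : (P₁ * Q₁) * (π * (L (+ 1) * L (+ suc d)))
                   ≈ (P₁ * Q₁) * (L (ℤ.- + d) * L (+ suc d ℤ.+ + suc d))
      telescoped = begin
        (P₁ * Q₁) * (π * (L (+ 1) * L (+ suc d)))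
          ≈⟨ solve 5 (λ p q π a b → (p :* q) :* (π :* (a :* b)) := (π :* (p :* q)) :* (b :* a)) refl _ _ _ _ _ ⟩
        (π * (P₁ * Q₁)) * (L (+ suc d) * L (+ 1))
          ≈⟨ *-congʳ (trans (*-congˡ (sym (∏-* W _ _))) (trans (sym (∏-* W _ _)) (trans (∏-cong W 1-r) (∏-* W _ _)))) ⟩
        (P₀ * Q₂) * (L (+ suc d) * L (+ 1))
          ≈⟨ solve 4 (λ p q b a → (p :* q) :* (b :* a) := (p :* b) :* (a :* q)) refl _ _ _ _ ⟩
        (P₀ * L (+ suc d)) * (L (+ 1) * Q₂)
          ≈⟨ *-cong P-shift (sym Q-shift) ⟩
        (L (ℤ.- + d) * P₁) * (Q₁ * L (+ suc d ℤ.+ + suc d))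
          ≈⟨ solve 4 (λ m p q n → (m :* p) :* (q :* n) := (p :* q) :* (m :* n)) refl _ _ _ _ ⟩
        (P₁ * Q₁) * (L (ℤ.- + d) * L (+ suc d ℤ.+ + suc d)) ∎

      r≈w[1-∏[1-r]] : r (+ 0) ≈ w * (1# - ∏ W (λ b → 1# - r b))
      r≈w[1-∏[1-r]] = regular-cancel (regular-* (L-regular (+ 1)) (L-regular (+ suc d))) (begin
        ℓ * r (+ 0)
          ≈⟨ *-comm ℓ (r (+ 0)) ⟩
        r (+ 0) * ℓ
          ≈⟨ r-equation (+ 0) ⟩
        (1# - v) * (1# - v * y) * 1# * Z
          ≈⟨ *-identityˡ _ ⟨
        1# * ((1# - v) * (1# - v * y) * 1# * Z)
          -- The characteristic equation is inserted as a factor w S = 1, so that (1 - v) S can be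
          -- summed to x^(-d) - x^(d+1).
          ≈⟨ *-congʳ w-equation ⟨
        w * S * ((1# - v) * (1# - v * y) * 1# * Z)
          ≈⟨ solve 5 (λ w s v y z → w :* s :* ((one :- v) :* (one :- v :* y) :* one :* z)
               := w :* ((one :- v :* y) :* ((one :- v) :* s) :* z)) refl w S v y Z ⟩
        w * ((1# - v * y) * ((1# - v) * S) * Z)
          ≈⟨ *-congˡ (*-congʳ (*-congˡ sum)) ⟩
        w * ((1# - v * y) * (p - v * y) * Z)
          -- The identity depends on p y = 1, a relation unknown to the solver. The term with factor
          -- 1 - p y makes it a polynomial identity and is discarded in the next step.
          ≈⟨ *-congˡ (solve 4 (λ v y p z → (one :- v :* y) :* (p :- v :* y) :* z
               := ((one :- v :* z) :* (one :- v :* y :* z) :- (one :- p :* z) :* (one :- (v :* y) :* (v :* y) :* z))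
                  :+ (one :- p :* y) :* (v :* z :- v :* v :* y :* z :* z)) refl v y p Z) ⟩
        w * (((1# - v * Z) * (1# - v * y * Z) - (1# - p * Z) * (1# - (v * y) * (v * y) * Z))
             + (1# - p * y) * (v * Z - v * v * y * Z * Z))
          ≈⟨ *-congˡ (trans (+-congˡ (trans (*-congʳ (x≈y⇒x-y≈0 (sym py≈1))) (zeroˡ _))) (+-identityʳ _)) ⟩
        w * ((1# - v * Z) * (1# - v * y * Z) - (1# - p * Z) * (1# - (v * y) * (v * y) * Z))
          ≈⟨ *-congˡ (+-cong (*-congʳ (+-congˡ (-‿cong (*-congʳ (^ᶻ-1 x)))))
               (-‿cong (*-congˡ (+-congˡ (-‿cong (*-congʳ (^ᶻ-homo x (+ suc d) (+ suc d)))))))) ⟨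
        w * (ℓ - L (ℤ.- + d) * L (+ suc d ℤ.+ + suc d))
          ≈⟨ *-congˡ (+-congˡ (-‿cong (regular-cancel (regular-* (regular-∏ W (λ b → L-regular (b ℤ.+ + 1)))
               (regular-∏ W (λ b → L-regular (b ℤ.+ + suc d)))) telescoped))) ⟨
        w * (ℓ - π * ℓ)
          ≈⟨ solve 3 (λ w l π → w :* (l :- π :* l) := l :* (w :* (one :- π))) refl w ℓ π ⟩
        ℓ * (w * (1# - π)) ∎)
        where
        ℓ S : Carrier
        ℓ = L (+ 1) * L (+ suc d)
        S = ∑ W (x ^ᶻ_)
        sum : (1# - v) * S ≈ p - v * y
        sum = trans (∑-telescope v (x ^ᶻ_) (_⊖ d)
                       (λ i → trans (reflexive (≡.cong (x ^ᶻ_) (suc-⊖ i d)))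
                         (trans (^ᶻ-homo x (i ⊖ d) (+ 1)) (trans (*-congˡ (^ᶻ-1 x)) (*-comm _ _))))
                       (2 ℕ.* d ℕ.+ 1))
                    (+-cong (reflexive (≡.cong (x ^ᶻ_) (ℤ.⊖-≤ (ℕ.z≤n {d}))))
                            (-‿cong (reflexive (≡.cong (x ^ᶻ_) (window-end d)))))
        py≈1 : p * y ≈ 1#
        py≈1 = trans (sym (^ᶻ-homo x (ℤ.- + d) (+ d))) (reflexive (≡.cong (x ^ᶻ_) (ℤ.+-inverseˡ (+ d))))

  -- Expanding t (1 - ρ₀) gives (t - w t) + (w t) π. The first part is 1, and w t = z t^(length xs)
  -- hands one factor t to each factor of the product.
  tree-recurrence : ∀ {A : Set} (t z w : Carrier) (xs : List A) (ρ : A → Carrier) {ρ₀} →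
    t ≈ 1# + w * t → w * t ≈ z * t ^ length xs →
    ρ₀ ≈ w * (1# - ∏ xs (λ x → 1# - ρ x)) →
    t * (1# - ρ₀) ≈ 1# + z * ∏ xs (λ x → t * (1# - ρ x))
  tree-recurrence t z w xs ρ {ρ₀} t-equation wt≈ ρ₀-equation = begin
    t * (1# - ρ₀)               ≈⟨ *-congˡ (+-congˡ (-‿cong ρ₀-equation)) ⟩
    t * (1# - w * (1# - π))
      ≈⟨ solve 3 (λ t w π → t :* (one :- w :* (one :- π)) := (t :- w :* t) :+ (w :* t) :* π) refl t w π ⟩
    (t - w * t) + (w * t) * π   ≈⟨ +-cong (trans (+-congʳ t-equation)
                                     (solve 1 (λ q → one :+ q :- q := one) refl (w * t)))
                                     (*-congʳ wt≈) ⟩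
    1# + (z * t ^ length xs) * π  ≈⟨ +-congˡ (*-assoc _ _ _) ⟩
    1# + z * (t ^ length xs * π)  ≈⟨ +-congˡ (*-congˡ (∏-scale xs t _)) ⟨
    1# + z * ∏ xs (λ x → t * (1# - ρ x)) ∎
    where
    π : Carrier
    π = ∏ xs (λ x → 1# - ρ x)

-- Rings of formal power series

-- Commutativity and associativity of convolution come from rearranging the lists of pairs and
-- triples of exponents. The rearrangements are recorded by their effect on sums in `R`, the form in
-- which the ring laws use them.
record IsSplitting (R : RawRing 0ℓ 0ℓ) (isCR : IsCommutativeRawRing R)
                   {I : Set} (o : I) (split : I → List (I × I)) : Set where
  open RingTheory R isCR
  field
    ∑-comm : ∀ n (F : I → I → Carrier) →
      ∑ (split n) (λ (i , j) → F i j) ≈ ∑ (split n) (λ (i , j) → F j i)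
    ∑-assoc : ∀ n (F : I → I → I → Carrier) →
      ∑ (split n) (λ (i , j) → ∑ (split i) λ (k , l) → F k l j)
      ≈ ∑ (split n) (λ (i , j) → ∑ (split j) λ (k , l) → F i k l)
    ∑-single : ∀ {n g h} → (g , h) ∈ split n → (F : I → I → Carrier) →
      (∀ i j → i ≢ g → F i j ≈ 0#) → ∑ (split n) (λ (i , j) → F i j) ≈ F g h
    [o,n]∈ : ∀ n → (o , n) ∈ split n
    [n,o]∈ : ∀ n → (n , o) ∈ split n

module SeriesTheory (R : RawRing 0ℓ 0ℓ) (isCR : IsCommutativeRawRing R)
                    {I : Set} (_≟_ : DecidableEquality I) (o : I) (split : I → List (I × I))
                    (isSplitting : IsSplitting R isCR o split) where
  private module R = RingTheory R isCR
  open R hiding (_+_; _*_; -_; 0#; 1#; _^_; ring; isCommutativeRing)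
  open Series R _≟_ o split
  private module S = RawRing ring
  open IsSplitting isSplitting

  monomial-diagonal : ∀ c n → monomial c n n ≈ c
  monomial-diagonal c n with n ≟ n
  ... | yes _   = refl
  ... | no  n≢n = contradiction ≡.refl n≢n

  monomial-off-diagonal : ∀ c {n m} → m ≢ n → monomial c n m ≈ R.0#
  monomial-off-diagonal c {n} {m} m≢n with m ≟ n
  ... | yes m≡n = contradiction m≡n m≢n
  ... | no  _   = refl

  constant-* : ∀ c f n → (constant c S.* f) n ≈ c R.* f n
  constant-* c f n = trans
    (∑-single ([o,n]∈ n) (λ i j → constant c i R.* f j)
      (λ i j i≢o → trans (*-congʳ (monomial-off-diagonal c i≢o)) (zeroˡ _)))
    (*-congʳ (monomial-diagonal c o))

  isCommutativeRing : IsCommutativeRawRing ring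
  isCommutativeRing = record
    { isRing = record
      { +-isAbelianGroup = record
        { isGroup = record
          { isMonoid = record
            { isSemigroup = record
              { isMagma = record
                { isEquivalence = record
                  { refl  = λ n → refl
                  ; sym   = λ p n → sym (p n)
                  ; trans = λ p q n → trans (p n) (q n)
                  }
                ; ∙-cong = λ p q n → +-cong (p n) (q n)
                }
              ; assoc = λ f g h n → +-assoc _ _ _
              }
            ; identity = (λ f n → +-identityˡ _) , (λ f n → +-identityʳ _)
            }
          ; inverse = (λ f n → -‿inverseˡ _) , (λ f n → -‿inverseʳ _)
          ; ⁻¹-cong = λ p n → -‿cong (p n)
          }
        ; comm = λ f g n → +-comm _ _
        }
      ; *-cong = λ p q n → ∑-cong (split n) (λ (i , j) → *-cong (p i) (q j))
      ; *-assoc = assoc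
      ; *-identity = identityˡ , λ f n → trans (comm f S.1# n) (identityˡ f n)
      ; distrib = (λ f g h n → trans (∑-cong (split n) (λ (i , j) → distribˡ (f i) (g j) (h j)))
                                     (∑-+ (split n) _ _))
                , (λ f g h n → trans (∑-cong (split n) (λ (i , j) → distribʳ (f j) (g i) (h i)))
                                     (∑-+ (split n) _ _))
      }
    ; *-comm = comm
    }
    where
    comm : ∀ f g n → (f S.* g) n ≈ (g S.* f) n
    comm f g n = trans (∑-comm n (λ i j → f i R.* g j))
                       (∑-cong (split n) (λ (i , j) → *-comm (f j) (g i)))
    assoc : ∀ f g h n → ((f S.* g) S.* h) n ≈ (f S.* (g S.* h)) n
    assoc f g h n = begin
      ∑ (split n) (λ (i , j) → ∑ (split i) (λ (k , l) → f k R.* g l) R.* h j)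
        ≈⟨ ∑-cong (split n) (λ (i , j) → ∑-* (split i) _ (h j)) ⟩
      ∑ (split n) (λ (i , j) → ∑ (split i) (λ (k , l) → f k R.* g l R.* h j))
        ≈⟨ ∑-assoc n (λ k l j → f k R.* g l R.* h j) ⟩
      ∑ (split n) (λ (i , j) → ∑ (split j) (λ (k , l) → f i R.* g k R.* h l))
        ≈⟨ ∑-cong (split n) (λ (i , j) → trans
             (∑-cong (split j) (λ (k , l) → *-assoc (f i) (g k) (h l)))
             (sym (*-∑ (split j) (f i) _))) ⟩
      ∑ (split n) (λ (i , j) → f i R.* ∑ (split j) (λ (k , l) → g k R.* h l)) ∎
    identityˡ : ∀ f n → (S.1# S.* f) n ≈ f n
    identityˡ f n = trans (constant-* R.1# f n) (*-identityˡ _)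

  constant-cong : ∀ {c e} → c ≈ e → constant c S.≈ constant e
  constant-cong c≈e n with n ≟ o
  ... | yes _ = c≈e
  ... | no  _ = refl

  constant-homo-+ : ∀ c e → constant (c R.+ e) S.≈ (constant c S.+ constant e)
  constant-homo-+ c e n with n ≟ o
  ... | yes _ = refl
  ... | no  _ = sym (+-identityˡ _)

  constant-homo-neg : ∀ c → constant (R.- c) S.≈ (S.- constant c)
  constant-homo-neg c n with n ≟ o
  ... | yes _ = refl
  ... | no  _ = sym -0#≈0#

  constant-homo-0 : constant R.0# S.≈ S.0#
  constant-homo-0 n with n ≟ o
  ... | yes _ = refl
  ... | no  _ = refl

  constant-homo-* : ∀ c e → constant (c R.* e) S.≈ (constant c S.* constant e)
  constant-homo-* c e n = trans (lemma n) (sym (constant-* c (constant e) n))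
    where
    lemma : ∀ n → constant (c R.* e) n ≈ c R.* constant e n
    lemma n with n ≟ o
    ... | yes _ = refl
    ... | no  _ = sym (zeroʳ c)

  coefficient-*constant : ∀ f c n → (f S.* constant c) n ≈ f n R.* c
  coefficient-*constant f c n =
    trans (RingTheory.*-comm ring isCommutativeRing f (constant c) n)
          (trans (constant-* c f n) (*-comm c (f n)))

  coefficient-∑∞ : ∀ F n → (∀ i → i ≢ n → F i n ≈ R.0#) → ∑∞ F n ≈ F n n
  coefficient-∑∞ F n p = ∑-single ([n,o]∈ n) (λ i _ → F i n) (λ i _ → p i)

-- Splittings of natural numbers and of exponent vectors

[0,n]∈splitℕ : ∀ n → (0 , n) ∈ splitℕ n
[0,n]∈splitℕ zero    = here ≡.refl
[0,n]∈splitℕ (suc n) = here ≡.refl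

[n,0]∈splitℕ : ∀ n → (n , 0) ∈ splitℕ n
[n,0]∈splitℕ zero    = here ≡.refl
[n,0]∈splitℕ (suc n) = there (∈-map⁺ _ ([n,0]∈splitℕ n))

splitℕ-sum : ∀ n {i j} → (i , j) ∈ splitℕ n → i ℕ.+ j ≡ n
splitℕ-sum zero    (here ≡.refl) = ≡.refl
splitℕ-sum (suc n) (here ≡.refl) = ≡.refl
splitℕ-sum (suc n) (there p) with ∈-map⁻ _ p
... | _ , q , ≡.refl = ≡.cong suc (splitℕ-sum n q)

∈-splitVec-∷ : ∀ {d} n (ns : Vec ℕ d) {g h gs hs} → (g , h) ∈ splitℕ n → (gs , hs) ∈ splitVec ns →
               (g ∷ gs , h ∷ hs) ∈ splitVec (n ∷ ns)
∈-splitVec-∷ n ns = ∈-cartesianProductWith⁺ (λ (i , j) (is , js) → i ∷ is , j ∷ js)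

[𝟘,n]∈splitVec : ∀ {d} (n : Vec ℕ d) → (𝟘 , n) ∈ splitVec n
[𝟘,n]∈splitVec []       = here ≡.refl
[𝟘,n]∈splitVec (n ∷ ns) = ∈-splitVec-∷ n ns ([0,n]∈splitℕ n) ([𝟘,n]∈splitVec ns)

[n,𝟘]∈splitVec : ∀ {d} (n : Vec ℕ d) → (n , 𝟘) ∈ splitVec n
[n,𝟘]∈splitVec []       = here ≡.refl
[n,𝟘]∈splitVec (n ∷ ns) = ∈-splitVec-∷ n ns ([n,0]∈splitℕ n) ([n,𝟘]∈splitVec ns)

[1e,ke]∈splitVec : ∀ {d} (ℓ : Fin d) k → (1 ·e ℓ , k ·e ℓ) ∈ splitVec (suc k ·e ℓ)
[1e,ke]∈splitVec zero    k = ∈-splitVec-∷ (suc k) 𝟘 (there (∈-map⁺ (λ (i , j) → suc i , j) ([0,n]∈splitℕ k))) ([𝟘,n]∈splitVec 𝟘)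
[1e,ke]∈splitVec (suc ℓ) k = ∈-splitVec-∷ 0 (suc k ·e ℓ) (here ≡.refl) ([1e,ke]∈splitVec ℓ k)

splitVec-lookup : ∀ {d} (n : Vec ℕ d) {g h} → (g , h) ∈ splitVec n →
                  ∀ i → lookup n i ≡ lookup g i ℕ.+ lookup h i
splitVec-lookup (n ∷ ns) gh∈ i with ∈-cartesianProductWith⁻ _ (splitℕ n) (splitVec ns) gh∈
splitVec-lookup (n ∷ ns) _ zero    | _ , _ , gh∈ , _ , ≡.refl = ≡.sym (splitℕ-sum n gh∈)
splitVec-lookup (n ∷ ns) _ (suc i) | _ , _ , _ , ghs∈ , ≡.refl = splitVec-lookup ns ghs∈ i

module _ (R : RawRing 0ℓ 0ℓ) (isCR : IsCommutativeRawRing R) where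
  open RingTheory R isCR

  private
    ∑ℕ : ℕ → (ℕ → ℕ → Carrier) → Carrier
    ∑ℕ n F = ∑ (splitℕ n) (λ (i , j) → F i j)

    ∑Vec : ∀ {d} → Vec ℕ d → (Vec ℕ d → Vec ℕ d → Carrier) → Carrier
    ∑Vec n F = ∑ (splitVec n) (λ (i , j) → F i j)

  ∑ℕ-suc : ∀ n F → ∑ℕ (suc n) F ≡ F 0 (suc n) + ∑ℕ n (F ∘ suc)
  ∑ℕ-suc n F = ≡.cong (λ s → F 0 (suc n) + s) (∑-map _ (splitℕ n) _)

  -- `splitℕ` peels off the pair whose first member is 0; exchanging the members of the pairs
  -- requires peeling off the pair whose second member is 0.
  ∑ℕ-last : ∀ n F → ∑ℕ (suc n) F ≈ ∑ℕ n (λ i j → F i (suc j)) + F (suc n) 0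
  ∑ℕ-last zero    F = sym (trans (+-congʳ (+-identityʳ _)) (+-congˡ (sym (+-identityʳ _))))
  ∑ℕ-last (suc n) F = begin
    ∑ℕ (suc (suc n)) F
      ≡⟨ ∑ℕ-suc (suc n) F ⟩
    F 0 (suc (suc n)) + ∑ℕ (suc n) (F ∘ suc)
      ≈⟨ +-congˡ (∑ℕ-last n (F ∘ suc)) ⟩
    F 0 (suc (suc n)) + (∑ℕ n (λ i j → F (suc i) (suc j)) + F (suc (suc n)) 0)
      ≈⟨ +-assoc _ _ _ ⟨
    F 0 (suc (suc n)) + ∑ℕ n (λ i j → F (suc i) (suc j)) + F (suc (suc n)) 0
      ≡⟨ ≡.cong (_+ F (suc (suc n)) 0) (∑ℕ-suc n (λ i j → F i (suc j))) ⟨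
    ∑ℕ (suc n) (λ i j → F i (suc j)) + F (suc (suc n)) 0 ∎

  ∑ℕ-comm : ∀ n F → ∑ℕ n F ≈ ∑ℕ n (λ i j → F j i)
  ∑ℕ-comm zero    F = refl
  ∑ℕ-comm (suc n) F = begin
    ∑ℕ (suc n) F                                    ≈⟨ ∑ℕ-last n F ⟩
    ∑ℕ n (λ i j → F i (suc j)) + F (suc n) 0        ≈⟨ +-congʳ (∑ℕ-comm n (λ i j → F i (suc j))) ⟩
    ∑ℕ n (λ i j → F j (suc i)) + F (suc n) 0        ≈⟨ +-comm _ _ ⟩
    F (suc n) 0 + ∑ℕ n (λ i j → F j (suc i))        ≡⟨ ∑ℕ-suc n (λ i j → F j i) ⟨
    ∑ℕ (suc n) (λ i j → F j i)                      ∎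

  -- The triples with first member 0 form a single sum over `splitℕ (suc n)`; the remaining ones are
  -- the case `n` for `F ∘ suc`.
  ∑ℕ-assoc : ∀ n (F : ℕ → ℕ → ℕ → Carrier) →
    ∑ℕ n (λ i j → ∑ℕ i λ k l → F k l j) ≈ ∑ℕ n (λ i j → ∑ℕ j λ k l → F i k l)
  ∑ℕ-assoc zero    F = refl
  ∑ℕ-assoc (suc n) F = begin
    ∑ℕ (suc n) (λ i j → ∑ℕ i λ k l → F k l j)
      ≡⟨ ∑ℕ-suc n _ ⟩
    (F 0 0 (suc n) + 0#) + ∑ℕ n (λ i j → ∑ℕ (suc i) λ k l → F k l j)
      ≈⟨ +-cong (+-identityʳ _) (∑-cong (splitℕ n) (λ (i , j) → reflexive (∑ℕ-suc i _))) ⟩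
    F 0 0 (suc n) + ∑ℕ n (λ i j → F 0 (suc i) j + ∑ℕ i λ k l → F (suc k) l j)
      ≈⟨ +-congˡ (∑-+ (splitℕ n) _ _) ⟩
    F 0 0 (suc n) + (∑ℕ n (λ i j → F 0 (suc i) j) + ∑ℕ n (λ i j → ∑ℕ i λ k l → F (suc k) l j))
      ≈⟨ +-assoc _ _ _ ⟨
    F 0 0 (suc n) + ∑ℕ n (λ i j → F 0 (suc i) j) + ∑ℕ n (λ i j → ∑ℕ i λ k l → F (suc k) l j)
      ≈⟨ +-cong (reflexive (≡.sym (∑ℕ-suc n (F 0)))) (∑ℕ-assoc n (F ∘ suc)) ⟩
    ∑ℕ (suc n) (F 0) + ∑ℕ n (λ i j → ∑ℕ j λ k l → F (suc i) k l)
      ≡⟨ ∑ℕ-suc n (λ i j → ∑ℕ j λ k l → F i k l) ⟨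
    ∑ℕ (suc n) (λ i j → ∑ℕ j λ k l → F i k l) ∎

  ∑ℕ-single : ∀ n {g h} → (g , h) ∈ splitℕ n → ∀ F →
              (∀ i j → i ≢ g → F i j ≈ 0#) → ∑ℕ n F ≈ F g h
  ∑ℕ-single zero    (here ≡.refl) F p = +-identityʳ _
  ∑ℕ-single (suc n) (here ≡.refl) F p = begin
    ∑ℕ (suc n) F                   ≡⟨ ∑ℕ-suc n F ⟩
    F 0 (suc n) + ∑ℕ n (F ∘ suc)   ≈⟨ +-congˡ (∑-0 (splitℕ n) (λ (i , j) → p (suc i) j (λ ()))) ⟩
    F 0 (suc n) + 0#               ≈⟨ +-identityʳ _ ⟩
    F 0 (suc n)                    ∎
  ∑ℕ-single (suc n) (there q) F p with ∈-map⁻ _ q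
  ... | (g , h) , gh∈ , ≡.refl = begin
    ∑ℕ (suc n) F                   ≡⟨ ∑ℕ-suc n F ⟩
    F 0 (suc n) + ∑ℕ n (F ∘ suc)   ≈⟨ +-cong (p 0 (suc n) (λ ()))
                                        (∑ℕ-single n gh∈ (F ∘ suc) (λ i j i≢g → p (suc i) j (i≢g ∘ ℕ.suc-injective))) ⟩
    0# + F (suc g) h               ≈⟨ +-identityˡ _ ⟩
    F (suc g) h                    ∎

  splitℕ-isSplitting : IsSplitting R isCR 0 splitℕ
  splitℕ-isSplitting = record
    { ∑-comm   = ∑ℕ-comm
    ; ∑-assoc  = ∑ℕ-assoc
    ; ∑-single = λ {n} gh∈ → ∑ℕ-single n gh∈
    ; [o,n]∈   = [0,n]∈splitℕ
    ; [n,o]∈   = [n,0]∈splitℕ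
    }

  ∑Vec-∷ : ∀ {d} n (ns : Vec ℕ d) F →
    ∑Vec (n ∷ ns) F ≈ ∑ℕ n (λ i j → ∑Vec ns λ is js → F (i ∷ is) (j ∷ js))
  ∑Vec-∷ n ns F = ∑-cartesianProductWith _ (splitℕ n) (splitVec ns) _

  ∑Vec-comm : ∀ {d} (n : Vec ℕ d) F → ∑Vec n F ≈ ∑Vec n (λ i j → F j i)
  ∑Vec-comm []       F = refl
  ∑Vec-comm (n ∷ ns) F = begin
    ∑Vec (n ∷ ns) F
      ≈⟨ ∑Vec-∷ n ns F ⟩
    ∑ℕ n (λ i j → ∑Vec ns λ is js → F (i ∷ is) (j ∷ js))
      ≈⟨ ∑ℕ-comm n _ ⟩
    ∑ℕ n (λ i j → ∑Vec ns λ is js → F (j ∷ is) (i ∷ js))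
      ≈⟨ ∑-cong (splitℕ n) (λ (i , j) → ∑Vec-comm ns _) ⟩
    ∑ℕ n (λ i j → ∑Vec ns λ is js → F (j ∷ js) (i ∷ is))
      ≈⟨ ∑Vec-∷ n ns (λ i j → F j i) ⟨
    ∑Vec (n ∷ ns) (λ i j → F j i) ∎

  -- Heads and tails are reassociated independently, once `∑-swap` has moved all sums over heads
  -- outside the sums over tails.
  ∑Vec-assoc : ∀ {d} (n : Vec ℕ d) (F : Vec ℕ d → Vec ℕ d → Vec ℕ d → Carrier) →
    ∑Vec n (λ i j → ∑Vec i λ k l → F k l j) ≈ ∑Vec n (λ i j → ∑Vec j λ k l → F i k l)
  ∑Vec-assoc []       F = refl
  ∑Vec-assoc (n ∷ ns) F = begin
    ∑Vec (n ∷ ns) (λ i j → ∑Vec i λ k l → F k l j)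
      ≈⟨ ∑Vec-∷ n ns _ ⟩
    ∑ℕ n (λ i j → ∑Vec ns λ is js → ∑Vec (i ∷ is) λ k l → F k l (j ∷ js))
      ≈⟨ ∑-cong (splitℕ n) (λ (i , j) → trans (∑-cong (splitVec ns) (λ (is , js) → ∑Vec-∷ i is _))
                                              (∑-swap (splitVec ns) (splitℕ i) _)) ⟩
    ∑ℕ n (λ i j → ∑ℕ i λ k l → ∑Vec ns λ is js → ∑Vec is λ ks ls → F (k ∷ ks) (l ∷ ls) (j ∷ js))
      ≈⟨ ∑ℕ-assoc n _ ⟩
    ∑ℕ n (λ i j → ∑ℕ j λ k l → ∑Vec ns λ is js → ∑Vec is λ ks ls → F (i ∷ ks) (k ∷ ls) (l ∷ js))
      ≈⟨ ∑-cong (splitℕ n) (λ (i , j) → ∑-cong (splitℕ j) (λ (k , l) → ∑Vec-assoc ns _)) ⟩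
    ∑ℕ n (λ i j → ∑ℕ j λ k l → ∑Vec ns λ is js → ∑Vec js λ ks ls → F (i ∷ is) (k ∷ ks) (l ∷ ls))
      ≈⟨ ∑-cong (splitℕ n) (λ (i , j) → trans (∑-cong (splitVec ns) (λ (is , js) → ∑Vec-∷ j js _))
                                              (∑-swap (splitVec ns) (splitℕ j) _)) ⟨
    ∑ℕ n (λ i j → ∑Vec ns λ is js → ∑Vec (j ∷ js) λ k l → F (i ∷ is) k l)
      ≈⟨ ∑Vec-∷ n ns _ ⟨
    ∑Vec (n ∷ ns) (λ i j → ∑Vec j λ k l → F i k l) ∎

  ∑Vec-single : ∀ {d} (n : Vec ℕ d) {g h} → (g , h) ∈ splitVec n → ∀ F →
                (∀ i j → i ≢ g → F i j ≈ 0#) → ∑Vec n F ≈ F g h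
  ∑Vec-single []       (here ≡.refl) F p = +-identityʳ _
  ∑Vec-single (n ∷ ns) q             F p with ∈-cartesianProductWith⁻ _ (splitℕ n) (splitVec ns) q
  ... | (g , h) , (gs , hs) , gh∈ , ghs∈ , ≡.refl = begin
    ∑Vec (n ∷ ns) F
      ≈⟨ ∑Vec-∷ n ns F ⟩
    ∑ℕ n (λ i j → ∑Vec ns λ is js → F (i ∷ is) (j ∷ js))
      ≈⟨ ∑ℕ-single n gh∈ _ (λ i j i≢g →
           ∑-0 (splitVec ns) (λ (is , js) → p _ _ (i≢g ∘ Vec.∷-injectiveˡ))) ⟩
    ∑Vec ns (λ is js → F (g ∷ is) (h ∷ js))
      ≈⟨ ∑Vec-single ns ghs∈ _ (λ is js is≢gs → p _ _ (is≢gs ∘ Vec.∷-injectiveʳ)) ⟩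
    F (g ∷ gs) (h ∷ hs) ∎

  splitVec-isSplitting : ∀ d → IsSplitting R isCR (Vec.replicate d 0) splitVec
  splitVec-isSplitting d = record
    { ∑-comm   = ∑Vec-comm
    ; ∑-assoc  = ∑Vec-assoc
    ; ∑-single = λ {n} gh∈ → ∑Vec-single n gh∈
    ; [o,n]∈   = [𝟘,n]∈splitVec
    ; [n,o]∈   = [n,𝟘]∈splitVec
    }

  module UnivariateTheory = SeriesTheory R isCR ℕ._≟_ 0 splitℕ splitℕ-isSplitting

  module MultivariateTheory (d : ℕ) =
    SeriesTheory R isCR (Vec.≡-dec ℕ._≟_) (Vec.replicate d 0) splitVec (splitVec-isSplitting d)

-- Laurent and Puiseux series

-- A directed union of copies of A, where act k embeds level m in level k ∙ m
-- and mul m n multiplies an element of level m by one of level n, with result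
-- in level m ∙ n.  Laurent series are such a union of the t^-m R⟦t⟧, and
-- Puiseux series one of the rings of Laurent series in z^(1/m).
record DirectedSystem (A : AbelianGroup 0ℓ 0ℓ) : Set₁ where
  open AbelianGroup A using (Carrier; _≈_) renaming (_∙_ to infixl 6 _+_)
  infixl 7 _∙_
  field
    Level               : Set
    _∙_                 : Level → Level → Level
    bottom              : Level
    isCommutativeMonoid : IsCommutativeMonoid _≡_ _∙_ bottom
    act                 : Level → Carrier → Carrier
    act-cong            : ∀ m {x y} → x ≈ y → act m x ≈ act m y
    act-+               : ∀ m x y → act m (x + y) ≈ act m x + act m y
    act-∙               : ∀ m n x → act (m ∙ n) x ≈ act m (act n x)
    act-injective       : ∀ m {x y} → act m x ≈ act m y → x ≈ y
    mul                 : Level → Level → Carrier → Carrier → Carrier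
    mul-congˡ           : ∀ m n {x x′} y → x ≈ x′ → mul m n x y ≈ mul m n x′ y
    mul-comm            : ∀ m n x y → mul m n x y ≈ mul n m y x
    mul-assoc           : ∀ m n p x y z →
                          mul (m ∙ n) p (mul m n x y) z ≈ mul m (n ∙ p) x (mul n p y z)
    mul-distribˡ        : ∀ m n x y z → mul m n x (y + z) ≈ mul m n x y + mul m n x z
    mul-act             : ∀ k m n x y → mul (k ∙ m) n (act k x) y ≈ act k (mul m n x y)
    one                 : Carrier
    mul-identityˡ       : ∀ m x → mul bottom m one x ≈ x

module DirectedUnion (A : AbelianGroup 0ℓ 0ℓ) (system : DirectedSystem A) where
  private module G = AbelianGroup A
  open AbelianGroup A using (_≈_; refl; sym; trans; setoid) renaming (_∙_ to infixl 6 _+_; ∙-cong to +-cong)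
  open AbelianGroupProperties A using (identityˡ-unique; inverseˡ-unique)
  open DirectedSystem system
  open SetoidReasoning setoid
  private
    levels : CommutativeMonoid 0ℓ 0ℓ
    levels = record { isCommutativeMonoid = isCommutativeMonoid }
    module M = CommutativeMonoid levels
    module MP = CommutativeSemigroupProperties M.commutativeSemigroup

  act-≡ : ∀ {m n} x → m ≡ n → act m x ≈ act n x
  act-≡ x ≡.refl = refl

  act-comm : ∀ m n x → act m (act n x) ≈ act n (act m x)
  act-comm m n x = trans (sym (act-∙ m n x)) (trans (act-≡ x (M.comm m n)) (act-∙ n m x))

  -- `act bottom` is idempotent, and an injective idempotent map is the identity.
  act-bottom : ∀ x → act bottom x ≈ x
  act-bottom x = act-injective bottom
    (trans (sym (act-∙ bottom bottom x)) (act-≡ x (M.identityˡ bottom)))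

  act-0 : ∀ m → act m G.ε ≈ G.ε
  act-0 m = identityˡ-unique _ _
    (trans (sym (act-+ m G.ε G.ε)) (act-cong m (G.identityˡ G.ε)))

  act-neg : ∀ m x → act m (x G.⁻¹) ≈ act m x G.⁻¹
  act-neg m x = inverseˡ-unique _ _
    (trans (sym (act-+ m _ x)) (trans (act-cong m (G.inverseˡ x)) (act-0 m)))

  ring : RawRing 0ℓ 0ℓ
  ring = record
    { Carrier = Level × G.Carrier
    ; _≈_     = λ (m , x) (n , y) → act n x ≈ act m y
    ; _+_     = λ (m , x) (n , y) → m ∙ n , act n x + act m y
    ; _*_     = λ (m , x) (n , y) → m ∙ n , mul m n x y
    ; -_      = λ (m , x) → m , x G.⁻¹
    ; 0#      = bottom , G.ε
    ; 1#      = bottom , one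
    }

  private
    module U = RawRing ring
  open U using () renaming (_≈_ to _~_)

  ~-sym : ∀ {x y} → x ~ y → y ~ x
  ~-sym p = sym p

  -- All three elements are carried to a common level; injectivity of `act n` then removes the level
  -- of the middle one.
  ~-trans : ∀ {x y z} → x ~ y → y ~ z → x ~ z
  ~-trans {m , x} {n , y} {p , z} x~y y~z = act-injective n (begin
    act n (act p x)  ≈⟨ act-comm n p x ⟩
    act p (act n x)  ≈⟨ act-cong p x~y ⟩
    act p (act m y)  ≈⟨ act-comm p m y ⟩
    act m (act p y)  ≈⟨ act-cong m y~z ⟩
    act m (act n z)  ≈⟨ act-comm m n z ⟩
    act n (act m z)  ∎)

  same-level : ∀ {m n x y} → m ≡ n → x ≈ y → (m , x) ~ (n , y)
  same-level {m} ≡.refl x≈y = act-cong m x≈y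

  raise : ∀ k m x → (m , x) ~ (k ∙ m , act k x)
  raise k m x = trans (act-∙ k m x) (act-comm k m x)

  zero-level : ∀ m {x} → x ≈ G.ε → (m , x) ~ U.0#
  zero-level m x≈0 = trans (act-cong bottom x≈0) (trans (act-0 bottom) (sym (act-0 m)))

  ~0⇒≈0 : ∀ {m x} → (m , x) ~ U.0# → x ≈ G.ε
  ~0⇒≈0 {m} {x} p = trans (sym (act-bottom x)) (trans p (act-0 m))

  level-+ : ∀ m x y → ((m , x) U.+ (m , y)) ~ (m , x + y)
  level-+ m x y = ~-sym {m , x + y} (~-trans {m , x + y} {m ∙ m , act m (x + y)}
    (raise m m (x + y)) (act-cong (m ∙ m) (act-+ m x y)))

  +-comm : ∀ x y → (x U.+ y) ~ (y U.+ x)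
  +-comm (m , x) (n , y) = same-level (M.comm m n) (G.comm _ _)

  +-congˡ : ∀ {x x′} y → x ~ x′ → (x U.+ y) ~ (x′ U.+ y)
  +-congˡ {m , x} {m′ , x′} (n , y) p = begin
    act (m′ ∙ n) (act n x + act m y)             ≈⟨ act-+ _ _ _ ⟩
    act (m′ ∙ n) (act n x) + act (m′ ∙ n) (act m y)
      ≈⟨ +-cong (trans (act-comm _ n x) (act-cong n (trans (act-≡ x (M.comm m′ n)) (act-∙ n m′ x))))
                (trans (act-comm _ m y) (act-cong m (act-∙ m′ n y))) ⟩
    act n (act n (act m′ x)) + act m (act m′ (act n y))
      ≈⟨ +-cong (act-cong n (act-cong n p)) (act-comm m m′ _) ⟩
    act n (act n (act m x′)) + act m′ (act m (act n y))
      ≈⟨ +-cong (trans (act-comm _ n x′) (act-cong n (trans (act-≡ x′ (M.comm m n)) (act-∙ n m x′))))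
                (trans (act-comm _ m′ y) (act-cong m′ (act-∙ m n y))) ⟨
    act (m ∙ n) (act n x′) + act (m ∙ n) (act m′ y) ≈⟨ act-+ _ _ _ ⟨
    act (m ∙ n) (act n x′ + act m′ y)            ∎

  *-comm : ∀ x y → (x U.* y) ~ (y U.* x)
  *-comm (m , x) (n , y) = same-level (M.comm m n) (mul-comm m n x y)

  mul-≡ : ∀ {m m′} n x y → m ≡ m′ → mul m n x y ≈ mul m′ n x y
  mul-≡ n x y ≡.refl = refl

  *-congˡ : ∀ {x x′} y → x ~ x′ → (x U.* y) ~ (x′ U.* y)
  *-congˡ {m , x} {m′ , x′} (n , y) p = begin
    act (m′ ∙ n) (mul m n x y)         ≈⟨ trans (act-≡ _ (M.comm m′ n)) (act-∙ n m′ _) ⟩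
    act n (act m′ (mul m n x y))       ≈⟨ act-cong n (mul-act m′ m n x y) ⟨
    act n (mul (m′ ∙ m) n (act m′ x) y) ≈⟨ act-cong n (mul-congˡ _ n y p) ⟩
    act n (mul (m′ ∙ m) n (act m x′) y) ≈⟨ act-cong n (mul-≡ n _ y (M.comm m′ m)) ⟩
    act n (mul (m ∙ m′) n (act m x′) y) ≈⟨ act-cong n (mul-act m m′ n x′ y) ⟩
    act n (act m (mul m′ n x′ y))      ≈⟨ trans (act-≡ _ (M.comm m n)) (act-∙ n m _) ⟨
    act (m ∙ n) (mul m′ n x′ y)        ∎

  mul-actʳ : ∀ k m n x y → mul m (k ∙ n) x (act k y) ≈ act k (mul m n x y)
  mul-actʳ k m n x y = trans (mul-comm m _ x _)
    (trans (mul-act k n m y x) (act-cong k (mul-comm n m y x)))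

  *-identityˡ : ∀ x → (U.1# U.* x) ~ x
  *-identityˡ (m , x) = same-level (M.identityˡ m) (mul-identityˡ m x)

  distribˡ : ∀ x y z → (x U.* (y U.+ z)) ~ ((x U.* y) U.+ (x U.* z))
  distribˡ (m , x) (n , y) (p , z) =
    -- The two products on the right each carry the level `m`, so their sum has it twice; the left
    -- side is first raised by `m` to match.
    ~-trans {_} {m ∙ (m ∙ (n ∙ p)) , _} (raise m (m ∙ (n ∙ p)) _)
      (same-level (≡.trans (≡.sym (M.assoc m m (n ∙ p))) (MP.interchange m m n p)) (begin
        act m (mul m (n ∙ p) x (act p y + act n z))
          ≈⟨ act-cong m (mul-distribˡ m (n ∙ p) x _ _) ⟩
        act m (mul m (n ∙ p) x (act p y) + mul m (n ∙ p) x (act n z))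
          ≈⟨ act-+ m _ _ ⟩
        act m (mul m (n ∙ p) x (act p y)) + act m (mul m (n ∙ p) x (act n z))
          ≈⟨ +-cong (act-cong m (trans (mul-comm m (n ∙ p) x _) (trans (mul-≡ m _ x (M.comm n p)) (trans (mul-act p n m y x) (act-cong p (mul-comm n m y x))))))
                    (act-cong m (mul-actʳ n m p x z)) ⟩
        act m (act p (mul m n x y)) + act m (act n (mul m p x z))
          ≈⟨ +-cong (act-∙ m p _) (act-∙ m n _) ⟨
        act (m ∙ p) (mul m n x y) + act (m ∙ n) (mul m p x z) ∎))

  +-assoc : ∀ x y z → ((x U.+ y) U.+ z) ~ (x U.+ (y U.+ z))
  +-assoc (m , x) (n , y) (p , z) = same-level (M.assoc m n p) (begin
    act p (act n x + act m y) + act (m ∙ n) z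
      ≈⟨ +-cong (act-+ p _ _) (act-∙ m n z) ⟩
    act p (act n x) + act p (act m y) + act m (act n z)
      ≈⟨ G.assoc _ _ _ ⟩
    act p (act n x) + (act p (act m y) + act m (act n z))
      ≈⟨ +-cong (trans (act-comm p n x) (sym (act-∙ n p x)))
                (trans (+-cong (act-comm p m y) refl) (sym (act-+ m _ _))) ⟩
    act (n ∙ p) x + act m (act p y + act n z) ∎)

  +-identityˡ : ∀ x → (U.0# U.+ x) ~ x
  +-identityˡ (m , x) = same-level (M.identityˡ m)
    (trans (+-cong (act-0 m) (act-bottom x)) (G.identityˡ x))

  -‿inverseˡ : ∀ x → ((U.- x) U.+ x) ~ U.0#
  -‿inverseˡ (m , x) = zero-level (m ∙ m)
    (trans (+-cong (act-neg m x) refl) (G.inverseˡ (act m x)))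

  -‿cong : ∀ {x y} → x ~ y → (U.- x) ~ (U.- y)
  -‿cong {m , x} {n , y} p = trans (act-neg n x) (trans (G.⁻¹-cong p) (sym (act-neg m y)))

  isCommutativeRing : IsCommutativeRawRing ring
  isCommutativeRing = record
    { isRing = record
      { +-isAbelianGroup = record
        { isGroup = record
          { isMonoid = record
            { isSemigroup = record
              { isMagma = record
                { isEquivalence = record
                  { refl  = refl
                  ; sym   = sym
                  ; trans = λ {x} {y} {z} → ~-trans {x} {y} {z}
                  }
                ; ∙-cong = λ {x} {x′} {y} {y′} →
                    cong₂ U._+_ (λ {x} {y} → +-congˡ {x} {y}) +-comm {x} {x′} {y} {y′}
                }
              ; assoc = +-assoc
              }
            ; identity = +-identityˡ
                       , λ x → ~-trans {x U.+ U.0#} {U.0# U.+ x} {x} (+-comm x U.0#) (+-identityˡ x)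
            }
          ; inverse = -‿inverseˡ
                    , λ x → ~-trans {x U.+ (U.- x)} {(U.- x) U.+ x} {U.0#} (+-comm x (U.- x)) (-‿inverseˡ x)
          ; ⁻¹-cong = λ {x} {y} → -‿cong {x} {y}
          }
        ; comm = +-comm
        }
      ; *-cong = λ {x} {x′} {y} {y′} →
          cong₂ U._*_ (λ {x} {y} → *-congˡ {x} {y}) *-comm {x} {x′} {y} {y′}
      ; *-assoc = λ (m , x) (n , y) (p , z) → same-level (M.assoc m n p) (mul-assoc m n p x y z)
      ; *-identity = *-identityˡ
                   , λ x → ~-trans {x U.* U.1#} {U.1# U.* x} {x} (*-comm x U.1#) (*-identityˡ x)
      ; distrib = distribˡ
                , λ x y z → ~-trans {(y U.+ z) U.* x} {x U.* (y U.+ z)} {(y U.* x) U.+ (z U.* x)}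
                    (*-comm (y U.+ z) x)
                    (~-trans {x U.* (y U.+ z)} {(x U.* y) U.+ (x U.* z)} {(y U.* x) U.+ (z U.* x)}
                      (distribˡ x y z)
                      (cong₂ U._+_ (λ {x} {y} → +-congˡ {x} {y}) +-comm
                        {x U.* y} {y U.* x} {x U.* z} {z U.* x} (*-comm x y) (*-comm x z)))
      }
    ; *-comm = *-comm
    }
    where
    cong₂ : (_⊙_ : U.Carrier → U.Carrier → U.Carrier) →
            (∀ {x x′} y → x ~ x′ → (x ⊙ y) ~ (x′ ⊙ y)) →
            (∀ x y → (x ⊙ y) ~ (y ⊙ x)) →
            ∀ {x x′ y y′} → x ~ x′ → y ~ y′ → (x ⊙ y) ~ (x′ ⊙ y′)
    cong₂ _⊙_ congˡ comm {x} {x′} {y} {y′} p q =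
      ~-trans {x ⊙ y} {x′ ⊙ y} {x′ ⊙ y′} (congˡ y p)
        (~-trans {x′ ⊙ y} {y ⊙ x′} {x′ ⊙ y′} (comm x′ y)
          (~-trans {y ⊙ x′} {y′ ⊙ x′} {x′ ⊙ y′} (congˡ x′ q) (comm y′ x′)))

module LaurentTheory (R : RawRing 0ℓ 0ℓ) (isCR : IsCommutativeRawRing R) where
  private module R = RingTheory R isCR
  open R using (refl; sym; trans; reflexive; +-cong; +-congʳ; +-identityˡ; zeroˡ)
  open UnivariateSeries R using () renaming (ring to R⟦t⟧)
  open Laurent R
  private
    module S = RingTheory R⟦t⟧ (UnivariateTheory.isCommutativeRing R isCR)

  shift-cong : ∀ k {f g} → f S.≈ g → (t^ k · f) S.≈ (t^ k · g)
  shift-cong zero    p n       = p n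
  shift-cong (suc k) p zero    = refl
  shift-cong (suc k) p (suc n) = shift-cong k p n

  shift-homo-+ : ∀ k f g → (t^ k · (f S.+ g)) S.≈ ((t^ k · f) S.+ (t^ k · g))
  shift-homo-+ zero    f g n       = refl
  shift-homo-+ (suc k) f g zero    = sym (+-identityˡ _)
  shift-homo-+ (suc k) f g (suc n) = shift-homo-+ k f g n

  shift-+ : ∀ k l f → (t^ (k ℕ.+ l) · f) S.≈ (t^ k · (t^ l · f))
  shift-+ zero    l f n       = refl
  shift-+ (suc k) l f zero    = refl
  shift-+ (suc k) l f (suc n) = shift-+ k l f n

  shift-coefficient : ∀ k f n → (t^ k · f) (k ℕ.+ n) ≡ f n
  shift-coefficient zero    f n = ≡.refl
  shift-coefficient (suc k) f n = shift-coefficient k f n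

  shift-coefficient-< : ∀ {k n} f → n ℕ.< k → (t^ k · f) n ≡ R.0#
  shift-coefficient-< {suc k} {zero}  f _           = ≡.refl
  shift-coefficient-< {suc k} {suc n} f (ℕ.s≤s n<k) = shift-coefficient-< f n<k

  shift-injective : ∀ k {f g} → (t^ k · f) S.≈ (t^ k · g) → f S.≈ g
  shift-injective k {f} {g} p n = trans (reflexive (≡.sym (shift-coefficient k f n)))
    (trans (p (k ℕ.+ n)) (reflexive (shift-coefficient k g n)))

  shift-* : ∀ k f g → ((t^ k · f) S.* g) S.≈ (t^ k · (f S.* g))
  shift-* zero    f g n       = refl
  shift-* (suc k) f g zero    = trans (R.+-identityʳ _) (zeroˡ _)
  shift-* (suc k) f g (suc n) = begin
    ((t^ suc k · f) S.* g) (suc n)            ≡⟨ ∑ℕ-suc R isCR n _ ⟩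
    R.0# R.* g (suc n) R.+ ((t^ k · f) S.* g) n ≈⟨ +-congʳ (zeroˡ _) ⟩
    R.0# R.+ ((t^ k · f) S.* g) n             ≈⟨ +-identityˡ _ ⟩
    ((t^ k · f) S.* g) n                      ≈⟨ shift-* k f g n ⟩
    (t^ k · (f S.* g)) n                      ∎
    where open R using (begin_; _∎; step-≈-⟩; step-≡-⟩)

  system : DirectedSystem S.+-abelianGroup
  system = record
    { Level               = ℕ
    ; _∙_                 = ℕ._+_
    ; bottom              = 0
    ; isCommutativeMonoid = ℕ.+-0-isCommutativeMonoid
    ; act                 = t^_·_
    ; act-cong            = shift-cong
    ; act-+               = shift-homo-+
    ; act-∙               = shift-+
    ; act-injective       = shift-injective
    ; mul                 = λ _ _ → S._*_
    ; mul-congˡ           = λ _ _ y → S.*-congʳ {y}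
    ; mul-comm            = λ _ _ → S.*-comm
    ; mul-assoc           = λ _ _ _ → S.*-assoc
    ; mul-distribˡ        = λ _ _ → S.distribˡ
    ; mul-act             = λ k _ _ → shift-* k
    ; one                 = S.1#
    ; mul-identityˡ       = λ _ → S.*-identityˡ
    }

  private module U = DirectedUnion S.+-abelianGroup system
  open U public using (same-level; level-+; ~0⇒≈0; zero-level)

  -- `t^- p · f` is the pair `p , f` of the directed union under another constructor, with the same
  -- operations, so every condition on the map holds by definition.
  isCommutativeRing : IsCommutativeRawRing ring
  isCommutativeRing = RingMonomorphism.isCommutativeRing isMonomorphism U.isCommutativeRing
    where
    isMonomorphism : IsRingMonomorphism ring U.ring (λ (t^- p · f) → p , f)
    isMonomorphism = record
      { isRingHomomorphism = record
        { isSemiringHomomorphism = record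
          { isNearSemiringHomomorphism = record
            { +-isMonoidHomomorphism = record
              { isMagmaHomomorphism = record
                { isRelHomomorphism = record { cong = λ p → p }
                ; homo = λ _ _ _ → refl
                }
              ; ε-homo = λ _ → refl
              }
            ; *-homo = λ _ _ _ → refl
            }
          ; 1#-homo = λ _ → refl
          }
        ; -‿homo = λ _ _ → refl
        }
      ; injective = λ p → p
      }

  private module L = RingTheory ring isCommutativeRing

  -- The substitution of t^k for t in a power series.
  dilate : (k : ℕ) .{{_ : NonZero k}} → S.Carrier → S.Carrier
  dilate k f n = LaurentSeries.body (substPower k (t^- 0 · f)) n

  module _ (k : ℕ) .{{_ : NonZero k}} where

    dilate-multiple : ∀ f n → dilate k f (n ℕ.* k) ≡ f n
    dilate-multiple f n with k ∣? n ℕ.* k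
    ... | yes _   = ≡.cong f (m*n/n≡m n k)
    ... | no  k∤n = contradiction (n∣m*n n) k∤n

    dilate-∤ : ∀ f {n} → ¬ (k ∣ n) → dilate k f n ≡ R.0#
    dilate-∤ f {n} k∤n with k ∣? n
    ... | yes k∣n = contradiction k∣n k∤n
    ... | no  _   = ≡.refl

    dilate-ext : ∀ {f g : S.Carrier} → (∀ n → f (n ℕ.* k) R.≈ g (n ℕ.* k)) →
                 (∀ {n} → ¬ (k ∣ n) → f n R.≈ g n) → f S.≈ g
    dilate-ext p q n with k ∣? n
    ... | yes (divides-refl m) = p m
    ... | no  k∤n              = q k∤n

    dilate-cong : ∀ {f g} → f S.≈ g → dilate k f S.≈ dilate k g
    dilate-cong p n with k ∣? n
    ... | yes _ = p (n / k)
    ... | no  _ = refl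

    dilate-+ : ∀ f g → dilate k (f S.+ g) S.≈ (dilate k f S.+ dilate k g)
    dilate-+ f g n with k ∣? n
    ... | yes _ = refl
    ... | no  _ = sym (+-identityˡ _)

    dilate-injective : ∀ {f g} → dilate k f S.≈ dilate k g → f S.≈ g
    dilate-injective {f} {g} p n = trans (reflexive (≡.sym (dilate-multiple f n)))
      (trans (p (n ℕ.* k)) (reflexive (dilate-multiple g n)))

    -- Below degree k q both sides vanish. From there on the index is k q + m, and k divides it
    -- exactly when it divides m.
    dilate-shift : ∀ q f → dilate k (t^ q · f) S.≈ (t^ (k ℕ.* q) · dilate k f)
    dilate-shift q f n with ℕ.<-≤-connex n (k ℕ.* q)
    ... | inj₁ n<kq = trans (lemma n<kq) (reflexive (≡.sym (shift-coefficient-< (dilate k f) n<kq)))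
      where
      lemma : ∀ {n} → n ℕ.< k ℕ.* q → dilate k (t^ q · f) n R.≈ R.0#
      lemma {n} n<kq with k ∣? n
      ... | no  _                = refl
      ... | yes (divides-refl m) = reflexive (≡.trans
        (≡.cong (t^ q · f) (m*n/n≡m m k))
        (shift-coefficient-< f (ℕ.*-cancelʳ-< k m q (≡.subst (m ℕ.* k ℕ.<_) (ℕ.*-comm k q) n<kq))))
    ... | inj₂ kq≤n with ℕ.m≤n⇒∃[o]m+o≡n kq≤n
    ...   | m , ≡.refl = trans (dilate-ext {λ m → dilate k (t^ q · f) (k ℕ.* q ℕ.+ m)} {dilate k f} multiple ∤ m)
                               (reflexive (≡.sym (shift-coefficient (k ℕ.* q) (dilate k f) m)))
      where
      kq+mk : ∀ m → k ℕ.* q ℕ.+ m ℕ.* k ≡ (q ℕ.+ m) ℕ.* k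
      kq+mk m = ≡.trans (≡.cong (ℕ._+ m ℕ.* k) (ℕ.*-comm k q)) (≡.sym (ℕ.*-distribʳ-+ k q m))
      multiple : ∀ m → dilate k (t^ q · f) (k ℕ.* q ℕ.+ m ℕ.* k) R.≈ dilate k f (m ℕ.* k)
      multiple m = reflexive (≡.trans (≡.cong (dilate k (t^ q · f)) (kq+mk m))
        (≡.trans (dilate-multiple (t^ q · f) (q ℕ.+ m))
        (≡.trans (shift-coefficient q f m) (≡.sym (dilate-multiple f m)))))
      ∤ : ∀ {m} → ¬ (k ∣ m) → dilate k (t^ q · f) (k ℕ.* q ℕ.+ m) R.≈ dilate k f m
      ∤ {m} k∤m = reflexive (≡.trans
        (dilate-∤ (t^ q · f) (λ k∣ → k∤m (∣m+n∣m⇒∣n k∣ (m∣m*n q))))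
        (≡.sym (dilate-∤ f k∤m)))

    dilate-1 : dilate k S.1# S.≈ S.1#
    dilate-1 = dilate-ext multiple ∤
      where
      multiple : ∀ n → dilate k S.1# (n ℕ.* k) R.≈ S.1# (n ℕ.* k)
      multiple zero    = reflexive (dilate-multiple S.1# 0)
      multiple (suc n) = trans (reflexive (dilate-multiple S.1# (suc n)))
        (sym (UnivariateTheory.monomial-off-diagonal R isCR R.1# (ℕ.≢-nonZero⁻¹ (suc n ℕ.* k) {{ℕ.m*n≢0 (suc n) k}})))
      ∤ : ∀ {n} → ¬ (k ∣ n) → dilate k S.1# n R.≈ S.1# n
      ∤ {zero}  k∤0 = contradiction (k ∣0) k∤0
      ∤ {suc n} k∤n = reflexive (dilate-∤ S.1# k∤n)

  private
    ∑ℕ : ℕ → (ℕ → ℕ → R.Carrier) → R.Carrier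
    ∑ℕ n F = R.∑ (splitℕ n) (λ (i , j) → F i j)

  ∑ℕ-drop : ∀ k n (F : ℕ → ℕ → R.Carrier) → (∀ i j → i ℕ.< k → F i j R.≈ R.0#) →
            ∑ℕ (k ℕ.+ n) F R.≈ ∑ℕ n (λ i j → F (k ℕ.+ i) j)
  ∑ℕ-drop zero    n F p = refl
  ∑ℕ-drop (suc k) n F p = trans (reflexive (∑ℕ-suc R isCR (k ℕ.+ n) F))
    (trans (+-cong (p 0 _ (ℕ.s≤s ℕ.z≤n)) (∑ℕ-drop k n (F ∘ suc) (λ i j i<k → p (suc i) j (ℕ.s≤s i<k))))
           (+-identityˡ _))

  ∑ℕ-multiples : ∀ k .{{_ : NonZero k}} m (F : ℕ → ℕ → R.Carrier) →
    (∀ i j → ¬ (k ∣ i) → F i j R.≈ R.0#) →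
    ∑ℕ (m ℕ.* k) F R.≈ ∑ℕ m (λ i j → F (i ℕ.* k) (j ℕ.* k))
  ∑ℕ-multiples k         zero    F p = refl
  ∑ℕ-multiples k@(suc l) (suc m) F p = begin
    ∑ℕ (k ℕ.+ m ℕ.* k) F
      ≡⟨ ∑ℕ-suc R isCR (l ℕ.+ m ℕ.* k) F ⟩
    F 0 (suc m ℕ.* k) R.+ ∑ℕ (l ℕ.+ m ℕ.* k) (F ∘ suc)
      -- Since k = l + 1, the l indices following 0 are 1, ..., k - 1, none of which is a multiple
      -- of k.
      ≈⟨ R.+-congˡ (∑ℕ-drop l (m ℕ.* k) (F ∘ suc) (λ i j i<l → p (suc i) j (>⇒∤ (ℕ.s≤s i<l)))) ⟩
    F 0 (suc m ℕ.* k) R.+ ∑ℕ (m ℕ.* k) (λ i j → F (k ℕ.+ i) j)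
      ≈⟨ R.+-congˡ (∑ℕ-multiples k m (λ i j → F (k ℕ.+ i) j) (λ i j k∤i → p (k ℕ.+ i) j (λ k∣ → k∤i (∣m+n∣m⇒∣n k∣ ∣-refl)))) ⟩
    F 0 (suc m ℕ.* k) R.+ ∑ℕ m (λ i j → F (suc i ℕ.* k) (j ℕ.* k))
      ≡⟨ ∑ℕ-suc R isCR m (λ i j → F (i ℕ.* k) (j ℕ.* k)) ⟨
    ∑ℕ (suc m) (λ i j → F (i ℕ.* k) (j ℕ.* k)) ∎
    where open R using (begin_; _∎; step-≈-⟩; step-≡-⟩; step-≡-⟨)

  module _ (k : ℕ) .{{_ : NonZero k}} where

    dilate-* : ∀ f g → dilate k (f S.* g) S.≈ (dilate k f S.* dilate k g)
    dilate-* f g = dilate-ext k multiple ∤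
      where
      multiple : ∀ n → dilate k (f S.* g) (n ℕ.* k) R.≈ (dilate k f S.* dilate k g) (n ℕ.* k)
      multiple n = trans (reflexive (dilate-multiple k (f S.* g) n)) (sym (trans
        (∑ℕ-multiples k n _ (λ i j k∤i → trans (R.*-congʳ (reflexive (dilate-∤ k f k∤i))) (zeroˡ _)))
        (R.∑-cong (splitℕ n) (λ (i , j) →
          R.*-cong (reflexive (dilate-multiple k f i)) (reflexive (dilate-multiple k g j))))))
      ∤ : ∀ {n} → ¬ (k ∣ n) → dilate k (f S.* g) n R.≈ (dilate k f S.* dilate k g) n
      ∤ {n} k∤n = trans (reflexive (dilate-∤ k (f S.* g) k∤n)) (sym (trans
        (R.∑-cong-∈ (splitℕ n) {_} {λ _ → R.0#} (λ {(i , j)} ij∈ → term i j ij∈))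
        (R.∑-0 (splitℕ n) (λ _ → refl))))
        where
        -- If k divided both members it would divide their sum n; so one of the two dilated factors
        -- vanishes.
        term : ∀ i j → (i , j) ∈ splitℕ n → dilate k f i R.* dilate k g j R.≈ R.0#
        term i j ij∈ with k ∣? i | k ∣? j
        ... | no  _   | _       = zeroˡ _
        ... | yes _   | no _    = R.zeroʳ _
        ... | yes k∣i | yes k∣j =
          contradiction (≡.subst (k ∣_) (splitℕ-sum n ij∈) (∣m∣n⇒∣m+n k∣i k∣j)) k∤n

  dilate-dilate : ∀ k l .{{_ : NonZero k}} .{{_ : NonZero l}} f →
    dilate (k ℕ.* l) {{ℕ.m*n≢0 k l}} f S.≈ dilate k (dilate l f)
  dilate-dilate k l f = dilate-ext (k ℕ.* l) {{kl≢0}} multiple ∤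
    where
    kl≢0 : NonZero (k ℕ.* l)
    kl≢0 = ℕ.m*n≢0 k l
    multiple : ∀ n → dilate (k ℕ.* l) {{kl≢0}} f (n ℕ.* (k ℕ.* l)) R.≈ dilate k (dilate l f) (n ℕ.* (k ℕ.* l))
    multiple n = reflexive (≡.trans (dilate-multiple (k ℕ.* l) {{kl≢0}} f n) (≡.sym (≡.trans
      (≡.cong (dilate k (dilate l f)) (≡.trans (≡.cong (n ℕ.*_) (ℕ.*-comm k l)) (≡.sym (ℕ.*-assoc n l k))))
      (≡.trans (dilate-multiple k (dilate l f) (n ℕ.* l)) (dilate-multiple l f n)))))
    ∤ : ∀ {n} → ¬ (k ℕ.* l ∣ n) → dilate (k ℕ.* l) {{kl≢0}} f n R.≈ dilate k (dilate l f) n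
    ∤ {n} kl∤n = trans (reflexive (dilate-∤ (k ℕ.* l) {{kl≢0}} f kl∤n)) (sym (lemma kl∤n))
      where
      lemma : ∀ {n} → ¬ (k ℕ.* l ∣ n) → dilate k (dilate l f) n R.≈ R.0#
      lemma {n} kl∤n with k ∣? n
      ... | no  _                = refl
      ... | yes (divides-refl m) = reflexive (≡.trans (≡.cong (dilate l f) (m*n/n≡m m k))
        (dilate-∤ l f (λ l∣m → kl∤n (≡.subst (_∣ m ℕ.* k) (ℕ.*-comm l k) (*-monoˡ-∣ k l∣m)))))

  module _ (k : ℕ) .{{_ : NonZero k}} where

    substPower-cong : ∀ {x y} → x L.≈ y → substPower k x L.≈ substPower k y
    substPower-cong {t^- p · f} {t^- q · g} x≈y =
      S.trans (S.sym (dilate-shift k q f)) (S.trans (dilate-cong k x≈y) (dilate-shift k p g))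

    substPower-injective : ∀ {x y} → substPower k x L.≈ substPower k y → x L.≈ y
    substPower-injective {t^- p · f} {t^- q · g} p≈ = dilate-injective k
      (S.trans (dilate-shift k q f) (S.trans p≈ (S.sym (dilate-shift k p g))))

    substPower-+ : ∀ x y → substPower k (x L.+ y) L.≈ (substPower k x L.+ substPower k y)
    substPower-+ (t^- p · f) (t^- q · g) = same-level (ℕ.*-distribˡ-+ k p q)
      (S.trans (dilate-+ k (t^ q · f) (t^ p · g)) (S.+-cong (dilate-shift k q f) (dilate-shift k p g)))

    substPower-* : ∀ x y → substPower k (x L.* y) L.≈ (substPower k x L.* substPower k y)
    substPower-* (t^- p · f) (t^- q · g) = same-level (ℕ.*-distribˡ-+ k p q) (dilate-* k f g)

    substPower-1 : substPower k L.1# L.≈ L.1#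
    substPower-1 = same-level (ℕ.*-zeroʳ k) (dilate-1 k)

  substPower-∘ : ∀ k l .{{_ : NonZero k}} .{{_ : NonZero l}} x →
    substPower (k ℕ.* l) {{ℕ.m*n≢0 k l}} x L.≈ substPower k (substPower l x)
  substPower-∘ k l (t^- p · f) = same-level (ℕ.*-assoc k l p) (dilate-dilate k l f)

module _ (R : RawRing 0ℓ 0ℓ) (isCR : IsCommutativeRawRing R) where
  open RingTheory R isCR
  private
    module S = RingTheory (UnivariateSeries.ring R) (UnivariateTheory.isCommutativeRing R isCR)

  -- The coefficient of F G at n is G n plus terms containing earlier coefficients of G, so these
  -- vanish one after another. Constant term 1 makes each step free of division.
  monic⇒regular : ∀ {F} → F 0 ≈ 1# → S.Regular F
  monic⇒regular {F} F₀≈1 G FG≈0 n = <-rec _ step n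
    where
    step : ∀ n → (∀ {m} → m ℕ.< n → G m ≈ 0#) → G n ≈ 0#
    step zero    _  = begin
      G 0              ≈⟨ trans (*-congʳ F₀≈1) (*-identityˡ _) ⟨
      F 0 * G 0        ≈⟨ +-identityʳ _ ⟨
      F 0 * G 0 + 0#   ≈⟨ FG≈0 0 ⟩
      0#               ∎
    step (suc n) ih = begin
      G (suc n)               ≈⟨ trans (*-congʳ F₀≈1) (*-identityˡ _) ⟨
      F 0 * G (suc n)         ≈⟨ +-identityʳ _ ⟨
      F 0 * G (suc n) + 0#    ≈⟨ +-congˡ (trans (∑-cong-∈ (splitℕ n) {_} {λ _ → 0#} (λ {(i , j)} → term i j))
                                                (∑-0 (splitℕ n) (λ _ → refl))) ⟨
      F 0 * G (suc n) + ∑ (splitℕ n) (λ (i , j) → F (suc i) * G j)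
                              ≡⟨ ∑ℕ-suc R isCR n (λ i j → F i * G j) ⟨
      (F S.* G) (suc n)       ≈⟨ FG≈0 (suc n) ⟩
      0#                      ∎
      where
      term : ∀ i j → (i , j) ∈ splitℕ n → F (suc i) * G j ≈ 0#
      term i j ij∈ = trans (*-congˡ (ih (ℕ.s≤s (≡.subst (j ℕ.≤_) (splitℕ-sum n ij∈) (ℕ.m≤n+m j i))))) (zeroʳ _)

-- The proof of nonzeroness is irrelevant, so levels with equal values are propositionally equal, as
-- the level monoid of a `DirectedSystem` demands.
record ℕ⁺ : Set where
  constructor positive
  field
    value       : ℕ
    .{{nonZero}} : NonZero value

module PuiseuxTheory (R : RawRing 0ℓ 0ℓ) (isCR : IsCommutativeRawRing R) where
  private
    module R = RingTheory R isCR
  open UnivariateSeries R using () renaming (ring to R⟦t⟧)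
  open Puiseux R using (ring)
  private
    module S = RingTheory R⟦t⟧ (UnivariateTheory.isCommutativeRing R isCR)
    module LT = LaurentTheory R isCR
    module L = RingTheory (Laurent.ring R) LT.isCommutativeRing
  open Laurent R using (substPower)
  open LT using (substPower-cong; substPower-injective; substPower-+; substPower-*; substPower-1; substPower-∘)

  substPower-≡ : ∀ {k l} .{{_ : NonZero k}} .{{_ : NonZero l}} x → k ≡ l → substPower k x L.≈ substPower l x
  substPower-≡ {k} {{k≢0}} x ≡.refl = L.refl {substPower k {{k≢0}} x}

  substPower-comm : ∀ k l .{{_ : NonZero k}} .{{_ : NonZero l}} x →
    substPower k (substPower l x) L.≈ substPower l (substPower k x)
  substPower-comm k l x = begin
    substPower k (substPower l x)            ≈⟨ substPower-∘ k l x ⟨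
    substPower (k ℕ.* l) {{ℕ.m*n≢0 k l}} x   ≈⟨ substPower-≡ {{ℕ.m*n≢0 k l}} {{ℕ.m*n≢0 l k}} x (ℕ.*-comm k l) ⟩
    substPower (l ℕ.* k) {{ℕ.m*n≢0 l k}} x   ≈⟨ substPower-∘ l k x ⟩
    substPower l (substPower k x)            ∎
    where open L using (begin_; _∎; step-≈-⟩; step-≈-⟨)

  substPower-1ˡ : ∀ x → substPower 1 x L.≈ x
  substPower-1ˡ x = substPower-injective 1 {substPower 1 x} {x} (L.sym {substPower 1 x} {substPower 1 (substPower 1 x)} (substPower-∘ 1 1 x))

  _⊠_ : ℕ⁺ → ℕ⁺ → ℕ⁺
  positive m ⊠ positive n = positive (m ℕ.* n) {{ℕ.m*n≢0 m n}}

  ℕ⁺-≡ : ∀ {m n} → ℕ⁺.value m ≡ ℕ⁺.value n → m ≡ n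
  ℕ⁺-≡ ≡.refl = ≡.refl

  act : ℕ⁺ → L.Carrier → L.Carrier
  act (positive m) = substPower m

  mul : ℕ⁺ → ℕ⁺ → L.Carrier → L.Carrier → L.Carrier
  mul m n x y = act n x L.* act m y

  act-⊠ : ∀ m n x → act (m ⊠ n) x L.≈ act m (act n x)
  act-⊠ (positive m) (positive n) = substPower-∘ m n

  act-comm : ∀ m n x → act m (act n x) L.≈ act n (act m x)
  act-comm (positive m) (positive n) = substPower-comm m n

  act-cong : ∀ m {x y} → x L.≈ y → act m x L.≈ act m y
  act-cong (positive m) {x} {y} = substPower-cong m {x} {y}

  act-* : ∀ m x y → act m (x L.* y) L.≈ (act m x L.* act m y)
  act-* (positive m) = substPower-* m

  act-+ : ∀ m x y → act m (x L.+ y) L.≈ (act m x L.+ act m y)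
  act-+ (positive m) = substPower-+ m

  ⊠-isCommutativeMonoid : IsCommutativeMonoid _≡_ _⊠_ (positive 1)
  ⊠-isCommutativeMonoid = record
    { isMonoid = record
      { isSemigroup = record
        { isMagma = record { isEquivalence = ≡.isEquivalence ; ∙-cong = ≡.cong₂ _⊠_ }
        ; assoc = λ (positive l) (positive m) (positive n) → ℕ⁺-≡ (ℕ.*-assoc l m n)
        }
      ; identity = (λ (positive m) → ℕ⁺-≡ (ℕ.*-identityˡ m)) , (λ (positive m) → ℕ⁺-≡ (ℕ.*-identityʳ m))
      }
    ; comm = λ (positive m) (positive n) → ℕ⁺-≡ (ℕ.*-comm m n)
    }

  system : DirectedSystem L.+-abelianGroup
  system = record
    { Level               = ℕ⁺
    ; _∙_                 = _⊠_
    ; bottom              = positive 1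
    ; isCommutativeMonoid = ⊠-isCommutativeMonoid
    ; act                 = act
    ; act-cong            = λ m {x} {y} → act-cong m {x} {y}
    ; act-+               = act-+
    ; act-∙               = act-⊠
    ; act-injective       = λ (positive m) {x} {y} → substPower-injective m {x} {y}
    ; mul                 = mul
    ; mul-congˡ           = λ m n {x} {x′} y p → L.*-congʳ {act m y} {act n x} {act n x′} (act-cong n {x} {x′} p)
    ; mul-comm            = λ m n x y → L.*-comm (act n x) (act m y)
    ; mul-assoc           = mul-assoc
    ; mul-distribˡ        = λ m n x y z → L.trans
        {act n x L.* act m (y L.+ z)} {act n x L.* (act m y L.+ act m z)} {act n x L.* act m y L.+ act n x L.* act m z}
        (L.*-congˡ {act n x} {act m (y L.+ z)} {act m y L.+ act m z} (act-+ m y z)) (L.distribˡ (act n x) (act m y) (act m z))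
    ; mul-act             = mul-act
    ; one                 = L.1#
    ; mul-identityˡ       = mul-identityˡ
    }
    where
    open L using (begin_; _∎; step-≈-⟩; step-≈-⟨)
    mul-assoc : ∀ m n p x y z → mul (m ⊠ n) p (mul m n x y) z L.≈ mul m (n ⊠ p) x (mul n p y z)
    mul-assoc m n p x y z = begin
      act p (act n x L.* act m y) L.* act (m ⊠ n) z
        ≈⟨ L.*-cong {act p (act n x L.* act m y)} {act p (act n x) L.* act p (act m y)} {act (m ⊠ n) z} {act m (act n z)}
             (act-* p (act n x) (act m y)) (act-⊠ m n z) ⟩
      act p (act n x) L.* act p (act m y) L.* act m (act n z)
        ≈⟨ L.*-assoc (act p (act n x)) (act p (act m y)) (act m (act n z)) ⟩
      act p (act n x) L.* (act p (act m y) L.* act m (act n z))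
        ≈⟨ L.*-cong {act p (act n x)} {act n (act p x)} {act p (act m y) L.* act m (act n z)} {act m (act p y) L.* act m (act n z)}
             (act-comm p n x) (L.*-congʳ {act m (act n z)} {act p (act m y)} {act m (act p y)} (act-comm p m y)) ⟩
      act n (act p x) L.* (act m (act p y) L.* act m (act n z))
        ≈⟨ L.*-cong {act (n ⊠ p) x} {act n (act p x)} {act m (act p y L.* act n z)} {act m (act p y) L.* act m (act n z)}
             (act-⊠ n p x) (act-* m (act p y) (act n z)) ⟨
      act (n ⊠ p) x L.* act m (act p y L.* act n z) ∎
    mul-act : ∀ k m n x y → mul (k ⊠ m) n (act k x) y L.≈ act k (mul m n x y)
    mul-act k m n x y = begin
      act n (act k x) L.* act (k ⊠ m) y
        ≈⟨ L.*-cong {act n (act k x)} {act k (act n x)} {act (k ⊠ m) y} {act k (act m y)}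
             (act-comm n k x) (act-⊠ k m y) ⟩
      act k (act n x) L.* act k (act m y)  ≈⟨ act-* k (act n x) (act m y) ⟨
      act k (act n x L.* act m y)          ∎
    mul-identityˡ : ∀ m x → mul (positive 1) m L.1# x L.≈ x
    mul-identityˡ (positive m) x = begin
      substPower m L.1# L.* substPower 1 x
        ≈⟨ L.*-cong {substPower m L.1#} {L.1#} {substPower 1 x} {x} (substPower-1 m) (substPower-1ˡ x) ⟩
      L.1# L.* x  ≈⟨ L.*-identityˡ x ⟩
      x           ∎

  private module U = DirectedUnion L.+-abelianGroup system

  isCommutativeRing : IsCommutativeRawRing ring
  isCommutativeRing = RingMonomorphism.isCommutativeRing isMonomorphism U.isCommutativeRing
    where
    isMonomorphism : IsRingMonomorphism ring U.ring (λ (puiseux m x) → positive m , x)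
    isMonomorphism = record
      { isRingHomomorphism = record
        { isSemiringHomomorphism = record
          { isNearSemiringHomomorphism = record
            { +-isMonoidHomomorphism = record
              { isMagmaHomomorphism = record
                { isRelHomomorphism = record { cong = λ p → p }
                ; homo = λ x y → P-refl (x P.+ y)
                }
              ; ε-homo = P-refl P.0#
              }
            ; *-homo = λ x y → P-refl (x P.* y)
            }
          ; 1#-homo = P-refl P.1#
          }
        ; -‿homo = λ x → P-refl (P.- x)
        }
      ; injective = λ p → p
      }
      where
      module P = RawRing ring
      P-refl : ∀ x → x P.≈ x
      P-refl (puiseux m x) = L.refl {substPower m x}

  private module P = RingTheory ring isCommutativeRing

  module _ (m : ℕ) .{{_ : NonZero m}} where

    -- The copy of the power series ring in z^(1/m) inside the Puiseux series. Elements of positive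
    -- order lie in such a copy, which reduces questions about them to constant terms.
    root : S.Carrier → P.Carrier
    root f = puiseux m (t^- 0 · f)

    root-cong : ∀ {f g} → f S.≈ g → root f P.≈ root g
    root-cong {f} {g} p = substPower-cong m {t^- 0 · f} {t^- 0 · g} p

    root-+ : ∀ f g → (root f P.+ root g) P.≈ root (f S.+ g)
    root-+ f g = U.level-+ (positive m) (t^- 0 · f) (t^- 0 · g)

    root-* : ∀ f g → (root f P.* root g) P.≈ root (f S.* g)
    root-* f g = P.sym {root (f S.* g)} {root f P.* root g} (P.trans {root (f S.* g)} {puiseux (m ℕ.* m) {{ℕ.m*n≢0 m m}} (substPower m (t^- 0 · (f S.* g)))} {root f P.* root g}
      (U.raise (positive m) (positive m) (t^- 0 · (f S.* g)))
      (act-cong (positive m ⊠ positive m) {substPower m (t^- 0 · (f S.* g))} {substPower m (t^- 0 · f) L.* substPower m (t^- 0 · g)}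
        (substPower-* m (t^- 0 · f) (t^- 0 · g))))

    root-1 : P.1# P.≈ root S.1#
    root-1 = L.trans {substPower m L.1#} {L.1#} {substPower 1 L.1#}
      (substPower-1 m) (L.sym {substPower 1 L.1#} {L.1#} (substPower-1 1))

    root-^ : ∀ f k → (root f P.^ k) P.≈ root (f S.^ k)
    root-^ f zero    = root-1
    root-^ f (suc k) = P.trans {root f P.* root f P.^ k} {root f P.* root (f S.^ k)} {root (f S.^ suc k)}
      (P.*-congˡ {root f} {root f P.^ k} {root (f S.^ k)} (root-^ f k)) (root-* f (f S.^ k))

    root-tree-equation : ∀ z T n → T S.≈ (S.1# S.+ z S.* T S.^ (n ℕ.+ 1)) →
      root T P.≈ (P.1# P.+ (root z P.* root T P.^ n) P.* root T)
    root-tree-equation z T n T-equation = begin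
      root T
        ≈⟨ root-cong {T} {S.1# S.+ z S.* T S.^ (n ℕ.+ 1)} T-equation ⟩
      root (S.1# S.+ z S.* T S.^ (n ℕ.+ 1))
        ≈⟨ root-+ S.1# (z S.* T S.^ (n ℕ.+ 1)) ⟨
      root S.1# P.+ root (z S.* T S.^ (n ℕ.+ 1))
        ≈⟨ P.+-cong {P.1#} {root S.1#} {root z P.* root (T S.^ (n ℕ.+ 1))} {root (z S.* T S.^ (n ℕ.+ 1))}
             root-1 (root-* z (T S.^ (n ℕ.+ 1))) ⟨
      P.1# P.+ root z P.* root (T S.^ (n ℕ.+ 1))
        ≈⟨ P.+-congˡ {P.1#} {root z P.* root (T S.^ (n ℕ.+ 1))} {root z P.* (root T P.^ n P.* root T)}
             (P.*-congˡ {root z} {root (T S.^ (n ℕ.+ 1))} {root T P.^ n P.* root T} power) ⟩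
      P.1# P.+ root z P.* (root T P.^ n P.* root T)
        ≈⟨ P.+-congˡ {P.1#} {(root z P.* root T P.^ n) P.* root T} {root z P.* (root T P.^ n P.* root T)}
             (P.*-assoc (root z) (root T P.^ n) (root T)) ⟨
      P.1# P.+ (root z P.* root T P.^ n) P.* root T ∎
      where
      open P using (begin_; _∎; step-≈-⟩; step-≈-⟨)
      power : root (T S.^ (n ℕ.+ 1)) P.≈ (root T P.^ n P.* root T)
      power = begin
        root (T S.^ (n ℕ.+ 1))          ≈⟨ root-^ T (n ℕ.+ 1) ⟨
        root T P.^ (n ℕ.+ 1)            ≈⟨ P.^-homo-* (root T) n 1 ⟩
        root T P.^ n P.* root T P.^ 1   ≈⟨ P.*-congˡ {root T P.^ n} {root T P.^ 1} {root T} (P.*-identityʳ (root T)) ⟩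
        root T P.^ n P.* root T         ∎

    -- At the common ramification the bodies multiply as power series, and dilating `F` keeps its
    -- constant term 1. Hence the dilated `g` vanishes, and the coefficients of `g` are found in it
    -- at the multiples of m.
    root-regular : ∀ {F} → F 0 R.≈ R.1# → P.Regular (root F)
    root-regular {F} F₀≈1 (puiseux n (t^- q · g)) Fv≈0 =
      U.zero-level (positive n) {t^- q · g} (LT.zero-level q g≈0)
      where
      product≈0 : (LT.dilate n F S.* LT.dilate m g) S.≈ S.0#
      product≈0 = LT.~0⇒≈0 {n ℕ.* 0 ℕ.+ m ℕ.* q} 
        (U.~0⇒≈0 {positive m ⊠ positive n} {substPower n (t^- 0 · F) L.* substPower m (t^- q · g)} Fv≈0)
      g≈0 : g S.≈ S.0#
      g≈0 k = R.trans (R.reflexive (≡.sym (LT.dilate-multiple m g k)))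
        (monic⇒regular R isCR {LT.dilate n F} (R.trans (R.reflexive (LT.dilate-multiple n F 0)) F₀≈1)
          (LT.dilate m g) product≈0 (k ℕ.* m))

  -- The coefficients with index below p vanish, which cancels the pole; the one at p itself becomes
  -- the constant term and vanishes too.
  positiveOrder⇒root : ∀ m .{{_ : NonZero m}} x → Puiseux.HasPositiveOrder R (puiseux m x) →
    Σ[ f ∈ S.Carrier ] f 0 R.≈ R.0# × puiseux m x P.≈ root m f
  positiveOrder⇒root m (t^- p · f) f≈0 =
    (λ n → f (p ℕ.+ n)) , f≈0 (p ℕ.+ 0) (ℕ.≤-reflexive (ℕ.+-identityʳ p)) ,
    substPower-cong m {t^- p · f} {t^- 0 · (λ n → f (p ℕ.+ n))} shifted
    where
    shifted : f S.≈ Laurent.t^_·_ R p (λ n → f (p ℕ.+ n))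
    shifted n with ℕ.<-≤-connex n p
    ... | inj₁ n<p = R.trans (f≈0 n (ℕ.<⇒≤ n<p)) (R.reflexive (≡.sym (LT.shift-coefficient-< _ n<p)))
    ... | inj₂ p≤n with ℕ.m≤n⇒∃[o]m+o≡n p≤n
    ...   | o , ≡.refl = R.reflexive (≡.sym (LT.shift-coefficient p _ o))

  -- A positive-order x is a power series f in some z^(1/m) without constant term, so 1 - f^(k+1)
  -- has constant term 1.
  1-x^k-regular : ∀ x → Puiseux.HasPositiveOrder R x → ∀ k → P.Regular (P.1# P.- x P.^ suc k)
  1-x^k-regular x@(puiseux m y) x>0 k with positiveOrder⇒root m y x>0
  ... | f , f₀≈0 , x≈f = P.regular-cong {root m F} {P.1# P.- x P.^ suc k}
    (P.sym {P.1# P.- x P.^ suc k} {root m F} (begin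
      P.1# P.- x P.^ suc k                     ≈⟨ P.+-cong {P.1#} {root m S.1#} {P.- (x P.^ suc k)} {P.- root m (f S.^ suc k)} (root-1 m) (P.-‿cong {x P.^ suc k} {root m (f S.^ suc k)} (begin
        x P.^ suc k             ≈⟨ P.^-congˡ (suc k) {x} {root m f} x≈f ⟩
        root m f P.^ suc k      ≈⟨ root-^ m f (suc k) ⟩
        root m (f S.^ suc k)    ∎)) ⟩
      root m S.1# P.+ root m (S.- (f S.^ suc k)) ≈⟨ root-+ m S.1# (S.- (f S.^ suc k)) ⟩
      root m F                                 ∎))
    (root-regular m {F} F₀≈1)
    where
    open P using (begin_; _∎; step-≈-⟩; step-≈-⟨)
    F : S.Carrier
    F = S.1# S.- f S.^ suc k
    F₀≈1 : F 0 R.≈ R.1#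
    F₀≈1 = R.trans
      (R.+-congˡ (R.trans (R.-‿cong (R.trans (R.+-identityʳ _) (R.trans (R.*-congʳ f₀≈0) (R.zeroˡ _)))) R.-0#≈0#))
      (R.+-identityʳ _)

-- Real and complex numbers

ℝ-ring : RawRing 0ℓ 0ℓ
ℝ-ring = record
  { Carrier = ℝ
  ; _≈_     = _≈ℝ_
  ; _+_     = _+ℝ_
  ; _*_     = _*ℝ_
  ; -_      = -ℝ_
  ; 0#      = fromℚ 0ℚ
  ; 1#      = fromℚ 1ℚ
  }

ℝ-isCommutativeRing : IsCommutativeRawRing ℝ-ring
ℝ-isCommutativeRing = record
  { isRing = record
    { +-isAbelianGroup = record
      { isGroup = record
        { isMonoid = record
          { isSemigroup = record
            { isMagma = record
              { isEquivalence = record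
                { refl  = λ {x} → pointwise x x λ _ → ≡.refl
                ; sym   = λ {x} {y} → ≈-sym x y
                ; trans = λ {x} {y} {z} → ≈-trans x y z
                }
              ; ∙-cong = λ {x} {y} {u} {v} → +-cong x y u v
              }
            ; assoc = λ x y z → pointwise ((x +ℝ y) +ℝ z) (x +ℝ (y +ℝ z)) λ n → ℚ.+-assoc (approx x n) (approx y n) (approx z n)
            }
          ; identity = (λ x → pointwise (0ℝ +ℝ x) x λ n → ℚ.+-identityˡ (approx x n))
                     , (λ x → pointwise (x +ℝ 0ℝ) x λ n → ℚ.+-identityʳ (approx x n))
          }
        ; inverse = (λ x → pointwise (-ℝ x +ℝ x) 0ℝ λ n → ℚ.+-inverseˡ (approx x n))
                  , (λ x → pointwise (x +ℝ -ℝ x) 0ℝ λ n → ℚ.+-inverseʳ (approx x n))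
        ; ⁻¹-cong = λ {x} {y} → neg-cong x y
        }
      ; comm = λ x y → pointwise (x +ℝ y) (y +ℝ x) λ n → ℚ.+-comm (approx x n) (approx y n)
      }
    ; *-cong = λ {x} {y} {u} {v} x≈y u≈v → ≈-trans (x *ℝ u) (y *ℝ u) (y *ℝ v)
        (*-congʳ x y u x≈y)
        (≈-trans (y *ℝ u) (u *ℝ y) (y *ℝ v) (*-comm y u)
          (≈-trans (u *ℝ y) (v *ℝ y) (y *ℝ v) (*-congʳ u v y u≈v) (*-comm v y)))
    ; *-assoc = λ x y z → pointwise ((x *ℝ y) *ℝ z) (x *ℝ (y *ℝ z)) λ n → ℚ.*-assoc (approx x n) (approx y n) (approx z n)
    ; *-identity = (λ x → pointwise (1ℝ *ℝ x) x λ n → ℚ.*-identityˡ (approx x n))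
                 , (λ x → pointwise (x *ℝ 1ℝ) x λ n → ℚ.*-identityʳ (approx x n))
    ; distrib = (λ x y z → pointwise (x *ℝ (y +ℝ z)) (x *ℝ y +ℝ x *ℝ z) λ n → ℚ.*-distribˡ-+ (approx x n) (approx y n) (approx z n))
              , (λ x y z → pointwise ((y +ℝ z) *ℝ x) (y *ℝ x +ℝ z *ℝ x) λ n → ℚ.*-distribʳ-+ (approx x n) (approx y n) (approx z n))
    }
  ; *-comm = *-comm
  }
  where
  open ℚ.≤-Reasoning
  0ℝ 1ℝ : ℝ
  0ℝ = fromℚ 0ℚ
  1ℝ = fromℚ 1ℚ

  pointwise : ∀ x y → (∀ n → approx x n ≡ approx y n) → x ≈ℝ y
  pointwise x y x≡y ε 0<ε = 0 , λ n _ → ≡.subst (λ q → ℚ.∣ q ∣ ℚ.< ε)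
    (≡.sym (≡.trans (≡.cong (λ p → p ℚ.- approx y n) (x≡y n)) (ℚ.+-inverseʳ (approx y n)))) 0<ε

  *-comm : ∀ x y → (x *ℝ y) ≈ℝ (y *ℝ x)
  *-comm x y = pointwise (x *ℝ y) (y *ℝ x) λ n → ℚ.*-comm (approx x n) (approx y n)

  ∣p-q∣≡∣q-p∣ : ∀ p q → ℚ.∣ p ℚ.- q ∣ ≡ ℚ.∣ q ℚ.- p ∣
  ∣p-q∣≡∣q-p∣ p q = ≡.trans (≡.sym (ℚ.∣-p∣≡∣p∣ (p ℚ.- q)))
    (≡.cong ℚ.∣_∣ (AbelianGroupProperties.⁻¹-anti-homo-// ℚ.+-0-abelianGroup p q))

  ≈-sym : ∀ x y → x ≈ℝ y → y ≈ℝ x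
  ≈-sym x y p ε 0<ε with p ε 0<ε
  ... | N , q = N , λ n N≤n → ≡.subst (ℚ._< ε) (∣p-q∣≡∣q-p∣ (approx x n) (approx y n)) (q n N≤n)

  -- The half-epsilon argument common to `≈-trans` and `+-cong`, which differ only in how the
  -- difference is split.
  null-+ : ∀ (a b c : ℕ → ℚ) → (∀ n → c n ≡ a n ℚ.+ b n) →
    (∀ ε → 0ℚ ℚ.< ε → Σ[ N ∈ ℕ ] (∀ n → N ℕ.≤ n → ℚ.∣ a n ∣ ℚ.< ε)) →
    (∀ ε → 0ℚ ℚ.< ε → Σ[ N ∈ ℕ ] (∀ n → N ℕ.≤ n → ℚ.∣ b n ∣ ℚ.< ε)) →
    (∀ ε → 0ℚ ℚ.< ε → Σ[ N ∈ ℕ ] (∀ n → N ℕ.≤ n → ℚ.∣ c n ∣ ℚ.< ε))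
  null-+ a b c c≡a+b a→0 b→0 ε 0<ε with a→0 _ (half ε 0<ε) | b→0 _ (half ε 0<ε)
  ... | M , p | N , q = M ℕ.⊔ N , λ n M⊔N≤n → begin-strict
    ℚ.∣ c n ∣                ≡⟨ ≡.cong ℚ.∣_∣ (c≡a+b n) ⟩
    ℚ.∣ a n ℚ.+ b n ∣        ≤⟨ ℚ.∣p+q∣≤∣p∣+∣q∣ (a n) (b n) ⟩
    ℚ.∣ a n ∣ ℚ.+ ℚ.∣ b n ∣    <⟨ ℚ.+-mono-< (p n (ℕ.m⊔n≤o⇒m≤o M N M⊔N≤n)) (q n (ℕ.m⊔n≤o⇒n≤o M N M⊔N≤n)) ⟩
    ½ ℚ.* ε ℚ.+ ½ ℚ.* ε    ≡⟨ halves ε ⟩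
    ε                      ∎

  ≈-trans : ∀ x y z → x ≈ℝ y → y ≈ℝ z → x ≈ℝ z
  ≈-trans x y z = null-+ _ _ _ λ n →
    ≡.trans (≡.cong (λ p → p ℚ.- approx z n) (minus-plus (approx x n) (approx y n)))
            (ℚ.+-assoc (approx x n ℚ.- approx y n) (approx y n) (ℚ.- approx z n))

  +-cong : ∀ x y u v → x ≈ℝ y → u ≈ℝ v → (x +ℝ u) ≈ℝ (y +ℝ v)
  +-cong x y u v = null-+ _ _ _ λ n → +-difference (approx x n) (approx u n) (approx y n) (approx v n)

  neg-cong : ∀ x y → x ≈ℝ y → (-ℝ x) ≈ℝ (-ℝ y)
  neg-cong x y p ε 0<ε with p ε 0<ε
  ... | N , q = N , λ n N≤n → ≡.subst (ℚ._< ε)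
    (≡.trans (≡.sym (ℚ.∣-p∣≡∣p∣ (approx x n ℚ.- approx y n)))
             (≡.cong ℚ.∣_∣ (ℚ.neg-distrib-+ (approx x n) (ℚ.- approx y n))))
    (q n N≤n)

  -- From some index on `u` is bounded by a positive B, so it is enough that x - y falls below δ
  -- with B δ = ε.
  *-congʳ : ∀ x y u → x ≈ℝ y → (x *ℝ u) ≈ℝ (y *ℝ u)
  *-congʳ x y u x≈y ε 0<ε with bounded {approx u} (cauchy u)
  ... | M , B , B>0 , ∣u∣≤B with shrink B B>0 ε 0<ε
  ...   | δ , 0<δ , Bδ≡ε with x≈y δ 0<δ
  ...     | N , p = M ℕ.⊔ N , λ n M⊔N≤n →
    let a = approx x n ; b = approx y n ; c = approx u n in begin-strict
    ℚ.∣ a ℚ.* c ℚ.- b ℚ.* c ∣    ≡⟨ ≡.cong (λ q → ℚ.∣ a ℚ.* c ℚ.+ q ∣) (ℚ.neg-distribˡ-* b c) ⟩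
    ℚ.∣ a ℚ.* c ℚ.+ ℚ.- b ℚ.* c ∣ ≡⟨ ≡.cong ℚ.∣_∣ (ℚ.*-distribʳ-+ c a (ℚ.- b)) ⟨
    ℚ.∣ (a ℚ.- b) ℚ.* c ∣        ≡⟨ ℚ.∣p*q∣≡∣p∣*∣q∣ (a ℚ.- b) c ⟩
    ℚ.∣ a ℚ.- b ∣ ℚ.* ℚ.∣ c ∣      ≤⟨ ℚ.*-monoˡ-≤-nonNeg ℚ.∣ a ℚ.- b ∣ {{ℚ.nonNegative (ℚ.0≤∣p∣ (a ℚ.- b))}}
                                   (∣u∣≤B n (ℕ.m⊔n≤o⇒m≤o M N M⊔N≤n)) ⟩
    ℚ.∣ a ℚ.- b ∣ ℚ.* B          ≡⟨ ℚ.*-comm ℚ.∣ a ℚ.- b ∣ B ⟩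
    B ℚ.* ℚ.∣ a ℚ.- b ∣          <⟨ ℚ.*-monoʳ-<-pos B {{B>0}} (p n (ℕ.m⊔n≤o⇒n≤o M N M⊔N≤n)) ⟩
    B ℚ.* δ                    ≡⟨ Bδ≡ε ⟩
    ε                          ∎

-- Adjoining a square root of -1 uses only ring laws, so it is done over any commutative ring, where
-- the solver applies. At `ℝ-ring` the result is `ℂ` by definition.
module GaussianTheory (R : RawRing 0ℓ 0ℓ) (isCR : IsCommutativeRawRing R) where
  open RingTheory R isCR hiding (isCommutativeRing; ring)
  open Solver using (solve; _:=_; _:+_; _:*_; _:-_; :-_; one; zer)

  ring : RawRing 0ℓ 0ℓ
  ring = record
    { Carrier = Carrier × Carrier
    ; _≈_     = λ (a , b) (c , e) → (a ≈ c) × (b ≈ e)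
    ; _+_     = λ (a , b) (c , e) → a + c , b + e
    ; _*_     = λ (a , b) (c , e) → a * c + - (b * e) , a * e + b * c
    ; -_      = λ (a , b) → - a , - b
    ; 0#      = 0# , 0#
    ; 1#      = 1# , 0#
    }

  isCommutativeRing : IsCommutativeRawRing ring
  isCommutativeRing = record
    { isRing = record
      { +-isAbelianGroup = record
        { isGroup = record
          { isMonoid = record
            { isSemigroup = record
              { isMagma = record
                { isEquivalence = record
                  { refl  = refl , refl
                  ; sym   = λ (p , q) → sym p , sym q
                  ; trans = λ (p , q) (r , s) → trans p r , trans q s
                  }
                ; ∙-cong = λ (p , q) (r , s) → +-cong p r , +-cong q s
                }
              ; assoc = λ _ _ _ → +-assoc _ _ _ , +-assoc _ _ _
              }
            ; identity = (λ _ → +-identityˡ _ , +-identityˡ _) , (λ _ → +-identityʳ _ , +-identityʳ _)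
            }
          ; inverse = (λ _ → -‿inverseˡ _ , -‿inverseˡ _) , (λ _ → -‿inverseʳ _ , -‿inverseʳ _)
          ; ⁻¹-cong = λ (p , q) → -‿cong p , -‿cong q
          }
        ; comm = λ _ _ → +-comm _ _ , +-comm _ _
        }
      ; *-cong = λ (p , q) (r , s) →
          +-cong (*-cong p r) (-‿cong (*-cong q s)) , +-cong (*-cong p s) (*-cong q r)
      ; *-assoc = λ (a , b) (c , e) (g , h) →
            solve 6 (λ a b c e g h → (a :* c :+ :- (b :* e)) :* g :+ :- ((a :* e :+ b :* c) :* h)
              := a :* (c :* g :+ :- (e :* h)) :+ :- (b :* (c :* h :+ e :* g))) refl a b c e g h
          , solve 6 (λ a b c e g h → (a :* c :+ :- (b :* e)) :* h :+ (a :* e :+ b :* c) :* g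
              := a :* (c :* h :+ e :* g) :+ b :* (c :* g :+ :- (e :* h))) refl a b c e g h
      ; *-identity =
            (λ (a , b) → solve 2 (λ a b → one :* a :+ :- (zer :* b) := a) refl a b
                       , solve 2 (λ a b → one :* b :+ zer :* a := b) refl a b)
          , (λ (a , b) → solve 2 (λ a b → a :* one :+ :- (b :* zer) := a) refl a b
                       , solve 2 (λ a b → a :* zer :+ b :* one := b) refl a b)
      ; distrib =
            (λ (a , b) (c , e) (g , h) →
                solve 6 (λ a b c e g h → a :* (c :+ g) :+ :- (b :* (e :+ h))
                  := (a :* c :+ :- (b :* e)) :+ (a :* g :+ :- (b :* h))) refl a b c e g h
              , solve 6 (λ a b c e g h → a :* (e :+ h) :+ b :* (c :+ g)
                  := (a :* e :+ b :* c) :+ (a :* h :+ b :* g)) refl a b c e g h)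
          , (λ (a , b) (c , e) (g , h) →
                solve 6 (λ a b c e g h → (c :+ g) :* a :+ :- ((e :+ h) :* b)
                  := (c :* a :+ :- (e :* b)) :+ (g :* a :+ :- (h :* b))) refl a b c e g h
              , solve 6 (λ a b c e g h → (c :+ g) :* b :+ (e :+ h) :* a
                  := (c :* b :+ e :* a) :+ (g :* b :+ h :* a)) refl a b c e g h)
      }
    ; *-comm = λ (a , b) (c , e) →
          solve 4 (λ a b c e → a :* c :+ :- (b :* e) := c :* a :+ :- (e :* b)) refl a b c e
        , solve 4 (λ a b c e → a :* e :+ b :* c := c :* b :+ e :* a) refl a b c e
    }

abstract
  ℂ-isCommutativeRing : IsCommutativeRawRing ℂ
  ℂ-isCommutativeRing = GaussianTheory.isCommutativeRing ℝ-ring ℝ-isCommutativeRing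

  K-isCommutativeRing : IsCommutativeRawRing Defs.K
  K-isCommutativeRing = PuiseuxTheory.isCommutativeRing ℂ ℂ-isCommutativeRing

-- Homomorphisms between rings of power series

module SeriesNotation (R : RawRing 0ℓ 0ℓ) (isCR : IsCommutativeRawRing R)
                      {I : Set} (_≟_ : DecidableEquality I) (o : I) (split : I → List (I × I))
                      (isSplitting : IsSplitting R isCR o split) where
  open Series R _≟_ o split public using (monomial; constant; ∑∞)
  open SeriesTheory R isCR _≟_ o split isSplitting public
  open IsSplitting isSplitting public
  private
    module R = RingTheory R isCR
  module S = RingTheory (Series.ring R _≟_ o split) isCommutativeRing

  constant-homo-^ : ∀ c n → constant (c R.^ n) S.≈ constant c S.^ n
  constant-homo-^ c zero    = S.refl
  constant-homo-^ c (suc n) = S.trans (constant-homo-* c (c R.^ n)) (S.*-congˡ {constant c} (constant-homo-^ c n))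

  constant-homo-∑ : ∀ {A : Set} (xs : List A) f → constant (R.∑ xs f) S.≈ S.∑ xs (λ x → constant (f x))
  constant-homo-∑ []       f = constant-homo-0
  constant-homo-∑ (x ∷ xs) f = S.trans (constant-homo-+ (f x) _) (S.+-congˡ {constant (f x)} (constant-homo-∑ xs f))

  constant-homo-∏ : ∀ {A : Set} (xs : List A) f → constant (R.∏ xs f) S.≈ S.∏ xs (λ x → constant (f x))
  constant-homo-∏ []       f = S.refl
  constant-homo-∏ (x ∷ xs) f = S.trans (constant-homo-* (f x) _) (S.*-congˡ {constant (f x)} (constant-homo-∏ xs f))

  constant-homo-minus : ∀ c e → constant (c R.- e) S.≈ (constant c S.- constant e)
  constant-homo-minus c e = S.trans (constant-homo-+ c (R.- e)) (S.+-congˡ {constant c} (constant-homo-neg e))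

  coefficient-∑ : ∀ {A : Set} (xs : List A) (f : A → S.Carrier) n → S.∑ xs f n ≡ R.∑ xs (λ x → f x n)
  coefficient-∑ []       f n = ≡.refl
  coefficient-∑ (x ∷ xs) f n = ≡.cong (λ s → f x n R.+ s) (coefficient-∑ xs f n)

  coefficient-sign : ∀ ℓ f n → (((S.- S.1#) S.^ ℓ) S.* f) n R.≈ ((R.- R.1#) R.^ ℓ) R.* f n
  coefficient-sign ℓ f n = R.trans
    (S.*-congʳ {f} {(S.- S.1#) S.^ ℓ} {constant ((R.- R.1#) R.^ ℓ)}
      (S.sym (S.trans (constant-homo-^ (R.- R.1#) ℓ) (S.^-congˡ ℓ (constant-homo-neg R.1#)))) n)
    (constant-* ((R.- R.1#) R.^ ℓ) f n)

  constantUnit : Unit R → Unit (Series.ring R _≟_ o split)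
  constantUnit u = record
    { value     = constant (value u)
    ; inverse   = constant (inverse u)
    ; isInverse = S.trans (S.sym (constant-homo-* (value u) (inverse u))) (constant-cong (isInverse u))
    }

  constantUnit-^ᶻ : ∀ u i → constant (u ^ᶻ i) S.≈ constantUnit u ^ᶻ i
  constantUnit-^ᶻ u (+ n)    = constant-homo-^ (value u) n
  constantUnit-^ᶻ u -[1+ n ] = constant-homo-^ (inverse u) (suc n)

-- A homomorphism of power series rings: restrict exponents along `ι` and rescale by a
-- multiplicative function `χ`. It is used for restriction to an axis, with `ι` sending k to k e_ℓ
-- and `χ` to s^k, and for the twist by X^(jn), with `ι` the identity. Multiplicativity rests on
-- `ι-split`: every splitting of ι n must come from one of n.
module Pullback
  (R : RawRing 0ℓ 0ℓ) (isCR : IsCommutativeRawRing R)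
  {I J : Set} (_≟ᴵ_ : DecidableEquality I) (_≟ᴶ_ : DecidableEquality J)
  (oᴵ : I) (oᴶ : J) (splitᴵ : I → List (I × I)) (splitᴶ : J → List (J × J))
  (isSplittingᴵ : IsSplitting R isCR oᴵ splitᴵ) (isSplittingᴶ : IsSplitting R isCR oᴶ splitᴶ)
  (ι : I → J) (χ : I → RawRing.Carrier R) where
  private
    module R = RingTheory R isCR
    module SI = SeriesNotation R isCR _≟ᴵ_ oᴵ splitᴵ isSplittingᴵ
    module SJ = SeriesNotation R isCR _≟ᴶ_ oᴶ splitᴶ isSplittingᴶ
    module I = SI.S
    module J = SJ.S
  open R hiding (_+_; _*_; -_; 0#; 1#; _-_; ∑; ∏; begin_; _∎; step-≈-⟩)

  pull : J.Carrier → I.Carrier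
  pull f i = χ i R.* f (ι i)

  module _ (ι-split : ∀ n (F : J → J → R.Carrier) →
              R.∑ (splitᴶ (ι n)) (λ (i , j) → F i j) ≈ R.∑ (splitᴵ n) (λ (i , j) → F (ι i) (ι j)))
           (χ-split : ∀ n {i j} → (i , j) ∈ splitᴵ n → χ n ≈ χ i R.* χ j)
           (pull-constant : ∀ c → pull (SJ.constant c) I.≈ SI.constant c) where

    pull-minus : ∀ f g → pull (f J.- g) I.≈ (pull f I.- pull g)
    pull-minus f g i = trans (distribˡ _ _ _) (+-congˡ (sym (-‿distribʳ-* _ _)))

    pull-* : ∀ f g → pull (f J.* g) I.≈ (pull f I.* pull g)
    pull-* f g n = let open R using (begin_; _∎; step-≈-⟩) in begin
      χ n R.* R.∑ (splitᴶ (ι n)) (λ (i , j) → f i R.* g j)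
        ≈⟨ *-congˡ (ι-split n (λ i j → f i R.* g j)) ⟩
      χ n R.* R.∑ (splitᴵ n) (λ (i , j) → f (ι i) R.* g (ι j))
        ≈⟨ *-∑ (splitᴵ n) _ _ ⟩
      R.∑ (splitᴵ n) (λ (i , j) → χ n R.* (f (ι i) R.* g (ι j)))
        ≈⟨ ∑-cong-∈ (splitᴵ n) (λ {(i , j)} ij∈ → trans (*-congʳ (χ-split n ij∈))
             (R.Solver.solve 4 (λ a b c e → (a R.Solver.:* b) R.Solver.:* (c R.Solver.:* e) R.Solver.:= (a R.Solver.:* c) R.Solver.:* (b R.Solver.:* e)) refl (χ i) (χ j) (f (ι i)) (g (ι j)))) ⟩
      R.∑ (splitᴵ n) (λ (i , j) → (χ i R.* f (ι i)) R.* (χ j R.* g (ι j))) ∎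

    pull-∏ : ∀ {A : Set} (xs : List A) (f : A → J.Carrier) → pull (J.∏ xs f) I.≈ I.∏ xs (λ x → pull (f x))
    pull-∏ []       f = pull-constant R.1#
    pull-∏ (x ∷ xs) f = I.trans (pull-* (f x) (J.∏ xs f)) (I.*-congˡ {pull (f x)} (pull-∏ xs f))

    pull-equation : ∀ {A : Set} c (xs : List A) (f : A → J.Carrier) →
      pull (SJ.constant c J.* (J.1# J.- J.∏ xs (λ x → J.1# J.- f x)))
      I.≈ (SI.constant c I.* (I.1# I.- I.∏ xs (λ x → I.1# I.- pull (f x))))
    pull-equation {A} c xs f = begin
      pull (SJ.constant c J.* (J.1# J.- J.∏ xs g))
        ≈⟨ pull-* (SJ.constant c) (J.1# J.- J.∏ xs g) ⟩
      pull (SJ.constant c) I.* pull (J.1# J.- J.∏ xs g)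
        ≈⟨ I.*-cong {pull (SJ.constant c)} {SI.constant c} {pull (J.1# J.- J.∏ xs g)} {I.1# I.- I.∏ xs h}
             (pull-constant c) minus ⟩
      SI.constant c I.* (I.1# I.- I.∏ xs h) ∎
      where
      open I using (begin_; _∎; step-≈-⟩)
      g : A → J.Carrier
      g x = J.1# J.- f x
      h : A → I.Carrier
      h x = I.1# I.- pull (f x)
      g≈h : ∀ x → pull (g x) I.≈ h x
      g≈h x i = trans (pull-minus J.1# (f x) i) (+-congʳ (pull-constant R.1# i))
      minus : pull (J.1# J.- J.∏ xs g) I.≈ (I.1# I.- I.∏ xs h)
      minus i = trans (pull-minus J.1# (J.∏ xs g) i) (+-cong (pull-constant R.1# i)
        (-‿cong (I.trans {pull (J.∏ xs g)} {I.∏ xs (λ x → pull (g x))} {I.∏ xs h}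
          (pull-∏ xs g) (I.∏-cong xs {λ x → pull (g x)} {h} g≈h) i)))

-- Exponent vectors on and off the axes

0·e≡𝟘 : ∀ {d} (ℓ : Fin d) → 0 ·e ℓ ≡ 𝟘
0·e≡𝟘 zero    = ≡.refl
0·e≡𝟘 (suc ℓ) = ≡.cong (0 ∷_) (0·e≡𝟘 ℓ)

lookup-·e : ∀ {d} (ℓ : Fin d) k → lookup (k ·e ℓ) ℓ ≡ k
lookup-·e ℓ k = Vec.lookup∘updateAt ℓ 𝟘

lookup-·e′ : ∀ {d} (ℓ : Fin d) k {i} → i ≢ ℓ → lookup (k ·e ℓ) i ≡ 0
lookup-·e′ ℓ k {i} i≢ℓ = ≡.trans (Vec.lookup∘updateAt′ i ℓ i≢ℓ 𝟘) (Vec.lookup-replicate i 0)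

-- These are the three cases in which the coefficients α_n are defined.
data Shape {d : ℕ} (n : Vec ℕ d) : Set where
  zero  : n ≡ 𝟘 → Shape n
  axis  : ∀ ℓ k → n ≡ suc k ·e ℓ → Shape n
  mixed : HasTwoNonzeroCoordinates n → Shape n

shape : ∀ {d} (n : Vec ℕ d) → Shape n
shape []       = zero ≡.refl
shape (n ∷ ns) with n | shape ns
... | zero  | zero ≡.refl     = zero ≡.refl
... | suc k | zero ≡.refl     = axis zero k ≡.refl
... | zero  | axis ℓ k ≡.refl = axis (suc ℓ) k ≡.refl
... | suc m | axis ℓ k ≡.refl =
  mixed (zero , suc ℓ , (λ ()) , (λ ()) , λ p → ℕ.1+n≢0 (≡.trans (≡.sym (lookup-·e ℓ (suc k))) p))
... | _     | mixed (i , j , i≢j , p , q) =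
  mixed (suc i , suc j , (i≢j ∘ Fin.suc-injective) , p , q)

module _ (R : RawRing 0ℓ 0ℓ) (isCR : IsCommutativeRawRing R) where
  open RingTheory R isCR

  ∑-splitVec-𝟘 : ∀ d (F : Vec ℕ d → Vec ℕ d → Carrier) →
    ∑ (splitVec (𝟘 {d})) (λ (i , j) → F i j) ≈ F 𝟘 𝟘
  ∑-splitVec-𝟘 zero    F = +-identityʳ _
  ∑-splitVec-𝟘 (suc d) F = trans (∑Vec-∷ R isCR 0 𝟘 F)
    (trans (+-identityʳ _) (∑-splitVec-𝟘 d (λ i j → F (0 ∷ i) (0 ∷ j))))

  -- A zero coordinate splits only as 0 + 0, so splittings of a vector on an axis stay on that axis.
  -- This makes restriction to the axis multiplicative.
  ∑-splitVec-·e : ∀ {d} (ℓ : Fin d) k (F : Vec ℕ d → Vec ℕ d → Carrier) →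
    ∑ (splitVec (k ·e ℓ)) (λ (i , j) → F i j) ≈ ∑ (splitℕ k) (λ (i , j) → F (i ·e ℓ) (j ·e ℓ))
  ∑-splitVec-·e {suc d} zero    k F = trans (∑Vec-∷ R isCR k 𝟘 F)
    (∑-cong (splitℕ k) (λ (i , j) → ∑-splitVec-𝟘 d (λ is js → F (i ∷ is) (j ∷ js))))
  ∑-splitVec-·e {suc d} (suc ℓ) k F = trans (∑Vec-∷ R isCR 0 (k ·e ℓ) F)
    (trans (+-identityʳ _) (∑-splitVec-·e ℓ k (λ i j → F (0 ∷ i) (0 ∷ j))))

-- The coefficient families

module FamilyTheory (R : RawRing 0ℓ 0ℓ) (isCR : IsCommutativeRawRing R) (d : ℕ) where
  private
    module R = RingTheory R isCR
    module M = SeriesNotation R isCR (Vec.≡-dec ℕ._≟_) (replicate d 0) splitVec (splitVec-isSplitting R isCR d)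
    module U = SeriesNotation R isCR ℕ._≟_ 0 splitℕ (splitℕ-isSplitting R isCR)
    module S = M.S
    module T = U.S
  open R using (refl; sym; trans; reflexive; +-cong; +-congˡ; +-congʳ; *-cong; *-congˡ; *-congʳ; -‿cong)
  open Coefficients R d using (_^[_·_]; ρ; IsCoefficientFamily)

  -- Vanishing constant terms remove the splittings with a zero part, which `compositions` leaves
  -- out.
  ∏-coefficient : ∀ ℓ (f : Fin ℓ → S.Carrier) → (∀ k → f k 𝟘 R.≈ R.0#) → ∀ n →
    S.∏ (allFin ℓ) f n R.≈ R.∑ (compositions ℓ n) (λ g → R.∏ (allFin ℓ) λ k → f k (lookup g k))
  ∏-coefficient zero f f𝟘≈0 n with n ≟ᵛ 𝟘
  ... | yes _ = sym (R.+-identityʳ _)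
  ... | no  _ = refl
  ∏-coefficient (suc ℓ) f f𝟘≈0 n = begin
    S.∏ (allFin (suc ℓ)) f n
      ≡⟨ ≡.cong (λ p → p n) (S.∏-allFin-suc ℓ f) ⟩
    R.∑ (splitVec n) (λ (g , h) → f zero g R.* S.∏ (allFin ℓ) (f ∘ suc) h)
      ≈⟨ R.∑-cong (splitVec n) (λ (g , h) → trans (*-congˡ (∏-coefficient ℓ (f ∘ suc) (f𝟘≈0 ∘ suc) h)) (term g h)) ⟩
    R.∑ (splitVec n) (λ gh → R.∑ (cons gh) F)
      ≈⟨ R.∑-concatMap cons (splitVec n) F ⟨
    R.∑ (compositions (suc ℓ) n) F ∎
    where
    open R using (begin_; _∎; step-≈-⟩; step-≈-⟨; step-≡-⟩)
    F : Vec (Vec ℕ d) (suc ℓ) → R.Carrier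
    F g = R.∏ (allFin (suc ℓ)) λ k → f k (lookup g k)
    cons : Vec ℕ d × Vec ℕ d → List (Vec (Vec ℕ d) (suc ℓ))
    cons (g , h) = if does (g ≟ᵛ 𝟘) then [] else map (g ∷_) (compositions ℓ h)
    term : ∀ g h → f zero g R.* R.∑ (compositions ℓ h) (λ g → R.∏ (allFin ℓ) λ k → f (suc k) (lookup g k))
                   R.≈ R.∑ (cons (g , h)) F
    term g h with g ≟ᵛ 𝟘
    ... | yes ≡.refl = trans (*-congʳ (f𝟘≈0 zero)) (R.zeroˡ _)
    ... | no  _      = trans (R.*-∑ (compositions ℓ h) _ _) (trans
      (R.∑-cong (compositions ℓ h) (λ g′ → reflexive (≡.sym (R.∏-allFin-suc ℓ (λ k → f k (lookup (g ∷ g′) k))))))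
      (reflexive (≡.sym (R.∑-map (g ∷_) (compositions ℓ h) F))))

  module _ (α : Vec ℕ d → S.Carrier) (α-off-diagonal : ∀ {n m} → m ≢ n → α n m R.≈ R.0#) where

    -- Each factor is supported at its own exponent, so among all splittings of n only the one given
    -- by the parts of `g` contributes.
    ∏α-coefficient : ∀ ℓ n {g} → g ∈ compositions ℓ n →
      S.∏ (allFin ℓ) (λ k → α (lookup g k)) n R.≈ R.∏ (allFin ℓ) (λ k → α (lookup g k) (lookup g k))
    ∏α-coefficient zero n g∈ with n ≟ᵛ 𝟘
    ∏α-coefficient zero n g∈ | yes _ = refl
    ∏α-coefficient zero n () | no  _
    ∏α-coefficient (suc ℓ) n g∈ with find (∈-concatMap⁻ _ {splitVec n} g∈)
    ... | (g , h) , gh∈ , g∈′ with g ≟ᵛ 𝟘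
    ∏α-coefficient (suc ℓ) n g∈ | (g , h) , gh∈ , () | yes _
    ∏α-coefficient (suc ℓ) n g∈ | (g , h) , gh∈ , g∈′ | no _ with ∈-map⁻ (g ∷_) g∈′
    ... | g′ , g′∈ , ≡.refl = begin
      S.∏ (allFin (suc ℓ)) (λ k → α (lookup (g ∷ g′) k)) n
        ≡⟨ ≡.cong (λ p → p n) (S.∏-allFin-suc ℓ (λ k → α (lookup (g ∷ g′) k))) ⟩
      (α g S.* P) n
        ≈⟨ M.∑-single {n} gh∈ (λ i j → α g i R.* P j) (λ i j i≢g → trans (*-congʳ (α-off-diagonal i≢g)) (R.zeroˡ _)) ⟩
      α g g R.* P h
        ≈⟨ *-congˡ (∏α-coefficient ℓ h g′∈) ⟩
      α g g R.* R.∏ (allFin ℓ) (λ k → α (lookup g′ k) (lookup g′ k))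
        ≡⟨ R.∏-allFin-suc ℓ (λ k → α (lookup (g ∷ g′) k) (lookup (g ∷ g′) k)) ⟨
      R.∏ (allFin (suc ℓ)) (λ k → α (lookup (g ∷ g′) k) (lookup (g ∷ g′) k)) ∎
      where
      open R using (begin_; _∎; step-≈-⟩; step-≡-⟩; step-≡-⟨)
      P : S.Carrier
      P = S.∏ (allFin ℓ) (λ k → α (lookup g′ k))

  module Characters (X : Fin d → Unit R) where

    χ : ℤ → Vec ℕ d → R.Carrier
    χ j n = X ^[ j · n ]

    χ-+ : ∀ i j n → χ (i ℤ.+ j) n R.≈ χ i n R.* χ j n
    χ-+ i j n = trans
      (R.∏-cong (allFin d) (λ k → trans
        (reflexive (≡.cong (X k ^ᶻ_) (ℤ.*-distribʳ-+ (+ lookup n k) i j)))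
        (R.^ᶻ-homo (X k) (i ℤ.* + lookup n k) (j ℤ.* + lookup n k))))
      (R.∏-* (allFin d) _ _)

    χ-split : ∀ j n {g h} → (g , h) ∈ splitVec n → χ j n R.≈ χ j g R.* χ j h
    χ-split j n {g} {h} gh∈ = trans
      (R.∏-cong (allFin d) (λ k → trans
        (reflexive (≡.cong (X k ^ᶻ_) (≡.trans
          (≡.cong (λ m → j ℤ.* + m) (splitVec-lookup n gh∈ k))
          (ℤ.*-distribˡ-+ j (+ lookup g k) (+ lookup h k)))))
        (R.^ᶻ-homo (X k) (j ℤ.* + lookup g k) (j ℤ.* + lookup h k))))
      (R.∏-* (allFin d) _ _)

    χ-𝟘 : ∀ j → χ j 𝟘 R.≈ R.1#
    χ-𝟘 j = R.∏-1 (allFin d) (λ k → reflexive (≡.cong (X k ^ᶻ_)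
      (≡.trans (≡.cong (λ m → j ℤ.* + m) (Vec.lookup-replicate k 0)) (ℤ.*-zeroʳ j))))

    χ-0 : ∀ n → χ (+ 0) n R.≈ R.1#
    χ-0 n = R.∏-1 (allFin d) (λ k → reflexive (≡.cong (X k ^ᶻ_) (ℤ.*-zeroˡ (+ lookup n k))))

    χ-axis : ∀ j k ℓ → χ j (k ·e ℓ) R.≈ (X ℓ ^ᶻ j) R.^ k
    χ-axis j k ℓ = trans
      (R.∏-allFin-single ℓ _ (λ i i≢ℓ → reflexive (≡.cong (X i ^ᶻ_)
        (≡.trans (≡.cong (λ m → j ℤ.* + m) (lookup-·e′ ℓ k i≢ℓ)) (ℤ.*-zeroʳ j)))))
      (trans (reflexive (≡.cong (λ m → X ℓ ^ᶻ (j ℤ.* + m)) (lookup-·e ℓ k))) (R.^ᶻ-*ℕ (X ℓ) j k))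

  -- The variable u of the axis computation.
  Z : T.Carrier
  Z = U.monomial R.1# 1

  Z*-zero : ∀ f → (Z T.* f) 0 R.≈ R.0#
  Z*-zero f = trans (R.+-identityʳ _) (R.zeroˡ _)

  Z*-suc : ∀ f n → (Z T.* f) (suc n) R.≈ f n
  Z*-suc f n = trans
    (U.∑-single {suc n} (there (∈-map⁺ (λ (i , j) → suc i , j) ([0,n]∈splitℕ n))) (λ i j → Z i R.* f j)
      (λ i j i≢1 → trans (*-congʳ (U.monomial-off-diagonal R.1# i≢1)) (R.zeroˡ _)))
    (R.*-identityˡ _)

  module _ (c : R.Carrier) (f : T.Carrier) where
    private
      expand : ((T.1# T.- U.constant c T.* Z) T.* f) T.≈ (f T.- U.constant c T.* (Z T.* f))
      expand = T.[1-cz]f (U.constant c) Z f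

    linear-zero : ((T.1# T.- U.constant c T.* Z) T.* f) 0 R.≈ f 0
    linear-zero = trans (expand 0) (trans
      (+-congˡ (-‿cong (trans (U.constant-* c (Z T.* f) 0) (trans (*-congˡ (Z*-zero f)) (R.zeroʳ c)))))
      (trans (+-congˡ R.-0#≈0#) (R.+-identityʳ _)))

    linear-suc : ∀ n → ((T.1# T.- U.constant c T.* Z) T.* f) (suc n) R.≈ f (suc n) R.- c R.* f n
    linear-suc n = trans (expand (suc n))
      (+-congˡ (-‿cong (trans (U.constant-* c (Z T.* f) (suc n)) (*-congˡ (Z*-suc f n)))))

  -- The numbers c^m (1 + y + ... + y^m) are the coefficients of 1 / ((1 - c Z)(1 - c y Z)).
  -- Multiplying `f` by 1 - c Z leaves the coefficients σ (c y)^m, and multiplying by 1 - e Z leaves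
  -- only the first of them.
  geometric-series : ∀ {c e y σ} {f : T.Carrier} → e R.≈ c R.* y → f 0 R.≈ R.0# →
    (∀ m → f (suc m) R.≈ σ R.* (c R.^ m R.* R.geometric y (suc m))) →
    (f T.* ((T.1# T.- U.constant c T.* Z) T.* (T.1# T.- U.constant e T.* Z))) T.≈ (U.constant σ T.* Z)
  geometric-series {c} {e} {y} {σ} {f} e≈cy f₀≈0 f₊ n =
    trans (T.x∙yz≈z∙yx f (T.1# T.- U.constant c T.* Z) (T.1# T.- U.constant e T.* Z) n)
          (trans (product n) (sym (U.constant-* σ Z n)))
    where
    open R using (begin_; _∎; step-≈-⟩; step-≈-⟨)
    open R.Solver using (solve; _:=_; _:+_; _:*_; _:-_; :-_; one; zer)
    g : T.Carrier
    g = (T.1# T.- U.constant c T.* Z) T.* f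
    g-zero : g 0 R.≈ R.0#
    g-zero = trans (linear-zero c f) f₀≈0
    g-suc : ∀ m → g (suc m) R.≈ σ R.* (c R.^ m R.* y R.^ m)
    g-suc zero = begin
      g 1                ≈⟨ linear-suc c f 0 ⟩
      f 1 R.- c R.* f 0  ≈⟨ +-cong (f₊ 0) (-‿cong (*-congˡ f₀≈0)) ⟩
      σ R.* (R.1# R.* (R.0# R.+ R.1#)) R.- c R.* R.0#
        ≈⟨ solve 2 (λ σ c → σ :* (one :* (zer :+ one)) :- c :* zer := σ :* (one :* one)) refl σ c ⟩
      σ R.* (R.1# R.* R.1#) ∎
    g-suc (suc m) = begin
      g (suc (suc m))                            ≈⟨ linear-suc c f (suc m) ⟩
      f (suc (suc m)) R.- c R.* f (suc m)        ≈⟨ +-cong (f₊ (suc m)) (-‿cong (*-congˡ (f₊ m))) ⟩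
      σ R.* (c R.^ suc m R.* (q R.+ y R.^ suc m)) R.- c R.* (σ R.* (c R.^ m R.* q))
        ≈⟨ solve 5 (λ σ c a q b → σ :* ((c :* a) :* (q :+ b)) :- c :* (σ :* (a :* q)) := σ :* ((c :* a) :* b))
             refl σ c (c R.^ m) q (y R.^ suc m) ⟩
      σ R.* (c R.^ suc m R.* y R.^ suc m)        ∎
      where
      q : R.Carrier
      q = R.geometric y (suc m)
    product : ∀ n → ((T.1# T.- U.constant e T.* Z) T.* g) n R.≈ σ R.* Z n
    product zero = trans (linear-zero e g) (trans g-zero (sym (R.zeroʳ σ)))
    product (suc zero) = begin
      ((T.1# T.- U.constant e T.* Z) T.* g) 1  ≈⟨ linear-suc e g 0 ⟩
      g 1 R.- e R.* g 0                        ≈⟨ +-cong (g-suc 0) (-‿cong (*-congˡ g-zero)) ⟩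
      σ R.* (R.1# R.* R.1#) R.- e R.* R.0#
        ≈⟨ solve 2 (λ σ e → σ :* (one :* one) :- e :* zer := σ :* one) refl σ e ⟩
      σ R.* R.1# ∎
    product (suc (suc m)) = begin
      ((T.1# T.- U.constant e T.* Z) T.* g) (suc (suc m))  ≈⟨ linear-suc e g (suc m) ⟩
      g (suc (suc m)) R.- e R.* g (suc m)
        ≈⟨ +-cong (g-suc (suc m)) (-‿cong (*-cong e≈cy (g-suc m))) ⟩
      σ R.* ((c R.* c R.^ m) R.* (y R.* y R.^ m)) R.- (c R.* y) R.* (σ R.* (c R.^ m R.* y R.^ m))
        ≈⟨ solve 5 (λ σ c y a b → σ :* ((c :* a) :* (y :* b)) :- (c :* y) :* (σ :* (a :* b)) := σ :* zer)
             refl σ c y (c R.^ m) (y R.^ m) ⟩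
      σ R.* R.0# ∎

  -- The functional equation of the series ρ

  module Family (0<d : 1 ℕ.≤ d) (X : Fin d → Unit R) (w : Unit R)
                (w-equation : ∀ ℓ → value w R.* R.∑ (window d) (X ℓ ^ᶻ_) R.≈ R.1#)
                (1-X^k-regular : ∀ ℓ k → R.Regular (R.1# R.- value (X ℓ) R.^ suc k))
                (α : Vec ℕ d → S.Carrier) (isFamily : IsCoefficientFamily w X α) where
    open IsCoefficientFamily isFamily
    open Characters X
    private
      W : List ℤ
      W = window d

    window-length : length W ≡ suc (2 ℕ.* d)
    window-length = ≡.trans (List.length-applyUpTo (_⊖ d) (2 ℕ.* d ℕ.+ 1)) (ℕ.+-comm (2 ℕ.* d) 1)

    α-off-diagonal : ∀ {n m} → m ≢ n → α n m R.≈ R.0#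
    α-off-diagonal {n} {m} m≢n with isMonomial n
    ... | c , αn≈ = trans (αn≈ m) (M.monomial-off-diagonal c m≢n)

    a : Vec ℕ d → R.Carrier
    a n = α n n

    ρ-coefficient : ∀ j n → ρ X α j n R.≈ a n R.* χ j n
    ρ-coefficient j n = trans
      (M.coefficient-∑∞ (λ i → α i S.* M.constant (χ j i)) n (λ i i≢n →
        trans (M.coefficient-*constant (α i) (χ j i) n)
              (trans (*-congʳ (α-off-diagonal (i≢n ∘ ≡.sym))) (R.zeroˡ _))))
      (M.coefficient-*constant (α n) (χ j n) n)

    ρ-𝟘 : ∀ j → ρ X α j 𝟘 R.≈ R.0#
    ρ-𝟘 j = trans (ρ-coefficient j 𝟘) (trans (*-congʳ (α-zero 𝟘)) (R.zeroˡ _))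

    rhs : ℤ → S.Carrier
    rhs j = M.constant (value w) S.* (S.1# S.- S.∏ W (λ b → S.1# S.- ρ X α (j ℤ.+ b)))

    rhs₀ : S.Carrier
    rhs₀ = M.constant (value w) S.* (S.1# S.- S.∏ W (λ b → S.1# S.- ρ X α b))

    -- Rescaling the coefficient at k ·e ℓ by s^k clears the denominators of
    -- α-axis.
    module Axis (ℓ : Fin d) where
      private
        v y s : R.Carrier
        v = value (X ℓ)
        y = v R.^ d
        s = (R.1# R.- v) R.* (R.1# R.- v R.^ suc d)
        X̂ : Unit (Series.ring R ℕ._≟_ 0 splitℕ)
        X̂ = U.constantUnit (X ℓ)
        L : ℤ → T.Carrier
        L i = T.1# T.- X̂ ^ᶻ i T.* Z
        module P = Pullback R isCR ℕ._≟_ (Vec.≡-dec ℕ._≟_) 0 (replicate d 0) splitℕ splitVec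
                     (splitℕ-isSplitting R isCR) (splitVec-isSplitting R isCR d) (_·e ℓ) (s R.^_)

      suc·e≢𝟘 : ∀ k → suc k ·e ℓ ≢ 𝟘
      suc·e≢𝟘 k p = ℕ.1+n≢0 (≡.trans (≡.sym (lookup-·e ℓ (suc k)))
        (≡.trans (≡.cong (λ n → lookup n ℓ) p) (Vec.lookup-replicate ℓ 0)))

      α₁^k-coefficient : ∀ k → (α (1 ·e ℓ) S.^ k) (k ·e ℓ) R.≈ R.1#
      α₁^k-coefficient zero    = trans (reflexive (≡.cong S.1# (0·e≡𝟘 ℓ))) (M.monomial-diagonal R.1# 𝟘)
      α₁^k-coefficient (suc k) = begin
        (α (1 ·e ℓ) S.* α (1 ·e ℓ) S.^ k) (suc k ·e ℓ)
          ≈⟨ M.∑-single {suc k ·e ℓ} ([1e,ke]∈splitVec ℓ k) (λ i j → α (1 ·e ℓ) i R.* (α (1 ·e ℓ) S.^ k) j)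
               (λ i j i≢ → trans (*-congʳ (α-off-diagonal i≢)) (R.zeroˡ _)) ⟩
        a (1 ·e ℓ) R.* (α (1 ·e ℓ) S.^ k) (k ·e ℓ)
          ≈⟨ *-cong (trans (α-unit ℓ (1 ·e ℓ)) (M.monomial-diagonal R.1# (1 ·e ℓ))) (α₁^k-coefficient k) ⟩
        R.1# R.* R.1#
          ≈⟨ R.*-identityˡ _ ⟩
        R.1# ∎
        where open R using (begin_; _∎; step-≈-⟩)

      1-v^k-regular : ∀ k → 1 ℕ.≤ k → R.Regular (R.1# R.- v R.^ k)
      1-v^k-regular (suc k) _ = 1-X^k-regular ℓ k

      1-v-regular : R.Regular (R.1# R.- v)
      1-v-regular = R.regular-cong (+-congˡ (-‿cong (R.*-identityʳ v))) (1-X^k-regular ℓ 0)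

      s-regular : R.Regular s
      s-regular = R.regular-* 1-v-regular (1-X^k-regular ℓ d)

      -- This is `α-axis` at k = m + 1, whose m-th powers of 1 - x and 1 - x^(d+1) combine to s^m.
      -- Dividing 1 - x^((m+1) d) by 1 - x^d leaves a geometric sum; `0<d` makes that divisor
      -- regular.
      a-axis : ∀ m → a (suc m ·e ℓ) R.* s R.^ m R.≈ v R.^ m R.* R.geometric y (suc m)
      a-axis m = R.regular-cancel (1-v^k-regular d 0<d) (begin
        (R.1# R.- y) R.* (a n R.* s R.^ m)
          ≈⟨ *-congˡ (*-congˡ (R.^-distrib-* _ _ m)) ⟩
        (R.1# R.- y) R.* (a n R.* ((R.1# R.- v) R.^ m R.* (R.1# R.- v R.^ suc d) R.^ m))
          ≈⟨ solve 4 (λ p a q r → p :* (a :* (q :* r)) := a :* (p :* q :* r)) refl _ _ _ _ ⟩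
        a n R.* ((R.1# R.- y) R.* (R.1# R.- v) R.^ m R.* (R.1# R.- v R.^ suc d) R.^ m)
          ≡⟨ ≡.cong (λ k → a n R.* ((R.1# R.- y) R.* (R.1# R.- v) R.^ m R.* (R.1# R.- v R.^ k) R.^ m)) (ℕ.+-comm 1 d) ⟩
        a n R.* D
          ≈⟨ M.coefficient-*constant (α n) D n ⟨
        (α n S.* M.constant D) n
          ≈⟨ α-axis ℓ (suc m) (ℕ.s≤s ℕ.z≤n) n ⟩
        (α (1 ·e ℓ) S.^ suc m S.* M.constant E) n
          ≈⟨ M.coefficient-*constant (α (1 ·e ℓ) S.^ suc m) E n ⟩
        (α (1 ·e ℓ) S.^ suc m) n R.* E
          ≈⟨ *-cong (α₁^k-coefficient (suc m)) (*-congˡ (+-congˡ (-‿cong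
               (trans (reflexive (≡.cong (v R.^_) (ℕ.*-comm (suc m) d))) (sym (R.^-assocʳ v d (suc m))))))) ⟩
        R.1# R.* (v R.^ m R.* (R.1# R.- y R.^ suc m))
          ≈⟨ R.*-identityˡ _ ⟩
        v R.^ m R.* (R.1# R.- y R.^ suc m)
          ≈⟨ *-congˡ (R.[1-y]*geometric y (suc m)) ⟨
        v R.^ m R.* ((R.1# R.- y) R.* R.geometric y (suc m))
          ≈⟨ solve 3 (λ a b c → a :* (b :* c) := b :* (a :* c)) refl _ _ _ ⟩
        (R.1# R.- y) R.* (v R.^ m R.* R.geometric y (suc m)) ∎)
        where
        open R using (begin_; _∎; step-≈-⟩; step-≈-⟨; step-≡-⟩)
        open R.Solver using (solve; _:=_; _:*_)
        n : Vec ℕ d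
        n = suc m ·e ℓ
        D E : R.Carrier
        D = (R.1# R.- y) R.* (R.1# R.- v) R.^ m R.* (R.1# R.- v R.^ (d ℕ.+ 1)) R.^ m
        E = v R.^ m R.* (R.1# R.- v R.^ (suc m ℕ.* d))

      r : ℤ → T.Carrier
      r b = P.pull (ρ X α b)

      r-zero : ∀ b → r b 0 R.≈ R.0#
      r-zero b = trans (R.*-identityˡ _) (trans (reflexive (≡.cong (ρ X α b) (0·e≡𝟘 ℓ))) (ρ-𝟘 b))

      -- `a-axis` absorbs s^m of the scaling s^(m+1). The remaining s goes into the constant σ of
      -- `geometric-series`, and x^(bm) x^m merges into the m-th power of x^(b+1).
      r-suc : ∀ b m → r b (suc m) R.≈
        (s R.* X ℓ ^ᶻ b) R.* ((X ℓ ^ᶻ (b ℤ.+ + 1)) R.^ m R.* R.geometric y (suc m))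
      r-suc b m = begin
        s R.^ suc m R.* ρ X α b (suc m ·e ℓ)
          ≈⟨ *-congˡ (trans (ρ-coefficient b (suc m ·e ℓ)) (*-congˡ (χ-axis b (suc m) ℓ))) ⟩
        (s R.* s R.^ m) R.* (a (suc m ·e ℓ) R.* (c₀ R.* c₀ R.^ m))
          ≈⟨ solve 5 (λ s t a c e → (s :* t) :* (a :* (c :* e)) := (s :* c) :* (e :* (a :* t))) refl _ _ _ _ _ ⟩
        (s R.* c₀) R.* (c₀ R.^ m R.* (a (suc m ·e ℓ) R.* s R.^ m))
          ≈⟨ *-congˡ (*-congˡ (a-axis m)) ⟩
        (s R.* c₀) R.* (c₀ R.^ m R.* (v R.^ m R.* R.geometric y (suc m)))
          ≈⟨ *-congˡ (R.*-assoc _ _ _) ⟨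
        (s R.* c₀) R.* (c₀ R.^ m R.* v R.^ m R.* R.geometric y (suc m))
          ≈⟨ *-congˡ (*-congʳ (trans (R.^-congˡ m (trans (R.^ᶻ-homo (X ℓ) b (+ 1)) (*-congˡ (R.^ᶻ-1 (X ℓ)))))
                                     (R.^-distrib-* c₀ v m))) ⟨
        (s R.* c₀) R.* ((X ℓ ^ᶻ (b ℤ.+ + 1)) R.^ m R.* R.geometric y (suc m)) ∎
        where
        open R using (begin_; _∎; step-≈-⟩; step-≈-⟨)
        open R.Solver using (solve; _:=_; _:*_)
        c₀ : R.Carrier
        c₀ = X ℓ ^ᶻ b

      L≈ : ∀ i → L i T.≈ (T.1# T.- U.constant (X ℓ ^ᶻ i) T.* Z)
      L≈ i = T.+-congˡ {T.1#} {T.- (X̂ ^ᶻ i T.* Z)} (T.-‿cong {X̂ ^ᶻ i T.* Z}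
        (T.*-congʳ {Z} {X̂ ^ᶻ i} (T.sym {U.constant (X ℓ ^ᶻ i)} (U.constantUnit-^ᶻ (X ℓ) i))))

      L-regular : ∀ i → T.Regular (L i)
      L-regular i = monic⇒regular R isCR (trans (+-congˡ (trans
        (-‿cong (trans (R.+-identityʳ _) (R.zeroʳ _))) R.-0#≈0#)) (R.+-identityʳ _))

      -- The factor `s` in the form in which the telescoping argument builds it, from the constant
      -- series v.
      ŝ : T.Carrier
      ŝ = (T.1# T.- U.constant v) T.* (T.1# T.- U.constant v T.^ suc d)

      s≈ŝ : U.constant s T.≈ ŝ
      s≈ŝ = T.trans {U.constant s} (U.constant-homo-* (R.1# R.- v) (R.1# R.- v R.^ suc d))
        (T.*-cong {U.constant (R.1# R.- v)} {T.1# T.- U.constant v} {U.constant (R.1# R.- v R.^ suc d)}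
          (U.constant-homo-minus R.1# v)
          (T.trans {U.constant (R.1# R.- v R.^ suc d)} (U.constant-homo-minus R.1# (v R.^ suc d))
            (T.+-congˡ {T.1#} {T.- U.constant (v R.^ suc d)} (T.-‿cong {U.constant (v R.^ suc d)} (U.constant-homo-^ v (suc d))))))

      r-equation : ∀ b → (r b T.* (L (b ℤ.+ + 1) T.* L (b ℤ.+ + suc d))) T.≈ (ŝ T.* X̂ ^ᶻ b T.* Z)
      r-equation b = begin
        r b T.* (L (b ℤ.+ + 1) T.* L (b ℤ.+ + suc d))
          ≈⟨ T.*-congˡ {r b} (T.*-cong {L (b ℤ.+ + 1)} {_} {L (b ℤ.+ + suc d)} (L≈ (b ℤ.+ + 1)) (L≈ (b ℤ.+ + suc d))) ⟩
        r b T.* ((T.1# T.- U.constant c T.* Z) T.* (T.1# T.- U.constant e T.* Z))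
          ≈⟨ geometric-series {c} {e} {y} e≈cy (r-zero b) (r-suc b) ⟩
        U.constant (s R.* X ℓ ^ᶻ b) T.* Z
          ≈⟨ T.*-congʳ {Z} {U.constant (s R.* X ℓ ^ᶻ b)} (U.constant-homo-* s (X ℓ ^ᶻ b)) ⟩
        U.constant s T.* U.constant (X ℓ ^ᶻ b) T.* Z
          ≈⟨ T.*-congʳ {Z} {U.constant s T.* U.constant (X ℓ ^ᶻ b)} (T.*-cong {U.constant s} s≈ŝ (U.constantUnit-^ᶻ (X ℓ) b)) ⟩
        ŝ T.* X̂ ^ᶻ b T.* Z ∎
        where
        open T using (begin_; _∎; step-≈-⟩)
        c e : R.Carrier
        c = X ℓ ^ᶻ (b ℤ.+ + 1)
        e = X ℓ ^ᶻ (b ℤ.+ + suc d)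
        e≈cy : e R.≈ c R.* y
        e≈cy = trans (reflexive (≡.cong (X ℓ ^ᶻ_) (≡.sym (ℤ.+-assoc b (+ 1) (+ d)))))
                     (R.^ᶻ-homo (X ℓ) (b ℤ.+ + 1) (+ d))

      ŵ-equation : (U.constant (value w) T.* T.∑ W (X̂ ^ᶻ_)) T.≈ T.1#
      ŵ-equation = begin
        U.constant (value w) T.* T.∑ W (X̂ ^ᶻ_)
          ≈⟨ T.*-congˡ {U.constant (value w)} (T.∑-cong W (U.constantUnit-^ᶻ (X ℓ))) ⟨
        U.constant (value w) T.* T.∑ W (λ b → U.constant (X ℓ ^ᶻ b))
          ≈⟨ T.*-congˡ {U.constant (value w)} (U.constant-homo-∑ W (X ℓ ^ᶻ_)) ⟨
        U.constant (value w) T.* U.constant (R.∑ W (X ℓ ^ᶻ_))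
          ≈⟨ U.constant-homo-* (value w) (R.∑ W (X ℓ ^ᶻ_)) ⟨
        U.constant (value w R.* R.∑ W (X ℓ ^ᶻ_))
          ≈⟨ U.constant-cong (w-equation ℓ) ⟩
        T.1# ∎
        where open T using (begin_; _∎; step-≈-⟩; step-≈-⟨)

      pull-constant : ∀ c → P.pull (M.constant c) T.≈ U.constant c
      pull-constant c zero    = trans (R.*-identityˡ _)
        (trans (reflexive (≡.cong (M.constant c) (0·e≡𝟘 ℓ))) (M.monomial-diagonal c 𝟘))
      pull-constant c (suc k) = trans (*-congˡ (M.monomial-off-diagonal c (suc·e≢𝟘 k))) (R.zeroʳ _)

      -- Scaled by s^k, the two sides are the k-th coefficients of the telescoped identity, because
      -- `pull` respects the right-hand side; the regular factor s^k is then cancelled.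
      ρ₀≈rhs₀ : ∀ k → ρ X α (+ 0) (k ·e ℓ) R.≈ rhs₀ (k ·e ℓ)
      ρ₀≈rhs₀ k = R.regular-cancel (R.regular-^ k s-regular) (trans
        (T.r≈w[1-∏[1-r]] d X̂ Z (U.constant (value w)) r L-regular r-equation ŵ-equation k)
        (sym (P.pull-equation (λ n F → ∑-splitVec-·e R isCR ℓ n F)
               (λ n {i} {j} ij∈ → trans (reflexive (≡.cong (s R.^_) (≡.sym (splitℕ-sum n ij∈)))) (R.^-homo-* s i j))
               pull-constant (value w) W (ρ X α) k)))

    module Mixed (n : Vec ℕ d) (mixed : HasTwoNonzeroCoordinates n) where
      private
        N : ℕ
        N = 2 ℕ.* d ℕ.+ 1

      products : ∀ ℓ → Vec (Vec ℕ d) ℓ → Vec ℤ ℓ → R.Carrier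
      products ℓ g b = R.∏ (allFin ℓ) λ k → χ (lookup b k) (lookup g k)

      weights : ∀ ℓ → Vec (Vec ℕ d) ℓ → R.Carrier
      weights ℓ g = R.∏ (allFin ℓ) λ k → a (lookup g k)

      -- For a fixed composition the α-part is the same for every subset of the window, so
      -- exchanging the two sums lets it be taken out.
      esym-coefficient : ∀ ℓ → S.esym (ρ X α) ℓ W n
        R.≈ R.∑ (compositions ℓ n) (λ g → weights ℓ g R.* R.∑ (choose ℓ W) (products ℓ g))
      esym-coefficient ℓ = begin
        S.esym (ρ X α) ℓ W n
          ≡⟨ M.coefficient-∑ (choose ℓ W) _ n ⟩
        R.∑ (choose ℓ W) (λ b → S.∏ (allFin ℓ) (λ k → ρ X α (lookup b k)) n)
          ≈⟨ R.∑-cong (choose ℓ W) (λ b → trans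
               (∏-coefficient ℓ (λ k → ρ X α (lookup b k)) (λ k → ρ-𝟘 (lookup b k)) n)
               (R.∑-cong (compositions ℓ n) (λ g → trans
                 (R.∏-cong (allFin ℓ) (λ k → ρ-coefficient (lookup b k) (lookup g k)))
                 (R.∏-* (allFin ℓ) _ _)))) ⟩
        R.∑ (choose ℓ W) (λ b → R.∑ (compositions ℓ n) (λ g → weights ℓ g R.* products ℓ g b))
          ≈⟨ R.∑-swap (choose ℓ W) (compositions ℓ n) _ ⟩
        R.∑ (compositions ℓ n) (λ g → R.∑ (choose ℓ W) (λ b → weights ℓ g R.* products ℓ g b))
          ≈⟨ R.∑-cong (compositions ℓ n) (λ g → R.*-∑ (choose ℓ W) (weights ℓ g) (products ℓ g)) ⟨
        R.∑ (compositions ℓ n) (λ g → weights ℓ g R.* R.∑ (choose ℓ W) (products ℓ g)) ∎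
        where open R using (begin_; _∎; step-≈-⟩; step-≈-⟨; step-≡-⟩)

      α-term : ∀ ℓ → S.Carrier
      α-term ℓ = S.∑ (compositions ℓ n) λ g →
        S.∏ (allFin ℓ) (λ k → α (lookup g k)) S.*
        S.∑ (choose ℓ W) λ b → S.∏ (allFin ℓ) λ k → M.constant (χ (lookup b k) (lookup g k))

      α-term-coefficient : ∀ ℓ → α-term ℓ n
        R.≈ R.∑ (compositions ℓ n) (λ g → weights ℓ g R.* R.∑ (choose ℓ W) (products ℓ g))
      α-term-coefficient ℓ = trans (reflexive (M.coefficient-∑ (compositions ℓ n) _ n))
        (R.∑-cong-∈ (compositions ℓ n) (λ {g} g∈ → begin
          (A g S.* B g) n
            ≈⟨ S.*-congˡ {A g} {B g} (B≈ g) n ⟩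
          (A g S.* M.constant (R.∑ (choose ℓ W) (products ℓ g))) n
            ≈⟨ M.coefficient-*constant (A g) _ n ⟩
          A g n R.* R.∑ (choose ℓ W) (products ℓ g)
            ≈⟨ *-congʳ (∏α-coefficient α α-off-diagonal ℓ n g∈) ⟩
          weights ℓ g R.* R.∑ (choose ℓ W) (products ℓ g) ∎))
        where
        open R using (begin_; _∎; step-≈-⟩)
        A B : Vec (Vec ℕ d) ℓ → S.Carrier
        A g = S.∏ (allFin ℓ) (λ k → α (lookup g k))
        B g = S.∑ (choose ℓ W) λ b → S.∏ (allFin ℓ) λ k → M.constant (χ (lookup b k) (lookup g k))
        B≈ : ∀ g → B g S.≈ M.constant (R.∑ (choose ℓ W) (products ℓ g))
        B≈ g = S.sym {M.constant (R.∑ (choose ℓ W) (products ℓ g))} {B g} (S.trans {M.constant (R.∑ (choose ℓ W) (products ℓ g))}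
          (M.constant-homo-∑ (choose ℓ W) (products ℓ g))
          (S.∑-cong (choose ℓ W) (λ b → M.constant-homo-∏ (allFin ℓ) (λ k → χ (lookup b k) (lookup g k)))))

      signed : (ℕ → S.Carrier) → S.Carrier
      signed F = S.∑ (range 2 N) (λ ℓ → (S.- S.1#) S.^ ℓ S.* F ℓ)

      signed-coefficient : ∀ F → signed F n R.≈ R.∑ (range 2 N) (λ ℓ → (R.- R.1#) R.^ ℓ R.* F ℓ n)
      signed-coefficient F = trans (reflexive (M.coefficient-∑ (range 2 N) _ n))
        (R.∑-cong (range 2 N) (λ ℓ → M.coefficient-sign ℓ (F ℓ) n))

      Q : R.Carrier
      Q = R.∑ W (λ b → χ b n)

      -- At exponent n the higher elementary symmetric polynomials of the ρ_b have the coefficients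
      -- of the right-hand side of `α-mixed`, so the recursion evaluates them.
      signed-esym : signed (λ ℓ → S.esym (ρ X α) ℓ W) n R.≈ a n R.* (R.- inverse w R.+ Q)
      signed-esym = begin
        signed (λ ℓ → S.esym (ρ X α) ℓ W) n
          ≈⟨ signed-coefficient _ ⟩
        R.∑ (range 2 N) (λ ℓ → (R.- R.1#) R.^ ℓ R.* S.esym (ρ X α) ℓ W n)
          ≈⟨ R.∑-cong (range 2 N) (λ ℓ → *-congˡ (trans (esym-coefficient ℓ) (sym (α-term-coefficient ℓ)))) ⟩
        R.∑ (range 2 N) (λ ℓ → (R.- R.1#) R.^ ℓ R.* α-term ℓ n)
          ≈⟨ signed-coefficient α-term ⟨
        signed α-term n
          ≈⟨ α-mixed n mixed n ⟨
        (α n S.* M.constant (R.- inverse w R.+ Q)) n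
          ≈⟨ M.coefficient-*constant (α n) (R.- inverse w R.+ Q) n ⟩
        a n R.* (R.- inverse w R.+ Q) ∎
        where open R using (begin_; _∎; step-≈-⟩; step-≈-⟨)

      1-∏[1-ρ] : (S.1# S.- S.∏ W (λ b → S.1# S.- ρ X α b)) n R.≈ a n R.* Q R.- a n R.* (R.- inverse w R.+ Q)
      1-∏[1-ρ] = begin
        (S.1# S.- S.∏ W (λ b → S.1# S.- ρ X α b)) n
          ≈⟨ S.1-∏[1-f] (ρ X α) W (2 ℕ.* d) (ℕ.≤-reflexive window-length) n ⟩
        S.∑ W (ρ X α) n R.- S.∑ (range 2 (suc (2 ℕ.* d))) (λ ℓ → (S.- S.1#) S.^ ℓ S.* S.esym (ρ X α) ℓ W) n
          ≡⟨ ≡.cong (λ m → S.∑ W (ρ X α) n R.- S.∑ (range 2 m) (λ ℓ → (S.- S.1#) S.^ ℓ S.* S.esym (ρ X α) ℓ W) n) (ℕ.+-comm 1 (2 ℕ.* d)) ⟩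
        S.∑ W (ρ X α) n R.- signed (λ ℓ → S.esym (ρ X α) ℓ W) n
          ≈⟨ +-cong (trans (reflexive (M.coefficient-∑ W (ρ X α) n))
                      (trans (R.∑-cong W (λ b → ρ-coefficient b n)) (sym (R.*-∑ W (a n) _))))
                    (-‿cong signed-esym) ⟩
        a n R.* Q R.- a n R.* (R.- inverse w R.+ Q) ∎
        where open R using (begin_; _∎; step-≈-⟩; step-≡-⟩)

      ρ₀≈rhs₀ : ρ X α (+ 0) n R.≈ rhs₀ n
      ρ₀≈rhs₀ = begin
        ρ X α (+ 0) n                  ≈⟨ ρ-coefficient (+ 0) n ⟩
        a n R.* χ (+ 0) n              ≈⟨ *-congˡ (χ-0 n) ⟩
        a n R.* R.1#                   ≈⟨ *-congˡ (isInverse w) ⟨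
        a n R.* (value w R.* inverse w)
          -- The window sum `Q` drops out: the linear part contributes a Q and the higher degrees
          -- take away a Q - a/w, leaving a/w.
          ≈⟨ solve 4 (λ a w i q → a :* (w :* i) := w :* (a :* q :- a :* (:- i :+ q))) refl (a n) (value w) (inverse w) Q ⟩
        value w R.* (a n R.* Q R.- a n R.* (R.- inverse w R.+ Q))
          ≈⟨ *-congˡ 1-∏[1-ρ] ⟨
        value w R.* (S.1# S.- S.∏ W (λ b → S.1# S.- ρ X α b)) n
          ≈⟨ M.constant-* (value w) (S.1# S.- S.∏ W (λ b → S.1# S.- ρ X α b)) n ⟨
        rhs₀ n ∎
        where
        open R using (begin_; _∎; step-≈-⟩; step-≈-⟨)
        open R.Solver using (solve; _:=_; _:+_; _:*_; _:-_; :-_)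

    ρ₀≈rhs₀ : ρ X α (+ 0) S.≈ rhs₀
    ρ₀≈rhs₀ n with shape n
    -- The origin lies on every axis, and `0<d` supplies one.
    ... | zero ≡.refl     = ≡.subst (λ m → ρ X α (+ 0) m R.≈ rhs₀ m) (0·e≡𝟘 ℓ) (Axis.ρ₀≈rhs₀ ℓ 0)
      where
      ℓ : Fin d
      ℓ = Fin.fromℕ< 0<d
    ... | axis ℓ k ≡.refl = Axis.ρ₀≈rhs₀ ℓ (suc k)
    ... | mixed n-mixed   = Mixed.ρ₀≈rhs₀ n n-mixed

    module Twist (j : ℤ) where
      private
        module P = Pullback R isCR (Vec.≡-dec ℕ._≟_) (Vec.≡-dec ℕ._≟_) (replicate d 0) (replicate d 0) splitVec splitVec
                     (splitVec-isSplitting R isCR d) (splitVec-isSplitting R isCR d) (λ n → n) (χ j)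

      pull-constant : ∀ c → P.pull (M.constant c) S.≈ M.constant c
      pull-constant c n with n ≟ᵛ 𝟘
      ... | yes ≡.refl = trans (*-congʳ (χ-𝟘 j)) (R.*-identityˡ c)
      ... | no  _      = R.zeroʳ _

      pull-ρ : ∀ b → P.pull (ρ X α b) S.≈ ρ X α (j ℤ.+ b)
      pull-ρ b n = begin
        χ j n R.* ρ X α b n              ≈⟨ *-congˡ (ρ-coefficient b n) ⟩
        χ j n R.* (a n R.* χ b n)        ≈⟨ solve 3 (λ c a e → c :* (a :* e) := a :* (c :* e)) refl _ _ _ ⟩
        a n R.* (χ j n R.* χ b n)        ≈⟨ *-congˡ (χ-+ j b n) ⟨
        a n R.* χ (j ℤ.+ b) n            ≈⟨ ρ-coefficient (j ℤ.+ b) n ⟨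
        ρ X α (j ℤ.+ b) n                ∎
        where
        open R using (begin_; _∎; step-≈-⟩; step-≈-⟨)
        open R.Solver using (solve; _:=_; _:*_)

      ρ≈rhs : ρ X α j S.≈ rhs j
      ρ≈rhs = begin
        ρ X α j                ≡⟨ ≡.cong (ρ X α) (ℤ.+-identityʳ j) ⟨
        ρ X α (j ℤ.+ + 0)      ≈⟨ pull-ρ (+ 0) ⟨
        P.pull (ρ X α (+ 0))   ≈⟨ (λ n → *-congˡ (ρ₀≈rhs₀ n)) ⟩
        P.pull rhs₀            ≈⟨ P.pull-equation (λ _ _ → refl) (λ n ij∈ → χ-split j n ij∈) pull-constant (value w) W (ρ X α) ⟩
        M.constant (value w) S.* (S.1# S.- S.∏ W (λ b → S.1# S.- P.pull (ρ X α b)))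
          ≈⟨ S.*-congˡ {M.constant (value w)} (S.+-congˡ {S.1#} (S.-‿cong (S.∏-cong W (λ b → S.+-congˡ {S.1#} (S.-‿cong (pull-ρ b)))))) ⟩
        rhs j ∎
        where open S using (begin_; _∎; step-≈-⟩; step-≈-⟨; step-≡-⟨)

    open Twist public using (ρ≈rhs)

    module _ {q t z : R.Carrier} (w≈q : value w R.≈ q) (q≈zt²ᵈ : q R.≈ z R.* t R.^ (2 ℕ.* d))
             (t-equation : t R.≈ R.1# R.+ q R.* t) where
      open Coefficients R d using (Tⱼ)

      factored : ∀ j → ρ X α j S.≈ (M.constant q S.* (S.1# S.- S.∏ W (λ b → S.1# S.- ρ X α (j ℤ.+ b))))
      factored j = S.trans {ρ X α j} {rhs j} (ρ≈rhs j)
        (S.*-congʳ {S.1# S.- S.∏ W (λ b → S.1# S.- ρ X α (j ℤ.+ b))} {M.constant (value w)} {M.constant q} (M.constant-cong w≈q))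

      expansion : ∀ j → ρ X α j S.≈ (M.constant q S.* S.∑ (range 1 (2 ℕ.* d ℕ.+ 1)) (λ ℓ →
        (S.- S.1#) S.^ (ℓ ℕ.∸ 1) S.* S.∑ (choose ℓ W) (λ b → S.∏ (allFin ℓ) (λ k → ρ X α (j ℤ.+ lookup b k)))))
      expansion j = S.trans {ρ X α j} (factored j) (S.*-congˡ {M.constant q}
        (S.inclusion-exclusion (λ b → ρ X α (j ℤ.+ b)) W (2 ℕ.* d ℕ.+ 1)
          (ℕ.≤-reflexive (List.length-applyUpTo (_⊖ d) (2 ℕ.* d ℕ.+ 1)))))

      recurrence : ∀ j → Tⱼ X α t j S.≈ (S.1# S.+ M.constant z S.* S.∏ W (λ b → Tⱼ X α t (j ℤ.+ b)))
      recurrence j = S.tree-recurrence (M.constant t) (M.constant z) (M.constant q) W (λ b → ρ X α (j ℤ.+ b))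
        (λ n → trans (M.constant-cong t-equation n) (trans (M.constant-homo-+ R.1# (q R.* t) n)
          (+-congˡ (M.constant-homo-* q t n))))
        (λ n → trans (sym (M.constant-homo-* q t n)) (trans (M.constant-cong qt≈ n)
          (trans (M.constant-homo-* z (t R.^ length W) n)
                 (S.*-congˡ {M.constant z} {M.constant (t R.^ length W)} (M.constant-homo-^ t (length W)) n))))
        (factored j)
        where
        open R using (begin_; _∎; step-≈-⟩; step-≡-⟨)
        qt≈ : q R.* t R.≈ z R.* t R.^ length W
        qt≈ = begin
          q R.* t                          ≈⟨ *-congʳ q≈zt²ᵈ ⟩
          z R.* t R.^ (2 ℕ.* d) R.* t      ≈⟨ R.*-assoc _ _ _ ⟩
          z R.* (t R.^ (2 ℕ.* d) R.* t)    ≈⟨ *-congˡ (R.*-comm _ _) ⟩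
          z R.* t R.^ suc (2 ℕ.* d)        ≡⟨ ≡.cong (λ m → z R.* t R.^ m) window-length ⟨
          z R.* t R.^ length W             ∎

-- From an arbitrary commutative ring to the Puiseux series

record IsTreeSystem (R : RawRing 0ℓ 0ℓ) (d : ℕ) (X : Fin d → Unit R) (w : Unit R)
                    (q t z : RawRing.Carrier R) : Set where
  open RawRing R
  open Notation R
  field
    X-equation : ∀ i → 1# ≈ q * ∑ (window d) (X i ^ᶻ_)
    regular    : ∀ i k v → (1# - value (X i) ^ suc k) * v ≈ 0# → v ≈ 0#
    w-value    : value w ≈ q
    q-value    : q ≈ z * t ^ (2 ℕ.* d)
    t-equation : t ≈ 1# + q * t

open Coefficients using (module K⟦α⟧; IsCoefficientFamily; constant; ρ; Tⱼ)
open K⟦α⟧ using (Carrier; _≈_; _+_; _*_; -_; 1#; _^_; ∑; ∏)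

-- The claim follows from the identities in `IsTreeSystem` over any commutative ring, where the
-- positive order of the small solutions appears only as regularity of the elements 1 - x^(k+1). The
-- representation of Puiseux series stays out of the computation.
tree-system-solution :
  (R : RawRing 0ℓ 0ℓ) (isCR : IsCommutativeRawRing R) →
  (d : ℕ) → 1 ℕ.≤ d →
  (X : Fin d → Unit R) (w : Unit R) {q t z : RawRing.Carrier R} → IsTreeSystem R d X w q t z →
  (α : Vec ℕ d → Carrier R d) → IsCoefficientFamily R d w X α →
  (∀ j → _≈_ R d
    (Tⱼ R d X α t j)
    (_+_ R d (1# R d)
      (_*_ R d (constant R d z) (∏ R d (window d) (λ ℓ → Tⱼ R d X α t (j ℤ.+ ℓ))))))
  ×
  (∀ j → _≈_ R d
    (ρ R d X α j)
    (_*_ R d (constant R d q) (∑ R d (range 1 (2 ℕ.* d ℕ.+ 1)) (λ ℓ →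
      _*_ R d (_^_ R d (-_ R d (1# R d)) (ℓ ℕ.∸ 1)) (∑ R d (choose ℓ (window d)) (λ b →
        ∏ R d (allFin ℓ) (λ k → ρ R d X α (j ℤ.+ lookup b k))))))))
tree-system-solution R isCR d 0<d X w tree α isFamily =
  recurrence w-value q-value t-equation , expansion w-value q-value t-equation
  where
  open IsTreeSystem tree
  open RingTheory R isCR using (trans; sym; *-congʳ)
  open FamilyTheory.Family R isCR d 0<d X w
    (λ i → trans (*-congʳ w-value) (sym (X-equation i))) regular α isFamily

isTreeSystem : ∀ d T → IsTreeSeries d T → ∀ X → AreTheSmallSolutions d T X →
  ∀ w → value w K.≈ zT²ᵈ d T → IsTreeSystem K d X w (zT²ᵈ d T) (embed T) (embed z)
isTreeSystem d T (_ , T-equation) X (X-small , _) w w≈zT²ᵈ = record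
  { X-equation = λ i → proj₂ (X-small i)
  ; regular    = λ i → P.1-x^k-regular (value (X i)) (proj₁ (X-small i))
  ; w-value    = w≈zT²ᵈ
  ; q-value    = RingTheory.refl K K-isCommutativeRing {zT²ᵈ d T}
  -- Ramification 1 because `embed` is `root 1` by definition.
  ; t-equation = P.root-tree-equation 1 z T (2 ℕ.* d) T-equation
  }
  where module P = PuiseuxTheory ℂ ℂ-isCommutativeRing

proposition1 :
  (d : ℕ) → 1 ℕ.≤ d →
  (T : ℂ⟦z⟧.Carrier) → IsTreeSeries d T →
  (X : Fin d → Unit K) → AreTheSmallSolutions d T X →
  (w : Unit K) → value w K.≈ zT²ᵈ d T →
  (α : Vec ℕ d → Carrier K d) → IsCoefficientFamily K d w X α →
  (∀ j → _≈_ K d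
    (Tⱼ K d X α (embed T) j)
    (_+_ K d (1# K d)
      (_*_ K d (constant K d (embed z)) (∏ K d (window d) (λ ℓ → Tⱼ K d X α (embed T) (j ℤ.+ ℓ))))))
  ×
  (∀ j → _≈_ K d
    (ρ K d X α j)
    (_*_ K d (constant K d (zT²ᵈ d T)) (∑ K d (range 1 (2 ℕ.* d ℕ.+ 1)) (λ ℓ →
      _*_ K d (_^_ K d (-_ K d (1# K d)) (ℓ ℕ.∸ 1)) (∑ K d (choose ℓ (window d)) (λ b →
        ∏ K d (allFin ℓ) (λ k → ρ K d X α (j ℤ.+ lookup b k))))))))
proposition1 d 0<d T T-tree X X-small w w≈zT²ᵈ =
  tree-system-solution K K-isCommutativeRing d 0<d X w (isTreeSystem d T T-tree X X-small w w≈zT²ᵈ)
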